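{- Let $n\ge1$, let $\mathcal{I}^2_n$ be the ideal of $\mathbb{Q}[x_1,y_1,\dots,x_n,y_n]$ generated by all $B$-quasisymmetric polynomials with zero constant term, and let $\mathcal{Q}_n=\mathbb{Q}[x_1,y_1,\dots,x_n,y_n]/\mathcal{I}^2_n$. Then the images of the monomials in $$\mathcal{B}_n=\{x_1^{v_1}y_1^{v_2}\cdots x_n^{v_{2n-1}}y_n^{v_{2n}} \;:\; v=(v_1,\dots,v_{2n})\in\mathbb{Z}_{\ge0}^{2n} \text{ is 2-Dyck}\}$$ form a basis of $\mathcal{Q}_n$; consequently $\dim\mathcal{Q}_n=\frac{1}{2n+1}\binom{3n}{n}$. Moreover, $\mathcal{I}^2_n$ is bihomogeneous, so $\mathcal{Q}_n$ is bigraded by (degree in the $x$'s, degree in the $y$'s), and the subspace $\mathbf{H}_{k,l}(\mathcal{Q}_n)$ of elements of bidegree $(k,l)$ satisfies $$\dim \mathbf{H}_{k,l}(\mathcal{Q}_n)=\binom{n+k-1}{k}\binom{n+l-1}{l}\frac{n-k-l}{n}.$$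
   Context: A bivector of size $k$ is a vector $c=(c_1,\dots,c_{2k})$ of nonnegative integers; a bicomposition is a bivector with no two consecutive entries both $0$ (the empty one allowed). Write $|c|=\sum c_j$. For a bicomposition $c$ of size $k$, $F_c(x_1,y_1,\dots,x_n,y_n)=\sum\prod_{r=1}^{|c|}z_r$, where positions $1,\dots,|c|$ are split into consecutive runs of lengths $c_1,\dots,c_{2k}$, runs $2t-1,2t$ forming block $t$; the sum runs over $1\le m_1\le\dots\le m_{|c|}\le n$ with $m_r<m_{r+1}$ whenever $r$ is the last position of a block, and $z_r=x_{m_r}$ (resp. $y_{m_r}$) if $r$ is in an odd-indexed (resp. even-indexed) run; $F_c=0$ if $k>n$, $F_\emptyset=1$. $B$-quasisymmetric polynomials are the elements of the $\mathbb{Q}$-span of the $F_c$. A vector $v=(v_1,\dots,v_{2n})$ of nonnegative integers is called 2-Dyck if $v_1+v_2+\dots+v_{2l}\le l-1$ for every $l=1,\dots,n$ (equivalently, the lattice path starting at $(0,0)$ which, for each entry $v_i$ read left to right, takes $v_i$ steps $(2,0)$ followed by one step $(0,1)$, never enters the region $x>y$... i.e. stays above the diagonal); otherwise $v$ is called transdiagonal.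
   Formalization: The formula for the dimension of the bidegree (k,l) part is stated for k+l ≤ n only; for k+l > n its right-hand side is negative (n=1, k=2, l=0 gives −1), so it cannot be a dimension there. -}

module Defs where

open import Data.Nat using (ℕ; zero; suc; _+_; _∸_; _≤_)
open import Data.Nat.ListAction using (sum)
open import Data.Unit using (⊤)
open import Data.Nat.Properties using () renaming (_≟_ to _≟ℕ_)
open import Data.Bool using (Bool; true; false; if_then_else_)
open import Data.Product using (_×_; _,_; proj₁; proj₂; ∃; ∃-syntax; Σ)
import Data.Product.Properties as ProdP
open import Data.List as L using (List; []; _∷_; _++_; upTo; drop; take; replicate; concatMap)
open import Data.List.Relation.Unary.All using (All)
open import Data.Vec as V using (Vec; []; _∷_; toList)
import Data.Vec.Properties as VecP
open import Data.Rational using (ℚ; 0ℚ; 1ℚ) renaming (_+_ to _+ℚ_; _*_ to _*ℚ_; -_ to -ℚ_)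
open import Relation.Binary.PropositionalEquality using (_≡_)
open import Relation.Binary.Definitions using (DecidableEquality)
open import Relation.Nullary using (¬_; yes; no)

-- Polynomials in Q[x_1,y_1,...,x_n,y_n].
-- A monomial x_1^{a_1} y_1^{b_1} ... x_n^{a_n} y_n^{b_n} is encoded by its
-- exponent vector, grouped in pairs: (a_1,b_1) ∷ ... ∷ (a_n,b_n).
-- (Thus v = (v_1,...,v_{2n}) corresponds to (v_1,v_2) ∷ ... ∷ (v_{2n-1},v_{2n}).)

Mono : ℕ → Set
Mono n = Vec (ℕ × ℕ) n

_≟M_ : ∀ {n} → DecidableEquality (Mono n)
_≟M_ = VecP.≡-dec (ProdP.≡-dec _≟ℕ_ _≟ℕ_)

Poly : ℕ → Set
Poly n = List (ℚ × Mono n)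

coeff : ∀ {n} → Poly n → Mono n → ℚ
coeff [] e = 0ℚ
coeff ((q , m) ∷ p) e with m ≟M e
... | yes _ = q +ℚ coeff p e
... | no  _ = coeff p e

_≈P_ : ∀ {n} → Poly n → Poly n → Set
p ≈P q = ∀ e → coeff p e ≡ coeff q e

zeroMono : ∀ n → Mono n
zeroMono n = V.replicate n (0 , 0)

0P : ∀ {n} → Poly n
0P = []

1P : ∀ {n} → Poly n
1P {n} = (1ℚ , zeroMono n) ∷ []

_+P_ : ∀ {n} → Poly n → Poly n → Poly n
p +P q = p ++ q

scaleP : ∀ {n} → ℚ → Poly n → Poly n
scaleP c p = L.map (λ t → c *ℚ proj₁ t , proj₂ t) p

-P_ : ∀ {n} → Poly n → Poly n
-P p = L.map (λ t → -ℚ proj₁ t , proj₂ t) p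

_-P_ : ∀ {n} → Poly n → Poly n → Poly n
p -P q = p +P (-P q)

mulMono : ∀ {n} → Mono n → Mono n → Mono n
mulMono = V.zipWith (λ a b → proj₁ a + proj₁ b , proj₂ a + proj₂ b)

_*P_ : ∀ {n} → Poly n → Poly n → Poly n
p *P q = concatMap (λ s → L.map (λ t → proj₁ s *ℚ proj₁ t , mulMono (proj₂ s) (proj₂ t)) q) p

sumP : ∀ {n} → List (Poly n) → Poly n
sumP = L.foldr _+P_ 0P

-- the variable x_{j+1} (if b = true) or y_{j+1} (if b = false), 0-based j
varMono : ∀ n → Bool → ℕ → Mono n
varMono zero    b j       = []
varMono (suc n) true  zero    = (1 , 0) ∷ zeroMono n
varMono (suc n) false zero    = (0 , 1) ∷ zeroMono n
varMono (suc n) b     (suc j) = (0 , 0) ∷ varMono n b j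

var : ∀ n → Bool → ℕ → Poly n
var n b j = (1ℚ , varMono n b j) ∷ []

monoP : ∀ {n} → Mono n → Poly n
monoP e = (1ℚ , e) ∷ []

xdeg : ∀ {n} → Mono n → ℕ
xdeg e = sum (toList (V.map proj₁ e))

ydeg : ∀ {n} → Mono n → ℕ
ydeg e = sum (toList (V.map proj₂ e))

BiHom : ∀ {n} → ℕ → ℕ → Poly n → Set
BiHom k l p = ∀ e → ¬ (coeff p e ≡ 0ℚ) → (xdeg e ≡ k × ydeg e ≡ l)

bicomp : ∀ {n} → ℕ → ℕ → Poly n → Poly n
bicomp k l [] = []
bicomp k l ((q , e) ∷ p) with xdeg e ≟ℕ k | ydeg e ≟ℕ l
... | yes _ | yes _ = (q , e) ∷ bicomp k l p
... | _     | _     = bicomp k l p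

-- Bivectors / bicompositions.  A bivector (c_1,...,c_{2k}) of size k is
-- encoded as the list of its blocks (c_1,c_2) ∷ ... ∷ (c_{2k-1},c_{2k}).

Bivector : Set
Bivector = List (ℕ × ℕ)

flatten : Bivector → List ℕ
flatten [] = []
flatten ((a , b) ∷ c) = a ∷ b ∷ flatten c

NoConsecZeros : List ℕ → Set
NoConsecZeros [] = ⊤
NoConsecZeros (a ∷ []) = ⊤
NoConsecZeros (a ∷ b ∷ w) = ¬ (a ≡ 0 × b ≡ 0) × NoConsecZeros (b ∷ w)

IsBicomposition : Bivector → Set
IsBicomposition c = NoConsecZeros (flatten c)

-- the letters of a block: c_{2t-1} letters x (true) then c_{2t} letters y (false)
blockWord : ℕ × ℕ → List Bool
blockWord (a , b) = replicate a true ++ replicate b false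

markEnd : List Bool → List (Bool × Bool)
markEnd [] = []
markEnd (z ∷ []) = (z , true) ∷ []
markEnd (z ∷ w@(_ ∷ _)) = (z , false) ∷ markEnd w

-- positions 1..|c|: (letter, is-last-position-of-its-block)
word : Bivector → List (Bool × Bool)
word c = concatMap (λ blk → markEnd (blockWord blk)) c

-- sum over m_r ≥ i, ..., weakly increasing, strictly after block ends, all < n (0-based)
Fsum : ∀ n → List (Bool × Bool) → ℕ → Poly n
Fsum n [] i = 1P
Fsum n ((b , end) ∷ w) i =
  sumP (L.map (λ j → var n b j *P Fsum n w (if end then suc j else j)) (drop i (upTo n)))

F : ∀ n → Bivector → Poly n
F n c = Fsum n (word c) 0

BQSym : ∀ n → Poly n → Set
BQSym n f = ∃[ cs ] (All (λ t → IsBicomposition (proj₂ t)) cs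
                     × f ≈P sumP (L.map (λ t → scaleP (proj₁ t) (F n (proj₂ t))) cs))

InI : ∀ n → Poly n → Set
InI n p = ∃[ gs ] (All (λ t → BQSym n (proj₂ t) × coeff (proj₂ t) (zeroMono n) ≡ 0ℚ) gs
                   × p ≈P sumP (L.map (λ t → proj₁ t *P proj₂ t) gs))

pairSum : List (ℕ × ℕ) → ℕ
pairSum [] = 0
pairSum ((a , b) ∷ w) = a + b + pairSum w

TwoDyck : ∀ {n} → Mono n → Set
TwoDyck {n} v = ∀ l → 1 ≤ l → l ≤ n → pairSum (take l (toList v)) ≤ l ∸ 1

lincomb : ∀ {n N} → Vec ℚ N → Vec (Poly n) N → Poly n
lincomb qs bs = sumP (toList (V.zipWith scaleP qs bs))

IsBasisMod : ∀ {n N} → (Poly n → Set) → (Poly n → Set) → Vec (Poly n) N → Set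
IsBasisMod {n} {N} I S bs =
  (∀ p → S p → ∃[ qs ] I (p -P lincomb qs bs))
  × (∀ (qs : Vec ℚ N) → I (lincomb qs bs) → ∀ i → V.lookup qs i ≡ 0ℚ)

{-
Order the variables x₁, y₁, x₂, y₂, … in one sequence, so that fundamental B-quasisymmetric
polynomials correspond to words of signed runs.

Spanning.  Let I_t be generated by the fundamental polynomials whose leading monomial violates, at
its last variable, the 2-Dyck condition relaxed by t.  If u is the first variable and a > 0, then u^a
times the polynomial of a word β in the other variables is, up to lower powers of u, the polynomial
of β preceded by a run of length a; for a = 0 the polynomial of β lies in the ideal itself.  So
induction on the number of variables and on the exponent of u reduces every monomial to 2-Dyck ones.

Independence.  The operators f ↦ (f(…,u,0,0,…) − f(…,0,0,u,…)) / u remove two variables and satisfy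
a Leibniz rule for which B-quasisymmetric polynomials are constants; hence they map the ideal to the
ideal, and they preserve 2-Dyck polynomials.  By induction a 2-Dyck polynomial of the ideal is killed
by all of them, so the coefficient of a monomial does not change when its first nonzero exponent is
moved two places to the left.  Eventually this yields a monomial which is not 2-Dyck, so all
coefficients vanish.

Dimensions.  Removing the last entry of a 2-Dyck vector gives a recurrence for their numbers.
-}
module Submission where

open import Defs
open import Data.Nat using (ℕ; zero; suc; _+_; _*_; _∸_; _≤_; _<_; z≤n; s≤s; s≤s⁻¹)
import Data.Nat.Properties as ℕ
open import Data.Nat.Combinatorics using (_C_; k>n⇒nCk≡0; nCk+nC[k+1]≡[n+1]C[k+1])
open import Data.Nat.Solver renaming (module +-*-Solver to ℕ-Solver)
open import Data.Rational using (ℚ; 0ℚ; 1ℚ) renaming (_+_ to _+ℚ_; _*_ to _*ℚ_; -_ to -ℚ_)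
import Data.Rational.Properties as ℚ
open import Data.Rational.Solver using (module +-*-Solver)
open import Data.Bool using (Bool; true; false; not; if_then_else_)
open import Data.Bool.Properties using (not-involutive)
open import Data.Unit using (⊤; tt)
open import Data.Empty using (⊥; ⊥-elim)
open import Data.Fin using (Fin; zero; suc)
open import Data.Product using (_×_; _,_; proj₁; proj₂; ∃-syntax; map₁)
open import Data.Sum using (_⊎_; inj₁; inj₂)
open import Data.List as L using (List; []; _∷_; _++_; concatMap; drop; upTo; applyUpTo; replicate)
import Data.List.Properties as L
open import Data.List.Membership.Propositional using (_∈_)
open import Data.List.Membership.Propositional.Properties
  using (∈-map⁺; ∈-map⁻; ∈-++⁺ˡ; ∈-++⁺ʳ; ∈-++⁻)
open import Data.List.Relation.Unary.All as All using (All; []; _∷_)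
import Data.List.Relation.Unary.All.Properties as All
open import Data.List.Relation.Unary.AllPairs using ([]; _∷_)
open import Data.List.Relation.Unary.Any using (here; there)
open import Data.List.Relation.Unary.Unique.Propositional using (Unique)
import Data.List.Relation.Unary.Unique.Propositional.Properties as Unique
open import Data.Vec as V using (Vec; []; _∷_; _∷ʳ_; lookup)
import Data.Vec.Properties as V
open import Algebra.Properties.CommutativeSemigroup ℕ.+-commutativeSemigroup using (interchange)
open import Function using (_∘_; id)
open import Relation.Binary.PropositionalEquality
  using (_≡_; _≢_; refl; sym; trans; cong; cong₂; subst; subst₂; module ≡-Reasoning)
open import Relation.Nullary using (¬_; Dec; yes; no; does)
open import Relation.Nullary.Decidable using (_×-dec_; dec-true; dec-false)

-- A pair of variables allows one more factor, so slack is counted in halves of a factor. Deleting a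
-- first variable with exponent `a` turns slack `t` into `t - 2a + 1`; hence the spanning statement
-- is proved for every `t` and for either colour of the first variable, although only `t = 0` is
-- wanted. The same balance explains why the divided differences remove exactly two variables: two
-- vanishing variables are worth slack 2, the price of the factor `u` divided out, and dropping two
-- neighbours keeps the colours alternating. Forbidding consecutive zeros in a bicomposition means
-- that no block ends between an x and a following y. So the order conditions on the letters become:
-- weakly increasing in the one sequence of variables inside a run, strictly increasing from run to
-- run. Independence is proved dually. For each exponent vector a functional is built that vanishes
-- on the ideal and reads off the corresponding coefficient of 2-Dyck polynomials; the divided
-- differences act on such functionals by transposition.

private variable
  A B M : Set
  n N : ℕ

-- Polynomials as linear functionals

∑ : List A → (A → ℚ) → ℚ
∑ []       f = 0ℚ
∑ (x ∷ xs) f = f x +ℚ ∑ xs f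

∑-congAll : ∀ {f g : A → ℚ} {xs} → All (λ x → f x ≡ g x) xs → ∑ xs f ≡ ∑ xs g
∑-congAll []         = refl
∑-congAll (eq ∷ eqs) = cong₂ _+ℚ_ eq (∑-congAll eqs)

∑-cong : ∀ {f g : A → ℚ} xs → (∀ x → f x ≡ g x) → ∑ xs f ≡ ∑ xs g
∑-cong xs eq = ∑-congAll (All.universal eq xs)

∑-0 : ∀ (xs : List A) → ∑ xs (λ _ → 0ℚ) ≡ 0ℚ
∑-0 []       = refl
∑-0 (x ∷ xs) = trans (ℚ.+-identityˡ _) (∑-0 xs)

∑-zero : ∀ {f : A → ℚ} {xs} → All (λ x → f x ≡ 0ℚ) xs → ∑ xs f ≡ 0ℚ
∑-zero {xs = xs} eqs = trans (∑-congAll eqs) (∑-0 xs)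

∑-++ : ∀ xs ys (f : A → ℚ) → ∑ (xs ++ ys) f ≡ ∑ xs f +ℚ ∑ ys f
∑-++ []       ys f = sym (ℚ.+-identityˡ _)
∑-++ (x ∷ xs) ys f = trans (cong (f x +ℚ_) (∑-++ xs ys f)) (sym (ℚ.+-assoc (f x) _ _))

∑-map : ∀ (h : A → B) xs (f : B → ℚ) → ∑ (L.map h xs) f ≡ ∑ xs (f ∘ h)
∑-map h []       f = refl
∑-map h (x ∷ xs) f = cong (f (h x) +ℚ_) (∑-map h xs f)

∑-concatMap : ∀ (h : A → List B) xs (f : B → ℚ) →
  ∑ (concatMap h xs) f ≡ ∑ xs (λ x → ∑ (h x) f)
∑-concatMap h []       f = refl
∑-concatMap h (x ∷ xs) f =
  trans (∑-++ (h x) (concatMap h xs) f) (cong (∑ (h x) f +ℚ_) (∑-concatMap h xs f))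

+ℚ-interchange : ∀ a b c d → (a +ℚ b) +ℚ (c +ℚ d) ≡ (a +ℚ c) +ℚ (b +ℚ d)
+ℚ-interchange = solve 4 (λ a b c d → (a :+ b) :+ (c :+ d) := (a :+ c) :+ (b :+ d)) refl
  where open +-*-Solver

∑-+ : ∀ xs (f g : A → ℚ) → ∑ xs (λ x → f x +ℚ g x) ≡ ∑ xs f +ℚ ∑ xs g
∑-+ []       f g = refl
∑-+ (x ∷ xs) f g =
  trans (cong ((f x +ℚ g x) +ℚ_) (∑-+ xs f g)) (+ℚ-interchange (f x) (g x) _ _)

∑-*ˡ : ∀ q xs (f : A → ℚ) → ∑ xs (λ x → q *ℚ f x) ≡ q *ℚ ∑ xs f
∑-*ˡ q []       f = sym (ℚ.*-zeroʳ q)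
∑-*ˡ q (x ∷ xs) f =
  trans (cong ((q *ℚ f x) +ℚ_) (∑-*ˡ q xs f)) (sym (ℚ.*-distribˡ-+ q (f x) _))

∑-*ʳ : ∀ q xs (f : A → ℚ) → ∑ xs (λ x → f x *ℚ q) ≡ ∑ xs f *ℚ q
∑-*ʳ q []       f = sym (ℚ.*-zeroˡ q)
∑-*ʳ q (x ∷ xs) f =
  trans (cong ((f x *ℚ q) +ℚ_) (∑-*ʳ q xs f)) (sym (ℚ.*-distribʳ-+ q (f x) _))

-ℚ≡-1* : ∀ a → -ℚ a ≡ (-ℚ 1ℚ) *ℚ a
-ℚ≡-1* = solve 1 (λ a → :- a := (:- con 1ℚ) :* a) refl
  where open +-*-Solver

∑-neg : ∀ xs (f : A → ℚ) → ∑ xs (λ x → -ℚ f x) ≡ -ℚ ∑ xs f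
∑-neg xs f = trans (∑-cong xs (λ x → -ℚ≡-1* (f x)))
  (trans (∑-*ˡ (-ℚ 1ℚ) xs f) (sym (-ℚ≡-1* (∑ xs f))))

∑-swap : ∀ (xs : List A) (ys : List B) (f : A → B → ℚ) →
  ∑ xs (λ x → ∑ ys (f x)) ≡ ∑ ys (λ y → ∑ xs (λ x → f x y))
∑-swap []       ys f = sym (∑-0 ys)
∑-swap (x ∷ xs) ys f =
  trans (cong (∑ ys (f x) +ℚ_) (∑-swap xs ys f)) (sym (∑-+ ys (f x) _))

-- A polynomial is studied through all linear functionals on it, φ being given by its values on
-- the monomials.
⟪_,_⟫ : List (ℚ × M) → (M → ℚ) → ℚ
⟪ p , φ ⟫ = ∑ p (λ t → proj₁ t *ℚ φ (proj₂ t))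

⟪⟫-cong : ∀ (p : List (ℚ × M)) {φ ψ : M → ℚ} → (∀ m → φ m ≡ ψ m) → ⟪ p , φ ⟫ ≡ ⟪ p , ψ ⟫
⟪⟫-cong p eq = ∑-cong p (λ t → cong (proj₁ t *ℚ_) (eq (proj₂ t)))

⟪⟫-scale : ∀ c (p : List (ℚ × M)) (φ : M → ℚ) →
  ⟪ L.map (λ t → c *ℚ proj₁ t , proj₂ t) p , φ ⟫ ≡ c *ℚ ⟪ p , φ ⟫
⟪⟫-scale c p φ = trans (∑-map _ p _)
  (trans (∑-cong p (λ t → ℚ.*-assoc c (proj₁ t) (φ (proj₂ t)))) (∑-*ˡ c p _))

⟪⟫-neg : ∀ (p : Poly n) φ → ⟪ -P p , φ ⟫ ≡ -ℚ ⟪ p , φ ⟫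
⟪⟫-neg p φ = trans (∑-map _ p _)
  (trans (∑-cong p (λ t → sym (ℚ.neg-distribˡ-* (proj₁ t) (φ (proj₂ t))))) (∑-neg p _))

⟪⟫-minus : ∀ (p r : Poly n) φ → ⟪ p -P r , φ ⟫ ≡ ⟪ p , φ ⟫ +ℚ (-ℚ ⟪ r , φ ⟫)
⟪⟫-minus p r φ = trans (∑-++ p (-P r) _) (cong (⟪ p , φ ⟫ +ℚ_) (⟪⟫-neg r φ))

⟪⟫-sumP : ∀ (ps : List (Poly n)) φ → ⟪ sumP ps , φ ⟫ ≡ ∑ ps (λ p → ⟪ p , φ ⟫)
⟪⟫-sumP []       φ = refl
⟪⟫-sumP (p ∷ ps) φ = trans (∑-++ p (sumP ps) _) (cong (⟪ p , φ ⟫ +ℚ_) (⟪⟫-sumP ps φ))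

⟪⟫-*P : ∀ (p q : Poly n) φ → ⟪ p *P q , φ ⟫ ≡ ⟪ p , (λ m → ⟪ q , φ ∘ mulMono m ⟫) ⟫
⟪⟫-*P p q φ = trans (∑-concatMap _ p _) (∑-cong p λ s → trans (∑-map _ q _)
  (trans (∑-cong q λ t → ℚ.*-assoc (proj₁ s) (proj₁ t) _) (∑-*ˡ (proj₁ s) q _)))

δ : Mono n → Mono n → ℚ
δ e m = if does (m ≟M e) then 1ℚ else 0ℚ

coeff-⟪⟫ : ∀ (p : Poly n) e → coeff p e ≡ ⟪ p , δ e ⟫
coeff-⟪⟫ []            e = refl
coeff-⟪⟫ ((q , m) ∷ p) e with m ≟M e
... | yes _ = cong₂ _+ℚ_ (sym (ℚ.*-identityʳ q)) (coeff-⟪⟫ p e)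
... | no  _ = trans (coeff-⟪⟫ p e)
  (sym (trans (cong (_+ℚ ⟪ p , δ e ⟫) (ℚ.*-zeroʳ q)) (ℚ.+-identityˡ _)))

δ-refl : ∀ (e : Mono n) → δ e e ≡ 1ℚ
δ-refl e with e ≟M e
... | yes _  = refl
... | no  e≢ = ⊥-elim (e≢ refl)

δ-≢ : ∀ (e m : Mono n) → m ≢ e → δ e m ≡ 0ℚ
δ-≢ e m m≢e with m ≟M e
... | yes m≡e = ⊥-elim (m≢e m≡e)
... | no  _   = refl

⟪⟫⇒≈P : ∀ (p q : Poly n) → (∀ φ → ⟪ p , φ ⟫ ≡ ⟪ q , φ ⟫) → p ≈P q
⟪⟫⇒≈P p q eq e = trans (coeff-⟪⟫ p e) (trans (eq (δ e)) (sym (coeff-⟪⟫ q e)))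

-- Polynomials with equal coefficients define equal functionals

remove : Mono n → Poly n → Poly n
remove m [] = []
remove m ((q , e) ∷ p) with e ≟M m
... | yes _ = remove m p
... | no  _ = (q , e) ∷ remove m p

⟪⟫-remove : ∀ (m : Mono n) p φ → ⟪ p , φ ⟫ ≡ coeff p m *ℚ φ m +ℚ ⟪ remove m p , φ ⟫
⟪⟫-remove m [] φ = sym (trans (ℚ.+-identityʳ _) (ℚ.*-zeroˡ (φ m)))
⟪⟫-remove m ((q , e) ∷ p) φ with e ≟M m
... | yes refl = trans (cong (q *ℚ φ e +ℚ_) (⟪⟫-remove m p φ)) (collect q _ _ _)
  where
  open +-*-Solver
  collect : ∀ a b c d → a *ℚ c +ℚ (b *ℚ c +ℚ d) ≡ (a +ℚ b) *ℚ c +ℚ d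
  collect = solve 4 (λ a b c d → a :* c :+ (b :* c :+ d) := (a :+ b) :* c :+ d) refl
... | no _ = trans (cong (q *ℚ φ e +ℚ_) (⟪⟫-remove m p φ)) (exchange (q *ℚ φ e) (coeff p m *ℚ φ m) ⟪ remove m p , φ ⟫)
  where
  open +-*-Solver
  exchange : ∀ a b c → a +ℚ (b +ℚ c) ≡ b +ℚ (a +ℚ c)
  exchange = solve 3 (λ a b c → a :+ (b :+ c) := b :+ (a :+ c)) refl

coeff-remove-≡ : ∀ (m : Mono n) p → coeff (remove m p) m ≡ 0ℚ
coeff-remove-≡ m [] = refl
coeff-remove-≡ m ((q , e) ∷ p) with e ≟M m
... | yes _ = coeff-remove-≡ m p
... | no e≢m with e ≟M m
...   | yes e≡m = ⊥-elim (e≢m e≡m)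
...   | no  _   = coeff-remove-≡ m p

coeff-remove-≢ : ∀ (m : Mono n) p e → e ≢ m → coeff (remove m p) e ≡ coeff p e
coeff-remove-≢ m [] e e≢m = refl
coeff-remove-≢ m ((q , e') ∷ p) e e≢m with e' ≟M m
coeff-remove-≢ m ((q , e') ∷ p) e e≢m | yes refl with e' ≟M e
... | yes refl = ⊥-elim (e≢m refl)
... | no  _    = coeff-remove-≢ m p e e≢m
coeff-remove-≢ m ((q , e') ∷ p) e e≢m | no _ with e' ≟M e
... | yes _ = cong (q +ℚ_) (coeff-remove-≢ m p e e≢m)
... | no  _ = coeff-remove-≢ m p e e≢m

length-remove : ∀ (m : Mono n) p → L.length (remove m p) ≤ L.length p
length-remove m [] = z≤n
length-remove m ((q , e) ∷ p) with e ≟M m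
... | yes _ = ℕ.m≤n⇒m≤1+n (length-remove m p)
... | no  _ = s≤s (length-remove m p)

-- The list may contain terms that cancel each other. The terms of the head monomial add up to its
-- coefficient, which is 0, and deleting all of them leaves a shorter list that is still zero; `k`
-- bounds the length for the recursion.
⟪⟫-null : ∀ k (p : Poly n) → L.length p ≤ k → p ≈P 0P → ∀ φ → ⟪ p , φ ⟫ ≡ 0ℚ
⟪⟫-null k [] _ p≈0 φ = refl
⟪⟫-null (suc k) p@((q , m) ∷ p') (s≤s len) p≈0 φ = begin
  ⟪ p , φ ⟫                                     ≡⟨ ⟪⟫-remove m p φ ⟩
  coeff p m *ℚ φ m +ℚ ⟪ remove m p , φ ⟫        ≡⟨ cong₂ _+ℚ_ (trans (cong (_*ℚ φ m) (p≈0 m)) (ℚ.*-zeroˡ (φ m))) tail≡0 ⟩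
  0ℚ                                            ∎
  where
  open ≡-Reasoning
  removed≈0 : remove m p ≈P 0P
  removed≈0 e with e ≟M m
  ... | yes refl = coeff-remove-≡ e p
  ... | no e≢m   = trans (coeff-remove-≢ m p e e≢m) (p≈0 e)
  shorter : L.length (remove m p) ≤ k
  shorter with m ≟M m
  ... | yes _  = ℕ.≤-trans (length-remove m p') len
  ... | no m≢m = ⊥-elim (m≢m refl)
  tail≡0 : ⟪ remove m p , φ ⟫ ≡ 0ℚ
  tail≡0 = ⟪⟫-null k (remove m p) shorter removed≈0 φ

≈P⇒⟪⟫ : ∀ (p q : Poly n) → p ≈P q → ∀ φ → ⟪ p , φ ⟫ ≡ ⟪ q , φ ⟫
≈P⇒⟪⟫ p q p≈q φ = x-y≡0⇒x≡y _ _
  (trans (sym (⟪⟫-minus p q φ)) (⟪⟫-null _ (p -P q) ℕ.≤-refl difference≈0 φ))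
  where
  x-y≡0⇒x≡y : ∀ x y → x +ℚ (-ℚ y) ≡ 0ℚ → x ≡ y
  x-y≡0⇒x≡y x y eq = trans (rearrange x y) (trans (cong (_+ℚ y) eq) (ℚ.+-identityˡ y))
    where
    open +-*-Solver
    rearrange : ∀ x y → x ≡ (x +ℚ (-ℚ y)) +ℚ y
    rearrange = solve 2 (λ x y → x := (x :+ (:- y)) :+ y) refl
  difference≈0 : (p -P q) ≈P 0P
  difference≈0 e = begin
    coeff (p -P q) e                         ≡⟨ coeff-⟪⟫ (p -P q) e ⟩
    ⟪ p -P q , δ e ⟫                         ≡⟨ ⟪⟫-minus p q (δ e) ⟩
    ⟪ p , δ e ⟫ +ℚ (-ℚ ⟪ q , δ e ⟫)          ≡⟨ cong₂ (λ a b → a +ℚ (-ℚ b)) (trans (sym (coeff-⟪⟫ p e)) (p≈q e)) (sym (coeff-⟪⟫ q e)) ⟩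
    coeff q e +ℚ (-ℚ coeff q e)              ≡⟨ ℚ.+-inverseʳ (coeff q e) ⟩
    0ℚ                                       ∎
    where open ≡-Reasoning

-- Fundamental B-quasisymmetric polynomials

dbl : ℕ → ℕ
dbl zero    = zero
dbl (suc n) = suc (suc (dbl n))

flat : Mono n → Vec ℕ (dbl n)
flat []            = []
flat ((a , b) ∷ e) = a ∷ b ∷ flat e

unflat : Vec ℕ (dbl n) → Mono n
unflat {zero}  []          = []
unflat {suc n} (a ∷ b ∷ v) = (a , b) ∷ unflat v

unflat-flat : ∀ (e : Mono n) → unflat (flat e) ≡ e
unflat-flat []            = refl
unflat-flat ((a , b) ∷ e) = cong ((a , b) ∷_) (unflat-flat e)

flat-unflat : ∀ (v : Vec ℕ (dbl n)) → flat {n} (unflat v) ≡ v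
flat-unflat {zero}  []          = refl
flat-unflat {suc n} (a ∷ b ∷ v) = cong (λ w → a ∷ b ∷ w) (flat-unflat {n} v)

infixl 6 _⊕_

_⊕_ : Vec ℕ N → Vec ℕ N → Vec ℕ N
_⊕_ = V.zipWith _+_

zeros : ∀ N → Vec ℕ N
zeros N = V.replicate N 0

⊕-zeros : ∀ (v : Vec ℕ N) → v ⊕ zeros N ≡ v
⊕-zeros []      = refl
⊕-zeros (a ∷ v) = cong₂ _∷_ (ℕ.+-identityʳ a) (⊕-zeros v)

unflat-⊕ : ∀ (v w : Vec ℕ (dbl n)) → unflat {n} (v ⊕ w) ≡ mulMono (unflat v) (unflat w)
unflat-⊕ {zero}  []          []          = refl
unflat-⊕ {suc n} (a ∷ b ∷ v) (c ∷ d ∷ w) = cong ((a + c , b + d) ∷_) (unflat-⊕ {n} v w)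

unflat-zeros : ∀ n → unflat (zeros (dbl n)) ≡ zeroMono n
unflat-zeros zero    = refl
unflat-zeros (suc n) = cong ((0 , 0) ∷_) (unflat-zeros n)

mulMono-zeroˡ : ∀ (e : Mono n) → mulMono (zeroMono n) e ≡ e
mulMono-zeroˡ []      = refl
mulMono-zeroˡ (p ∷ e) = cong (p ∷_) (mulMono-zeroˡ e)

inc : Vec ℕ (suc N) → Vec ℕ (suc N)
inc (a ∷ v) = suc a ∷ v

-- A signed composition: the run (b , a) stands for suc a equal letters of colour b.  Consecutive
-- runs of the same colour are separated by a block end.
SComp : Set
SComp = List (Bool × ℕ)

-- The ways to use up an initial part of a signed composition on the first variable, of colour κ.
splits : Bool → SComp → List (ℕ × SComp)
splits κ     []                      = (0 , []) ∷ []
splits true  ((true  , zero)  ∷ w)   = (0 , (true , 0) ∷ w) ∷ (1 , w) ∷ []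
splits true  ((true  , suc a) ∷ w)   = (0 , (true , suc a) ∷ w) ∷ L.map (map₁ suc) (splits true ((true , a) ∷ w))
splits true  ((false , a)     ∷ w)   = (0 , (false , a) ∷ w) ∷ []
splits false ((false , zero)  ∷ w)   = (0 , (false , 0) ∷ w) ∷ (1 , w) ∷ []
splits false ((false , suc a) ∷ w)   = (0 , (false , suc a) ∷ w) ∷ L.map (map₁ suc) (splits false ((false , a) ∷ w))
splits false ((true  , a)     ∷ w)   = (0 , (true , a) ∷ w) ∷ []

-- The monomials of the fundamental B-quasisymmetric polynomial of a signed composition, in
-- variables of alternating colours, the first one having colour κ.
fundamental : Bool → (N : ℕ) → SComp → List (Vec ℕ N)
fundamental κ zero    []      = [] ∷ []
fundamental κ zero    (_ ∷ _) = []
fundamental κ (suc N) w =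
  concatMap (λ s → L.map (proj₁ s ∷_) (fundamental (not κ) N (proj₂ s))) (splits κ w)

∑-fundamental : ∀ κ N w φ → ∑ (fundamental κ (suc N) w) φ ≡
  ∑ (splits κ w) (λ s → ∑ (fundamental (not κ) N (proj₂ s)) (λ v → φ (proj₁ s ∷ v)))
∑-fundamental κ N w φ = trans (∑-concatMap _ (splits κ w) φ)
  (∑-cong (splits κ w) λ s → ∑-map (proj₁ s ∷_) (fundamental (not κ) N (proj₂ s)) φ)

peel-[] : ∀ κ N φ →
  ∑ (fundamental κ (suc N) []) φ ≡ ∑ (fundamental (not κ) N []) (λ v → φ (0 ∷ v))
peel-[] κ N φ = trans (∑-fundamental κ N [] φ) (ℚ.+-identityʳ _)

peel-≢ : ∀ κ N a w φ → ∑ (fundamental κ (suc N) ((not κ , a) ∷ w)) φ ≡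
  ∑ (fundamental (not κ) N ((not κ , a) ∷ w)) (λ v → φ (0 ∷ v))
peel-≢ true  N a w φ = trans (∑-fundamental true N ((false , a) ∷ w) φ) (ℚ.+-identityʳ _)
peel-≢ false N a w φ = trans (∑-fundamental false N ((true , a) ∷ w) φ) (ℚ.+-identityʳ _)

peel-zero : ∀ κ N w φ → ∑ (fundamental κ (suc N) ((κ , 0) ∷ w)) φ ≡
  ∑ (fundamental (not κ) N ((κ , 0) ∷ w)) (λ v → φ (0 ∷ v))
  +ℚ ∑ (fundamental (not κ) N w) (λ v → φ (1 ∷ v))
peel-zero true  N w φ = trans (∑-fundamental true N ((true , 0) ∷ w) φ)
  (cong (∑ (fundamental false N ((true , 0) ∷ w)) (λ v → φ (0 ∷ v)) +ℚ_) (ℚ.+-identityʳ (∑ (fundamental false N w) (λ v → φ (1 ∷ v)))))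
peel-zero false N w φ = trans (∑-fundamental false N ((false , 0) ∷ w) φ)
  (cong (∑ (fundamental true N ((false , 0) ∷ w)) (λ v → φ (0 ∷ v)) +ℚ_) (ℚ.+-identityʳ (∑ (fundamental true N w) (λ v → φ (1 ∷ v)))))

peel-suc : ∀ κ N a w φ → ∑ (fundamental κ (suc N) ((κ , suc a) ∷ w)) φ ≡
  ∑ (fundamental (not κ) N ((κ , suc a) ∷ w)) (λ v → φ (0 ∷ v))
  +ℚ ∑ (fundamental κ (suc N) ((κ , a) ∷ w)) (φ ∘ inc)
peel-suc true N a w φ = trans (∑-fundamental true N ((true , suc a) ∷ w) φ)
  (cong (∑ (fundamental false N ((true , suc a) ∷ w)) (λ v → φ (0 ∷ v)) +ℚ_) (trans (∑-map (map₁ suc) (splits true ((true , a) ∷ w))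
      (λ s → ∑ (fundamental false N (proj₂ s)) (λ v → φ (proj₁ s ∷ v))))
    (sym (∑-fundamental true N ((true , a) ∷ w) (φ ∘ inc)))))
peel-suc false N a w φ = trans (∑-fundamental false N ((false , suc a) ∷ w) φ)
  (cong (∑ (fundamental true N ((false , suc a) ∷ w)) (λ v → φ (0 ∷ v)) +ℚ_) (trans (∑-map (map₁ suc) (splits false ((false , a) ∷ w))
      (λ s → ∑ (fundamental true N (proj₂ s)) (λ v → φ (proj₁ s ∷ v))))
    (sym (∑-fundamental false N ((false , a) ∷ w) (φ ∘ inc)))))

∑-fundamental-[] : ∀ κ N φ → ∑ (fundamental κ N []) φ ≡ φ (zeros N)
∑-fundamental-[] κ zero    φ = ℚ.+-identityʳ _
∑-fundamental-[] κ (suc N) φ = trans (peel-[] κ N φ) (∑-fundamental-[] (not κ) N _)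

-- Bicompositions as signed compositions

runX runY : ℕ → SComp → SComp
runX zero    w = w
runX (suc a) w = (true , a) ∷ w
runY zero    w = w
runY (suc a) w = (false , a) ∷ w

scomp : Bivector → SComp
scomp []            = []
scomp ((a , b) ∷ c) = runX a (runY b (scomp c))

push : Bool × Bool → SComp → SComp
push (b     , true)  w                 = (b , 0) ∷ w
push (b     , false) []                = (b , 0) ∷ []
push (true  , false) ((true , a) ∷ w)  = (true , suc a) ∷ w
push (true  , false) ((false , a) ∷ w) = (true , 0) ∷ (false , a) ∷ w
push (false , false) ((true , a) ∷ w)  = (false , 0) ∷ (true , a) ∷ w
push (false , false) ((false , a) ∷ w) = (false , suc a) ∷ w

wordSComp : List (Bool × Bool) → SComp
wordSComp = L.foldr push []

data Link : Bool × Bool → Bool × Bool → Set where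
  same : ∀ {b e e'} → Link (b , e) (b , e')
  x-y  : ∀ {e'} → Link (true , false) (false , e')
  y-x  : ∀ {e'} → Link (false , true) (true , e')

-- Marked words of bicompositions: blocks end exactly where y is followed by x, at some places
-- between equal letters, and at the last letter.
data Marked : List (Bool × Bool) → Set where
  []   : Marked []
  last : ∀ {b} → Marked ((b , true) ∷ [])
  _∷_  : ∀ {z z' w} → Link z z' → Marked (z' ∷ w) → Marked (z ∷ z' ∷ w)

wordSComp-head : ∀ b e w → ∃[ a ] ∃[ w' ] wordSComp ((b , e) ∷ w) ≡ (b , a) ∷ w'
wordSComp-head b true w = 0 , wordSComp w , refl
wordSComp-head b false w with wordSComp w
wordSComp-head b     false w | []               = 0 , [] , refl
wordSComp-head true  false w | (true , a) ∷ w'  = suc a , w' , refl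
wordSComp-head true  false w | (false , a) ∷ w' = 0 , (false , a) ∷ w' , refl
wordSComp-head false false w | (true , a) ∷ w'  = 0 , (true , a) ∷ w' , refl
wordSComp-head false false w | (false , a) ∷ w' = suc a , w' , refl

⟪var*⟫ : ∀ b j (p : Poly n) φ → ⟪ var n b j *P p , φ ⟫ ≡ ⟪ p , φ ∘ mulMono (varMono n b j) ⟫
⟪var*⟫ {n} b j p φ = trans (⟪⟫-*P (var n b j) p φ) (trans (ℚ.+-identityʳ _) (ℚ.*-identityˡ _))

varMono-suc : ∀ n b j → varMono (suc n) b (suc j) ≡ (0 , 0) ∷ varMono n b j
varMono-suc n true  j = refl
varMono-suc n false j = refl

⟪1P⟫ : ∀ φ → ⟪ 1P {n} , φ ⟫ ≡ φ (zeroMono n)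
⟪1P⟫ φ = trans (ℚ.+-identityʳ _) (ℚ.*-identityˡ _)

Fsum-shift : ∀ n w i φ →
  ⟪ Fsum (suc n) w (suc i) , φ ⟫ ≡ ⟪ Fsum n w i , (λ e → φ ((0 , 0) ∷ e)) ⟫
Fsum-shift n []            i φ = trans (⟪1P⟫ φ) (sym (⟪1P⟫ {n} (λ e → φ ((0 , 0) ∷ e))))
Fsum-shift n ((b , e) ∷ w) i φ = begin
  ⟪ sumP (L.map f (drop i (applyUpTo suc n))) , φ ⟫
    ≡⟨ ⟪⟫-sumP (L.map f (drop i (applyUpTo suc n))) φ ⟩
  ∑ (L.map f (drop i (applyUpTo suc n))) (λ p → ⟪ p , φ ⟫)
    ≡⟨ cong (λ xs → ∑ (L.map f (drop i xs)) (λ p → ⟪ p , φ ⟫)) (sym (L.map-upTo suc n)) ⟩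
  ∑ (L.map f (drop i (L.map suc (upTo n)))) (λ p → ⟪ p , φ ⟫)
    ≡⟨ cong (λ xs → ∑ (L.map f xs) (λ p → ⟪ p , φ ⟫)) (L.drop-map i (upTo n)) ⟩
  ∑ (L.map f (L.map suc (drop i (upTo n)))) (λ p → ⟪ p , φ ⟫)
    ≡⟨ trans (∑-map f (L.map suc (drop i (upTo n))) _) (∑-map suc (drop i (upTo n)) _) ⟩
  ∑ (drop i (upTo n)) (λ j → ⟪ f (suc j) , φ ⟫)
    ≡⟨ ∑-cong (drop i (upTo n)) step ⟩
  ∑ (drop i (upTo n)) (λ j → ⟪ g j , φ ∘ ((0 , 0) ∷_) ⟫)
    ≡⟨ sym (trans (⟪⟫-sumP (L.map g (drop i (upTo n))) _) (∑-map g (drop i (upTo n)) _)) ⟩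
  ⟪ Fsum n ((b , e) ∷ w) i , φ ∘ ((0 , 0) ∷_) ⟫ ∎
  where
  open ≡-Reasoning
  f : ℕ → Poly (suc n)
  f j = var (suc n) b j *P Fsum (suc n) w (if e then suc j else j)
  g : ℕ → Poly n
  g j = var n b j *P Fsum n w (if e then suc j else j)
  tail : ∀ e j ψ → ⟪ Fsum (suc n) w (if e then suc (suc j) else suc j) , ψ ⟫
    ≡ ⟪ Fsum n w (if e then suc j else j) , ψ ∘ ((0 , 0) ∷_) ⟫
  tail true  j ψ = Fsum-shift n w (suc j) ψ
  tail false j ψ = Fsum-shift n w j ψ
  step : ∀ j → ⟪ f (suc j) , φ ⟫ ≡ ⟪ g j , φ ∘ ((0 , 0) ∷_) ⟫
  step j = begin
    ⟪ f (suc j) , φ ⟫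
      ≡⟨ ⟪var*⟫ b (suc j) (Fsum (suc n) w (if e then suc (suc j) else suc j)) φ ⟩
    ⟪ Fsum (suc n) w (if e then suc (suc j) else suc j) , φ ∘ mulMono (varMono (suc n) b (suc j)) ⟫
      ≡⟨ tail e j _ ⟩
    ⟪ Fsum n w (if e then suc j else j) , φ ∘ mulMono (varMono (suc n) b (suc j)) ∘ ((0 , 0) ∷_) ⟫
      ≡⟨ ⟪⟫-cong (Fsum n w (if e then suc j else j))
           (λ m → cong (λ v → φ (mulMono v ((0 , 0) ∷ m))) (varMono-suc n b j)) ⟩
    ⟪ Fsum n w (if e then suc j else j) , φ ∘ ((0 , 0) ∷_) ∘ mulMono (varMono n b j) ⟫
      ≡⟨ sym (⟪var*⟫ b j (Fsum n w (if e then suc j else j)) _) ⟩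
    ⟪ g j , φ ∘ ((0 , 0) ∷_) ⟫ ∎

Fsum-head : ∀ n b e w φ → ⟪ Fsum (suc n) ((b , e) ∷ w) 0 , φ ⟫ ≡
  ⟪ Fsum (suc n) w (if e then 1 else 0) , φ ∘ mulMono (varMono (suc n) b 0) ⟫
  +ℚ ⟪ Fsum n ((b , e) ∷ w) 0 , (λ m → φ ((0 , 0) ∷ m)) ⟫
Fsum-head n b e w φ = begin
  ⟪ f 0 +P rest , φ ⟫                     ≡⟨ ∑-++ (f 0) rest _ ⟩
  ⟪ f 0 , φ ⟫ +ℚ ⟪ rest , φ ⟫             ≡⟨ cong₂ _+ℚ_ (⟪var*⟫ b 0 (Fsum (suc n) w (if e then 1 else 0)) φ)
                                               (Fsum-shift n ((b , e) ∷ w) 0 φ) ⟩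
  _ ∎
  where
  open ≡-Reasoning
  f : ℕ → Poly (suc n)
  f j = var (suc n) b j *P Fsum (suc n) w (if e then suc j else j)
  rest : Poly (suc n)
  rest = Fsum (suc n) ((b , e) ∷ w) 1

-- Both sides are split according to whether the first letter takes a variable of the first pair or
-- a later one. On the left this is `Fsum-head`; on the right two variables are peeled off, and the
-- link between the first two letters decides which peeling rule applies.
⟪Fsum⟫ : ∀ n {w} → Marked w → ∀ φ →
  ⟪ Fsum n w 0 , φ ⟫ ≡ ∑ (fundamental true (dbl n) (wordSComp w)) (φ ∘ unflat)
⟪Fsum⟫ n [] φ = begin
  ⟪ 1P {n} , φ ⟫                                ≡⟨ ⟪1P⟫ φ ⟩
  φ (zeroMono n)                                ≡⟨ cong φ (sym (unflat-zeros n)) ⟩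
  φ (unflat (zeros (dbl n)))                    ≡⟨ sym (∑-fundamental-[] true (dbl n) _) ⟩
  ∑ (fundamental true (dbl n) []) (φ ∘ unflat)  ∎
  where open ≡-Reasoning
⟪Fsum⟫ zero {(b , e) ∷ w} mw φ with wordSComp-head b e w
... | a , w' , eq rewrite eq = refl
⟪Fsum⟫ (suc n) {(b , e) ∷ w} mw φ = begin
  ⟪ Fsum (suc n) ((b , e) ∷ w) 0 , φ ⟫
    ≡⟨ Fsum-head n b e w φ ⟩
  ⟪ Fsum (suc n) w (if e then 1 else 0) , φ ∘ mulMono (varMono (suc n) b 0) ⟫
  +ℚ ⟪ Fsum n ((b , e) ∷ w) 0 , φ ∘ ((0 , 0) ∷_) ⟫
    ≡⟨ ℚ.+-comm ⟪ Fsum (suc n) w (if e then 1 else 0) , _ ⟫ _ ⟩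
  ⟪ Fsum n ((b , e) ∷ w) 0 , φ ∘ ((0 , 0) ∷_) ⟫
  +ℚ ⟪ Fsum (suc n) w (if e then 1 else 0) , φ ∘ mulMono (varMono (suc n) b 0) ⟫
    ≡⟨ cong (_+ℚ ⟪ Fsum (suc n) w (if e then 1 else 0) , φ ∘ mulMono (varMono (suc n) b 0) ⟫)
         (⟪Fsum⟫ n mw _) ⟩
  ∑ (fundamental true (dbl n) (wordSComp ((b , e) ∷ w))) (λ v → φ ((0 , 0) ∷ unflat v))
  +ℚ ⟪ Fsum (suc n) w (if e then 1 else 0) , φ ∘ mulMono (varMono (suc n) b 0) ⟫
    ≡⟨ step mw ⟩
  ∑ (fundamental true (dbl (suc n)) (wordSComp ((b , e) ∷ w))) (φ ∘ unflat) ∎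
  where
  open ≡-Reasoning
  N' : ℕ
  N' = dbl n
  Goal : Bool → Bool → List (Bool × Bool) → Set
  Goal b e w =
    ∑ (fundamental true N' (wordSComp ((b , e) ∷ w))) (λ v → φ ((0 , 0) ∷ unflat v))
    +ℚ ⟪ Fsum (suc n) w (if e then 1 else 0) , φ ∘ mulMono (varMono (suc n) b 0) ⟫
    ≡ ∑ (fundamental true (suc (suc N')) (wordSComp ((b , e) ∷ w))) (φ ∘ unflat)
  closeX : ∀ m → φ (mulMono (varMono (suc n) true 0) ((0 , 0) ∷ m)) ≡ φ ((1 , 0) ∷ m)
  closeX m = cong (λ m' → φ ((1 , 0) ∷ m')) (mulMono-zeroˡ m)
  closeY : ∀ m → φ (mulMono (varMono (suc n) false 0) ((0 , 0) ∷ m)) ≡ φ ((0 , 1) ∷ m)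
  closeY m = cong (λ m' → φ ((0 , 1) ∷ m')) (mulMono-zeroˡ m)
  -- After a block end `Fsum` moves on to the next pair, whereas `fundamental` moves on to the next
  -- variable. The two differ only when an x could be followed by the y of the same pair, which the
  -- last hypothesis rules out.
  end : ∀ b {w} → Marked w → (∀ a w' → wordSComp w ≡ (false , a) ∷ w' → b ≡ false) → Goal b true w
  end b {w} mw noxy = trans (cong (∑ (fundamental true N' ((b , 0) ∷ wordSComp w)) _ +ℚ_)
      (trans (Fsum-shift n w 0 _) (⟪Fsum⟫ n mw _)))
    (sym (unfolded b noxy))
    where
    unfolded : ∀ b → (∀ a w' → wordSComp w ≡ (false , a) ∷ w' → b ≡ false) →
      ∑ (fundamental true (suc (suc N')) ((b , 0) ∷ wordSComp w)) (φ ∘ unflat) ≡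
      ∑ (fundamental true N' ((b , 0) ∷ wordSComp w)) (λ v → φ ((0 , 0) ∷ unflat v))
      +ℚ ∑ (fundamental true N' (wordSComp w)) (λ v → φ (mulMono (varMono (suc n) b 0) ((0 , 0) ∷ unflat v)))
    unfolded true noxy = trans (peel-zero true (suc N') (wordSComp w) (φ ∘ unflat))
      (cong₂ _+ℚ_ (peel-≢ false N' 0 (wordSComp w) _)
        (trans (noY noxy) (∑-cong (fundamental true N' (wordSComp w)) (λ v → sym (closeX (unflat v))))))
      where
      noY : (∀ a w' → wordSComp w ≡ (false , a) ∷ w' → true ≡ false) →
        ∑ (fundamental false (suc N') (wordSComp w)) (λ v → φ (unflat (1 ∷ v))) ≡
        ∑ (fundamental true N' (wordSComp w)) (λ v → φ ((1 , 0) ∷ unflat v))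
      noY noxy with wordSComp w
      ... | []               = peel-[] false N' _
      ... | (true  , a) ∷ w' = peel-≢ false N' a w' _
      ... | (false , a) ∷ w' with noxy a w' refl
      ...   | ()
    unfolded false noxy = trans (peel-≢ true (suc N') 0 (wordSComp w) (φ ∘ unflat))
      (trans (peel-zero false N' (wordSComp w) _)
        (cong (∑ (fundamental true N' ((false , 0) ∷ wordSComp w)) _ +ℚ_)
          (∑-cong (fundamental true N' (wordSComp w)) (λ v → sym (closeY (unflat v))))))
  continue : ∀ b b' {e' w} → Link (b , false) (b' , e') → Marked ((b' , e') ∷ w) →
    Goal b false ((b' , e') ∷ w)
  continue b b' {e'} {w} link mw =
    trans (cong (∑ (fundamental true N' (wordSComp ((b , false) ∷ (b' , e') ∷ w))) _ +ℚ_)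
        (⟪Fsum⟫ (suc n) mw _))
      (sym (unfolded b b' link))
    where
    unfolded : ∀ b b' → Link (b , false) (b' , e') →
      ∑ (fundamental true (suc (suc N')) (wordSComp ((b , false) ∷ (b' , e') ∷ w))) (φ ∘ unflat) ≡
      ∑ (fundamental true N' (wordSComp ((b , false) ∷ (b' , e') ∷ w))) (λ v → φ ((0 , 0) ∷ unflat v))
      +ℚ ∑ (fundamental true (suc (suc N')) (wordSComp ((b' , e') ∷ w)))
           (φ ∘ mulMono (varMono (suc n) b 0) ∘ unflat)
    unfolded true true same with wordSComp ((true , e') ∷ w) | wordSComp-head true e' w
    ... | _ | a , w' , refl = trans (peel-suc true (suc N') a w' _)
      (cong₂ _+ℚ_ (peel-≢ false N' (suc a) w' _)
        (∑-cong (fundamental true (suc (suc N')) ((true , a) ∷ w')) λ where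
          (i ∷ j ∷ v) → cong (λ m → φ ((suc i , j) ∷ m)) (sym (mulMono-zeroˡ (unflat v)))))
    unfolded true false x-y with wordSComp ((false , e') ∷ w) | wordSComp-head false e' w
    ... | _ | a , w' , refl = trans (peel-zero true (suc N') ((false , a) ∷ w') _)
      (cong₂ _+ℚ_ (peel-≢ false N' 0 ((false , a) ∷ w') _)
        (trans
          (∑-cong (fundamental false (suc N') ((false , a) ∷ w')) λ where
            (j ∷ v) → cong (λ m → φ ((1 , j) ∷ m)) (sym (mulMono-zeroˡ (unflat v))))
          (sym (peel-≢ true (suc N') a w' _))))
    unfolded false false same with wordSComp ((false , e') ∷ w) | wordSComp-head false e' w
    ... | _ | a , w' , refl = trans (peel-≢ true (suc N') (suc a) w' _)
      (trans (peel-suc false N' a w' _)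
        (cong (∑ (fundamental true N' ((false , suc a) ∷ w')) _ +ℚ_)
          (trans
            (∑-cong (fundamental false (suc N') ((false , a) ∷ w')) λ where
              (j ∷ v) → cong (λ m → φ ((0 , suc j) ∷ m)) (sym (mulMono-zeroˡ (unflat v))))
            (sym (peel-≢ true (suc N') a w' _)))))
  step : ∀ {b e w} → Marked ((b , e) ∷ w) → Goal b e w
  step {b} last = end b [] (λ _ _ ())
  step {b} {true} (_∷_ {z' = b' , e'} {w} link mw) = end b mw (noxy link)
    where
    noxy : ∀ {b b'} → Link (b , true) (b' , e') → ∀ a w' →
      wordSComp ((b' , e') ∷ w) ≡ (false , a) ∷ w' → b ≡ false
    noxy {b' = b'} link a w' eq with wordSComp ((b' , e') ∷ w) | wordSComp-head b' e' w
    noxy same a w' refl | _ | _ , _ , refl = refl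
    noxy y-x  a w' eq   | _ | _ , _ , _    = refl
  step {b} {false} (_∷_ {z' = b' , e'} link mw) = continue b b' link mw

wordSComp-Y : ∀ b w →
  wordSComp (markEnd (replicate (suc b) false) ++ w) ≡ (false , b) ∷ wordSComp w
wordSComp-Y zero    w = refl
wordSComp-Y (suc b) w = cong (push (false , false)) (wordSComp-Y b w)

wordSComp-X : ∀ a b w → wordSComp (markEnd (blockWord (suc a , b)) ++ w)
  ≡ (true , a) ∷ runY b (wordSComp w)
wordSComp-X zero    zero    w = refl
wordSComp-X zero    (suc b) w = cong (push (true , false)) (wordSComp-Y b w)
wordSComp-X (suc a) b       w = cong (push (true , false)) (wordSComp-X a b w)

noConsecZeros-tail : ∀ {x} l → NoConsecZeros (x ∷ l) → NoConsecZeros l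
noConsecZeros-tail []      _        = tt
noConsecZeros-tail (_ ∷ _) (_ , nc) = nc

wordSComp-word : ∀ c → IsBicomposition c → wordSComp (word c) ≡ scomp c
wordSComp-word []                 _         = refl
wordSComp-word ((zero , zero) ∷ c)  (nz , _)  = ⊥-elim (nz (refl , refl))
wordSComp-word ((zero , suc b) ∷ c) (_ , bic) =
  trans (wordSComp-Y b (word c)) (cong ((false , b) ∷_) (wordSComp-word c (noConsecZeros-tail (flatten c) bic)))
wordSComp-word ((suc a , b) ∷ c)  (_ , bic) =
  trans (wordSComp-X a b (word c)) (cong (λ w → (true , a) ∷ runY b w) (wordSComp-word c (noConsecZeros-tail (flatten c) bic)))

data StartsX : List (Bool × Bool) → Set where
  []   : StartsX []
  cons : ∀ {e w} → StartsX ((true , e) ∷ w)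

Marked-Y : ∀ b {w} → Marked w → Marked (markEnd (replicate (suc b) false) ++ w)
Marked-Y zero    []               = last
Marked-Y zero    {(true  , _) ∷ _} mw = y-x ∷ mw
Marked-Y zero    {(false , _) ∷ _} mw = same ∷ mw
Marked-Y (suc zero)    mw = same ∷ Marked-Y zero mw
Marked-Y (suc (suc b)) mw = same ∷ Marked-Y (suc b) mw

Marked-X : ∀ a b {w} → Marked w → (b ≡ 0 → StartsX w) →
  Marked (markEnd (blockWord (suc a , b)) ++ w)
Marked-X zero zero mw st with st refl
Marked-X zero zero mw st | []   = last
Marked-X zero zero mw st | cons = same ∷ mw
Marked-X zero (suc zero)    mw st = x-y ∷ Marked-Y zero mw
Marked-X zero (suc (suc b)) mw st = x-y ∷ Marked-Y (suc b) mw
Marked-X (suc zero) zero          mw st = same ∷ Marked-X zero zero mw st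
Marked-X (suc zero) (suc b)       mw st = same ∷ Marked-X zero (suc b) mw st
Marked-X (suc (suc a)) b          mw st = same ∷ Marked-X (suc a) b mw st

-- Here the ban on consecutive zeros enters. The leading `0` is the second entry of a block without
-- y; the next block must then start with an x, so the block end does not stand between an x and a
-- y.
StartsX-word : ∀ c → NoConsecZeros (0 ∷ flatten c) → StartsX (word c)
StartsX-word []                      _        = []
StartsX-word ((zero , b) ∷ c)        (nz , _) = ⊥-elim (nz (refl , refl))
StartsX-word ((suc zero , zero) ∷ c)  _       = cons
StartsX-word ((suc zero , suc b) ∷ c) _       = cons
StartsX-word ((suc (suc a) , b) ∷ c)  _       = cons

Marked-word : ∀ c → IsBicomposition c → Marked (word c)
Marked-word []                   _         = []
Marked-word ((zero , zero) ∷ c)  (nz , _)  = ⊥-elim (nz (refl , refl))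
Marked-word ((zero , suc b) ∷ c) (_ , bic) = Marked-Y b (Marked-word c (noConsecZeros-tail (flatten c) bic))
Marked-word ((suc a , b) ∷ c)    (_ , bic) =
  Marked-X a b (Marked-word c (noConsecZeros-tail (flatten c) bic)) λ where refl → StartsX-word c bic

⟪F⟫ : ∀ n c → IsBicomposition c → ∀ φ →
  ⟪ F n c , φ ⟫ ≡ ∑ (fundamental true (dbl n) (scomp c)) (φ ∘ unflat)
⟪F⟫ n c bic φ = trans (⟪Fsum⟫ n (Marked-word c bic) φ)
  (cong (λ w → ∑ (fundamental true (dbl n) w) (φ ∘ unflat)) (wordSComp-word c bic))

-- A run of x has to join a following block that starts with `0`: a separate block `(suc a , 0)` in
-- front of it would create two consecutive zeros.
addX : ℕ → Bivector → Bivector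
addX a []                  = (suc a , 0) ∷ []
addX a ((zero , b) ∷ c)    = (suc a , b) ∷ c
addX a ((suc a' , b) ∷ c)  = (suc a , 0) ∷ (suc a' , b) ∷ c

bicomposition : SComp → Bivector
bicomposition []                = []
bicomposition ((true  , a) ∷ w) = addX a (bicomposition w)
bicomposition ((false , b) ∷ w) = (0 , suc b) ∷ bicomposition w

scomp-addX : ∀ a c → scomp (addX a c) ≡ (true , a) ∷ scomp c
scomp-addX a []                 = refl
scomp-addX a ((zero , b) ∷ c)   = refl
scomp-addX a ((suc a' , b) ∷ c) = refl

scomp-bicomposition : ∀ w → scomp (bicomposition w) ≡ w
scomp-bicomposition []                = refl
scomp-bicomposition ((true  , a) ∷ w) =
  trans (scomp-addX a (bicomposition w)) (cong ((true , a) ∷_) (scomp-bicomposition w))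
scomp-bicomposition ((false , b) ∷ w) = cong ((false , b) ∷_) (scomp-bicomposition w)

isBicomposition-addX : ∀ a c → IsBicomposition c → IsBicomposition (addX a c)
isBicomposition-addX a []                 _        = (λ ()) , tt
isBicomposition-addX a ((zero , b) ∷ c)   (_ , nc) = (λ ()) , nc
isBicomposition-addX a ((suc a' , b) ∷ c) nc       = (λ ()) , (λ ()) , nc

isBicomposition : ∀ w → IsBicomposition (bicomposition w)
isBicomposition []                = tt
isBicomposition ((true  , a) ∷ w) = isBicomposition-addX a (bicomposition w) (isBicomposition w)
isBicomposition ((false , b) ∷ w) = (λ ()) , prepend (flatten (bicomposition w)) (isBicomposition w)
  where
  prepend : ∀ l → NoConsecZeros l → NoConsecZeros (suc b ∷ l)
  prepend []      _  = tt
  prepend (_ ∷ _) nc = (λ ()) , nc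

data NonEmpty {A : Set} : List A → Set where
  cons : ∀ {x xs} → NonEmpty (x ∷ xs)

scomp-nonEmpty : ∀ {c} → IsBicomposition c → NonEmpty c → NonEmpty (scomp c)
scomp-nonEmpty {(zero , zero) ∷ c}  (nz , _) _ = ⊥-elim (nz (refl , refl))
scomp-nonEmpty {(zero , suc b) ∷ c} _        _ = cons
scomp-nonEmpty {(suc a , b) ∷ c}    _        _ = cons

bicomposition-nonEmpty : ∀ {w} → NonEmpty w → NonEmpty (bicomposition w)
bicomposition-nonEmpty {w} ne with bicomposition w | scomp-bicomposition w
bicomposition-nonEmpty cons | []    | ()
bicomposition-nonEmpty _    | _ ∷ _ | _ = cons

-- Degrees in the variables of each colour

pick : Bool → Bool → ℕ → ℕ
pick true  true  a = a
pick false false a = a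
pick _     _     a = 0

pick-0 : ∀ b b' → pick b b' 0 ≡ 0
pick-0 true  true  = refl
pick-0 true  false = refl
pick-0 false true  = refl
pick-0 false false = refl

pick-0+ : ∀ b b' m → pick b b' 0 + m ≡ m
pick-0+ b b' m = cong (_+ m) (pick-0 b b')

pick-+ : ∀ b b' a c → pick b b' (a + c) ≡ pick b b' a + pick b b' c
pick-+ true  true  a c = refl
pick-+ true  false a c = refl
pick-+ false true  a c = refl
pick-+ false false a c = refl

-- The degree in the variables of colour b, when the i-th variable has colour χ i.
deg : Bool → (ℕ → Bool) → Vec ℕ N → ℕ
deg b χ []      = 0
deg b χ (a ∷ v) = pick b (χ 0) a + deg b (χ ∘ suc) v

alt : Bool → ℕ → Bool
alt κ zero    = κ
alt κ (suc i) = alt (not κ) i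

xdeg-unflat : ∀ (v : Vec ℕ (dbl n)) → xdeg (unflat {n} v) ≡ deg true (alt true) v
xdeg-unflat {zero}  []          = refl
xdeg-unflat {suc n} (a ∷ b ∷ v) = cong (a +_) (xdeg-unflat {n} v)

ydeg-unflat : ∀ (v : Vec ℕ (dbl n)) → ydeg (unflat {n} v) ≡ deg false (alt true) v
ydeg-unflat {zero}  []          = refl
ydeg-unflat {suc n} (a ∷ b ∷ v) = cong (b +_) (ydeg-unflat {n} v)

deg-⊕ : ∀ b χ (v w : Vec ℕ N) → deg b χ (v ⊕ w) ≡ deg b χ v + deg b χ w
deg-⊕ b χ []      []      = refl
deg-⊕ b χ (a ∷ v) (c ∷ w) = begin
  pick b (χ 0) (a + c) + deg b (χ ∘ suc) (v ⊕ w)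
    ≡⟨ cong₂ _+_ (pick-+ b (χ 0) a c) (deg-⊕ b (χ ∘ suc) v w) ⟩
  (pick b (χ 0) a + pick b (χ 0) c) + (deg b (χ ∘ suc) v + deg b (χ ∘ suc) w)
    ≡⟨ interchange (pick b (χ 0) a) _ _ _ ⟩
  (pick b (χ 0) a + deg b (χ ∘ suc) v) + (pick b (χ 0) c + deg b (χ ∘ suc) w) ∎
  where
  open ≡-Reasoning

deg-zeros : ∀ b χ N → deg b χ (zeros N) ≡ 0
deg-zeros b χ zero    = refl
deg-zeros b χ (suc N) = cong₂ _+_ (pick-0 b (χ 0)) (deg-zeros b (χ ∘ suc) N)

sdeg : Bool → SComp → ℕ
sdeg b []             = 0
sdeg b ((b' , a) ∷ w) = pick b b' (suc a) + sdeg b w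

splits-sdeg : ∀ b κ w → All (λ s → pick b κ (proj₁ s) + sdeg b (proj₂ s) ≡ sdeg b w) (splits κ w)
splits-sdeg b κ [] = pick-0+ b κ _ ∷ []
splits-sdeg b true  ((true  , zero) ∷ w)  = pick-0+ b true _ ∷ refl ∷ []
splits-sdeg b false ((false , zero) ∷ w)  = pick-0+ b false _ ∷ refl ∷ []
splits-sdeg b true  ((false , a) ∷ w)     = pick-0+ b true _ ∷ []
splits-sdeg b false ((true , a) ∷ w)      = pick-0+ b false _ ∷ []
splits-sdeg b true  ((true  , suc a) ∷ w) = pick-0+ b true _ ∷
  All.map⁺ (All.map (λ {s} → step b s) (splits-sdeg b true ((true , a) ∷ w)))
  where
  step : ∀ b s → pick b true (proj₁ s) + sdeg b (proj₂ s) ≡ sdeg b ((true , a) ∷ w) →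
    pick b true (suc (proj₁ s)) + sdeg b (proj₂ s) ≡ sdeg b ((true , suc a) ∷ w)
  step true  s eq = cong suc eq
  step false s eq = eq
splits-sdeg b false ((false , suc a) ∷ w) = pick-0+ b false _ ∷
  All.map⁺ (All.map (λ {s} → step b s) (splits-sdeg b false ((false , a) ∷ w)))
  where
  step : ∀ b s → pick b false (proj₁ s) + sdeg b (proj₂ s) ≡ sdeg b ((false , a) ∷ w) →
    pick b false (suc (proj₁ s)) + sdeg b (proj₂ s) ≡ sdeg b ((false , suc a) ∷ w)
  step true  s eq = eq
  step false s eq = cong suc eq

fundamental-deg : ∀ b κ N w → All (λ v → deg b (alt κ) v ≡ sdeg b w) (fundamental κ N w)
fundamental-deg b κ zero    []      = refl ∷ []
fundamental-deg b κ zero    (_ ∷ _) = []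
fundamental-deg b κ (suc N) w       = All.concat⁺ (All.map⁺ (All.map
  (λ {s} eq → All.map⁺ (All.map (λ eq' → trans (cong (pick b κ (proj₁ s) +_) eq') eq)
    (fundamental-deg b (not κ) N (proj₂ s))))
  (splits-sdeg b κ w)))

-- Spanning

-- Reading one more variable raises the slack t by 1, each factor of it costs 2.  The vector v is
-- 2-Dyck iff Dyck 0 v.
Dyck : ℕ → Vec ℕ N → Set
Dyck t []      = ⊤
Dyck t (a ∷ v) = ∃[ s ] (t ≡ s + (a + a) × Dyck (suc s) v)

skip : Bool → Bool → ℕ
skip true  true  = 0
skip true  false = 1
skip false true  = 1
skip false false = 0

data SameColour (κ : Bool) : Bool → Set where
  equal   : SameColour κ κ
  opposed : SameColour κ (not κ)

sameColour : ∀ κ b → SameColour κ b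
sameColour true  true  = equal
sameColour true  false = opposed
sameColour false true  = opposed
sameColour false false = equal

skip-equal : ∀ κ → skip κ κ ≡ 0
skip-equal true  = refl
skip-equal false = refl

skip-opposed : ∀ κ → skip κ (not κ) ≡ 1
skip-opposed true  = refl
skip-opposed false = refl

skip-opposed′ : ∀ κ → skip (not κ) κ ≡ 1
skip-opposed′ true  = refl
skip-opposed′ false = refl

-- The number of the last variable in the leading monomial of the fundamental polynomial of w.
position : Bool → SComp → ℕ
position κ []            = 0
position κ ((b , a) ∷ w) = skip κ b + suc (position (not b) w)

size₂ : SComp → ℕ
size₂ []            = 0
size₂ ((b , a) ∷ w) = suc (suc (a + a)) + size₂ w

-- The leading monomial of the fundamental polynomial of w violates Dyck t at its last variable.
Exceeds : Bool → ℕ → SComp → Set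
Exceeds κ t w = NonEmpty w × position κ w + t ≤ size₂ w

Term : ℕ → Set
Term N = ℚ × Vec ℕ N × SComp

combine : Bool → List (Term N) → (Vec ℕ N → ℚ) → ℚ
combine {N} κ gs φ =
  ∑ gs (λ g → proj₁ g *ℚ ∑ (fundamental κ N (proj₂ (proj₂ g))) (λ v → φ (proj₁ (proj₂ g) ⊕ v)))

-- The functional `ℓ` stands for a polynomial, given through its values on all `φ`. Leaving `P` and
-- `Q` open lets the same closure lemmas serve both the reduction to 2-Dyck monomials and membership
-- in the ideal.
Spanned : Bool → (Vec ℕ N → Set) → (SComp → Set) → ((Vec ℕ N → ℚ) → ℚ) → Set
Spanned {N} κ P Q ℓ = ∃[ r ] ∃[ gs ]
  (All (λ s → P (proj₂ s)) r × All (λ g → Q (proj₂ (proj₂ g))) gs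
    × (∀ φ → ℓ φ ≡ ⟪ r , φ ⟫ +ℚ combine {N} κ gs φ))

Reducible : Bool → ℕ → ((Vec ℕ N → ℚ) → ℚ) → Set
Reducible κ t = Spanned κ (Dyck t) (Exceeds κ t)

module _ {κ : Bool} {P : Vec ℕ N → Set} {Q : SComp → Set} where

  spanned-resp : ∀ {ℓ ℓ' : (Vec ℕ N → ℚ) → ℚ} → (∀ φ → ℓ' φ ≡ ℓ φ) →
    Spanned κ P Q ℓ → Spanned κ P Q ℓ'
  spanned-resp eq (r , gs , dr , eg , h) = r , gs , dr , eg , λ φ → trans (eq φ) (h φ)

  spanned-0 : Spanned {N} κ P Q (λ _ → 0ℚ)
  spanned-0 = [] , [] , [] , [] , λ _ → refl

  spanned-+ : ∀ {ℓ ℓ' : (Vec ℕ N → ℚ) → ℚ} → Spanned κ P Q ℓ → Spanned κ P Q ℓ' →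
    Spanned κ P Q (λ φ → ℓ φ +ℚ ℓ' φ)
  spanned-+ (r , gs , dr , eg , h) (r' , gs' , dr' , eg' , h') =
    r ++ r' , gs ++ gs' , All.++⁺ dr dr' , All.++⁺ eg eg' , λ φ →
      trans (cong₂ _+ℚ_ (h φ) (h' φ)) (trans (+ℚ-interchange ⟪ r , φ ⟫ _ _ _)
        (sym (cong₂ _+ℚ_ (∑-++ r r' _) (∑-++ gs gs' _))))

  spanned-* : ∀ {ℓ : (Vec ℕ N → ℚ) → ℚ} q → Spanned κ P Q ℓ → Spanned κ P Q (λ φ → q *ℚ ℓ φ)
  spanned-* q (r , gs , dr , eg , h) =
    L.map (map₁ (q *ℚ_)) r , L.map (map₁ (q *ℚ_)) gs , All.map⁺ dr , All.map⁺ eg , λ φ →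
      trans (cong (q *ℚ_) (h φ)) (trans (ℚ.*-distribˡ-+ q ⟪ r , φ ⟫ _)
        (sym (cong₂ _+ℚ_ (scaled r φ) (scaled gs _))))
    where
    scaled : ∀ {B : Set} (xs : List (ℚ × B)) (f : B → ℚ) →
      ∑ (L.map (map₁ (q *ℚ_)) xs) (λ x → proj₁ x *ℚ f (proj₂ x))
      ≡ q *ℚ ∑ xs (λ x → proj₁ x *ℚ f (proj₂ x))
    scaled xs f = trans (∑-map (map₁ (q *ℚ_)) xs _)
      (trans (∑-cong xs (λ x → ℚ.*-assoc q (proj₁ x) (f (proj₂ x)))) (∑-*ˡ q xs _))

  spanned-∑ : ∀ {ℓ : A → (Vec ℕ N → ℚ) → ℚ} {xs} → All (λ x → Spanned κ P Q (ℓ x)) xs →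
    Spanned κ P Q (λ φ → ∑ xs (λ x → ℓ x φ))
  spanned-∑ []         = spanned-0
  spanned-∑ (px ∷ pxs) = spanned-+ px (spanned-∑ pxs)

  -- An identity between polynomials can be solved for one of its terms; this is how a leading term
  -- is traded for a generator and lower terms.
  spanned-difference : ∀ {ℓ ℓ' ℓ'' : (Vec ℕ N → ℚ) → ℚ} → (∀ φ → ℓ φ ≡ ℓ' φ +ℚ ℓ'' φ) →
    Spanned κ P Q ℓ → Spanned κ P Q ℓ' → Spanned κ P Q ℓ''
  spanned-difference {ℓ' = ℓ'} {ℓ''} eq red red' =
    spanned-resp
      (λ φ → trans (cancel (ℓ' φ) (ℓ'' φ)) (cong (_+ℚ ((-ℚ 1ℚ) *ℚ ℓ' φ)) (sym (eq φ))))
      (spanned-+ red (spanned-* (-ℚ 1ℚ) red'))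
    where
    open +-*-Solver
    cancel : ∀ a b → b ≡ (a +ℚ b) +ℚ (-ℚ 1ℚ) *ℚ a
    cancel = solve 2 (λ a b → b := (a :+ b) :+ (:- con 1ℚ) :* a) refl

  spanned-generator : ∀ {w} → Q w → ∀ m →
    Spanned κ P Q (λ φ → ∑ (fundamental κ N w) (λ v → φ (m ⊕ v)))
  spanned-generator {w = w} ex m = [] , (1ℚ , m , w) ∷ [] , [] , ex ∷ [] , λ φ →
    sym (trans (ℚ.+-identityˡ _) (trans (ℚ.+-identityʳ _) (ℚ.*-identityˡ _)))

  spanned-mono : ∀ {v : Vec ℕ N} → P v → Spanned κ P Q (λ φ → φ v)
  spanned-mono {v = v} d = (1ℚ , v) ∷ [] , [] , d ∷ [] , [] , λ φ →
    sym (trans (ℚ.+-identityʳ _) (trans (ℚ.+-identityʳ _) (ℚ.*-identityˡ _)))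

-- Later runs must use later variables. So the exponent `suc a` of the first variable is reached
-- only by spending the whole first run on it, and then `w` is left for the other variables.
lower-terms : ∀ κ N a w → ∃[ xs ] (All (λ x → V.head x < suc a) xs
  × (∀ ψ → ∑ (fundamental κ (suc N) ((κ , a) ∷ w)) ψ ≡
      ∑ xs ψ +ℚ ∑ (fundamental (not κ) N w) (λ v → ψ (suc a ∷ v))))
lower-terms κ N zero w = L.map (0 ∷_) rest , All.map⁺ (All.universal (λ _ → s≤s z≤n) rest) ,
  λ ψ → trans (peel-zero κ N w ψ) (cong (_+ℚ ∑ (fundamental (not κ) N w) (λ v → ψ (1 ∷ v)))
    (sym (∑-map (0 ∷_) rest ψ)))
  where
  rest : List (Vec ℕ N)
  rest = fundamental (not κ) N ((κ , 0) ∷ w)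
lower-terms κ N (suc a) w with lower-terms κ N a w
... | xs , low , eq = L.map (0 ∷_) rest ++ L.map inc xs ,
  All.++⁺ (All.map⁺ (All.universal (λ _ → s≤s z≤n) rest))
    (All.map⁺ (All.map (λ {x} → inc-< x) low)) ,
  λ ψ → begin
    ∑ (fundamental κ (suc N) ((κ , suc a) ∷ w)) ψ
      ≡⟨ peel-suc κ N a w ψ ⟩
    ∑ rest (ψ ∘ (0 ∷_)) +ℚ ∑ (fundamental κ (suc N) ((κ , a) ∷ w)) (ψ ∘ inc)
      ≡⟨ cong (∑ rest (ψ ∘ (0 ∷_)) +ℚ_) (eq (ψ ∘ inc)) ⟩
    ∑ rest (ψ ∘ (0 ∷_)) +ℚ (∑ xs (ψ ∘ inc) +ℚ top ψ)
      ≡⟨ sym (ℚ.+-assoc (∑ rest (ψ ∘ (0 ∷_))) _ _) ⟩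
    (∑ rest (ψ ∘ (0 ∷_)) +ℚ ∑ xs (ψ ∘ inc)) +ℚ top ψ
      ≡⟨ cong (_+ℚ top ψ) (sym (trans (∑-++ (L.map (0 ∷_) rest) (L.map inc xs) ψ)
           (cong₂ _+ℚ_ (∑-map (0 ∷_) rest ψ) (∑-map inc xs ψ)))) ⟩
    ∑ (L.map (0 ∷_) rest ++ L.map inc xs) ψ +ℚ top ψ ∎
  where
  open ≡-Reasoning
  rest : List (Vec ℕ N)
  rest = fundamental (not κ) N ((κ , suc a) ∷ w)
  top : (Vec ℕ (suc N) → ℚ) → ℚ
  top ψ = ∑ (fundamental (not κ) N w) (λ v → ψ (suc (suc a) ∷ v))
  inc-< : ∀ x → V.head x < suc a → V.head (inc x) < suc (suc a)
  inc-< (_ ∷ _) h<a = s≤s h<a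

-- The fundamental polynomial of (κ , a) ∷ w is u^(a+1) times that of w in the remaining variables,
-- up to terms of lower degree in its first variable u.
reducible-leading : ∀ {κ t a w} → Exceeds κ t ((κ , a) ∷ w) →
  (∀ (x : Vec ℕ (suc N)) → V.head x < suc a → Reducible κ t (λ φ → φ x)) →
  ∀ m → Reducible κ t (λ φ → ∑ (fundamental (not κ) N w) (λ v → φ (suc a ∷ (m ⊕ v))))
reducible-leading {N} {κ} {t} {a} {w} ex low m with lower-terms κ N a w
... | xs , lowxs , eq = spanned-difference
  (λ φ → eq (λ v → φ ((0 ∷ m) ⊕ v)))
  (spanned-generator ex (0 ∷ m))
  (spanned-∑ (All.map (λ {x} h<a → low ((0 ∷ m) ⊕ x) (subst (_< suc a) (head-0⊕ x) h<a)) lowxs))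
  where
  head-0⊕ : ∀ x → V.head x ≡ V.head ((0 ∷ m) ⊕ x)
  head-0⊕ (_ ∷ _) = refl

⊕-1∷ : ∀ (m : Vec ℕ (suc N)) v → m ⊕ (1 ∷ v) ≡ inc m ⊕ (0 ∷ v)
⊕-1∷ (h ∷ m) v = cong (_∷ (m ⊕ v)) (ℕ.+-suc h 0)

⊕-inc : ∀ (m v : Vec ℕ (suc N)) → m ⊕ inc v ≡ inc m ⊕ v
⊕-inc (h ∷ m) (a ∷ v) = cong (_∷ (m ⊕ v)) (ℕ.+-suc h a)

-- The polynomial of the word in the variables after `u` is the one in all variables minus the part
-- containing `u`. If the first run has the other colour, that part is empty, and counting `u`
-- raises the position by 1 while the slack drops by 1. If it has the colour of `u`, position and
-- slack both drop by 1. The 2 gained is the size of one letter, so the part containing `u`, which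
-- has lost one letter, still exceeds its bound. For a run of one letter that part again lives in
-- the later variables, whence the recursion.
reducible-shifted : ∀ {κ t} w → position (not κ) w + suc t ≤ size₂ w → ∀ (m : Vec ℕ (suc N)) →
  Reducible κ t (λ φ → ∑ (fundamental (not κ) N w) (λ v → φ (m ⊕ (0 ∷ v))))
reducible-shifted {N} {κ} {t} ((b , a) ∷ w) ex m with sameColour κ b
... | opposed = spanned-resp (λ φ → sym (peel-≢ κ N a w (λ v → φ (m ⊕ v))))
  (spanned-generator (cons , exceeds) m)
  where
  exceeds : skip κ (not κ) + suc (position (not (not κ)) w) + t ≤ size₂ ((not κ , a) ∷ w)
  exceeds rewrite skip-opposed κ | skip-equal (not κ) =
    subst (_≤ suc (suc (a + a)) + size₂ w) (ℕ.+-suc (suc (position (not (not κ)) w)) t) ex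
reducible-shifted {N} {κ} {t} ((_ , zero) ∷ w) ex m | equal = spanned-difference
  (λ φ → trans (peel-zero κ N w (λ v → φ (m ⊕ v))) (ℚ.+-comm (∑ (fundamental (not κ) N ((κ , 0) ∷ w)) _) _))
  (spanned-generator (cons , exceeds) m)
  (spanned-resp (λ φ → ∑-cong (fundamental (not κ) N w) (λ v → cong φ (⊕-1∷ m v)))
    (reducible-shifted w exceeds-tail (inc m)))
  where
  bound : suc (suc (position (not κ) w)) + suc t ≤ size₂ ((κ , 0) ∷ w)
  bound = subst (λ s → s + suc (position (not κ) w) + suc t ≤ size₂ ((κ , 0) ∷ w)) (skip-opposed′ κ) ex
  exceeds : skip κ κ + suc (position (not κ) w) + t ≤ size₂ ((κ , 0) ∷ w)
  exceeds rewrite skip-equal κ =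
    ℕ.≤-trans (ℕ.+-mono-≤ (ℕ.n≤1+n (suc (position (not κ) w))) (ℕ.n≤1+n t)) bound
  exceeds-tail : position (not κ) w + suc t ≤ size₂ w
  exceeds-tail = s≤s⁻¹ (s≤s⁻¹ bound)
reducible-shifted {N} {κ} {t} ((_ , suc a) ∷ w) ex m | equal = spanned-difference
  (λ φ → trans (peel-suc κ N a w (λ v → φ (m ⊕ v))) (ℚ.+-comm (∑ (fundamental (not κ) N ((κ , suc a) ∷ w)) _) _))
  (spanned-generator (cons , exceeds) m)
  (spanned-resp (λ φ → ∑-cong (fundamental κ (suc N) ((κ , a) ∷ w)) (λ v → cong φ (⊕-inc m v)))
    (spanned-generator (cons , exceeds-smaller) (inc m)))
  where
  bound : suc (suc (position (not κ) w)) + suc t ≤ size₂ ((κ , suc a) ∷ w)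
  bound = subst (λ s → s + suc (position (not κ) w) + suc t ≤ size₂ ((κ , suc a) ∷ w)) (skip-opposed′ κ) ex
  exceeds : skip κ κ + suc (position (not κ) w) + t ≤ size₂ ((κ , suc a) ∷ w)
  exceeds rewrite skip-equal κ =
    ℕ.≤-trans (ℕ.+-mono-≤ (ℕ.n≤1+n (suc (position (not κ) w))) (ℕ.n≤1+n t)) bound
  exceeds-smaller : skip κ κ + suc (position (not κ) w) + t ≤ size₂ ((κ , a) ∷ w)
  exceeds-smaller rewrite skip-equal κ =
    subst (_≤ suc (suc (a + a)) + size₂ w) (ℕ.+-suc (position (not κ) w) t)
      (subst (λ s → position (not κ) w + suc t ≤ suc s + size₂ w) (ℕ.+-suc a a) (s≤s⁻¹ (s≤s⁻¹ bound)))

reducible-mono : ∀ N κ t (v : Vec ℕ N) → Reducible κ t (λ φ → φ v)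
reducible-mono zero    κ t []      = spanned-mono tt
reducible-mono (suc N) κ t (a ∷ v) = below (suc a) (a ∷ v) (s≤s ℕ.≤-refl)
  where
  step : ∀ a (v : Vec ℕ N) → (∀ (x : Vec ℕ (suc N)) → V.head x < a → Reducible κ t (λ φ → φ x)) → Reducible κ t (λ φ → φ (a ∷ v))
  step a v low with a + a ℕ.≤? t
  ... | yes 2a≤t with ℕ.m≤n⇒∃[o]m+o≡n 2a≤t
  ...   | s , refl with reducible-mono N (not κ) (suc s) v
  ...     | r , gs , dr , eg , h = spanned-resp (λ φ → h (λ x → φ (a ∷ x))) (spanned-+
    (spanned-∑ (All.map
      (λ {x} d → spanned-* (proj₁ x) (spanned-mono (s , ℕ.+-comm (a + a) s , d))) dr))
    (spanned-∑ (All.map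
      (λ {g} ex → spanned-* (proj₁ g) (generator a low (proj₁ (proj₂ g)) ex)) eg)))
    where
    generator : ∀ a {w} → (∀ (x : Vec ℕ (suc N)) → V.head x < a → Reducible κ (a + a + s) (λ φ → φ x)) →
      ∀ m → Exceeds (not κ) (suc s) w →
      Reducible κ (a + a + s) (λ φ → ∑ (fundamental (not κ) N w) (λ x → φ (a ∷ (m ⊕ x))))
    generator zero    {w} low m (_ , ex) = reducible-shifted w ex (0 ∷ m)
    generator (suc a) {w} low m (_ , ex) = reducible-leading {w = w} (cons , exceeds) low m
      where
      open ℕ.≤-Reasoning
      -- Prepending a run of `suc a` letters raises position plus slack by `2(a + 1)`, which is
      -- exactly its contribution to `size₂`.
      exceeds : skip κ κ + suc (position (not κ) w) + (suc a + suc a + s) ≤ size₂ ((κ , a) ∷ w)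
      exceeds rewrite skip-equal κ = begin
        suc (position (not κ) w) + (suc a + suc a + s)  ≡⟨ rearrange (position (not κ) w) a s ⟩
        suc (suc (a + a)) + (position (not κ) w + suc s) ≤⟨ ℕ.+-monoʳ-≤ (suc (suc (a + a))) ex ⟩
        size₂ ((κ , a) ∷ w)                             ∎
        where
        open ℕ-Solver
        rearrange : ∀ p a s → suc p + (suc a + suc a + s) ≡ suc (suc (a + a)) + (p + suc s)
        rearrange = solve 3 (λ p a s → con 1 :+ p :+ (con 1 :+ a :+ (con 1 :+ a) :+ s)
          := con 2 :+ (a :+ a) :+ (p :+ (con 1 :+ s))) refl
  step zero    v low | no 0≰t = ⊥-elim (0≰t z≤n)
  -- The exponent of the first variable breaks the bound on its own. So the single run `(κ , a)`
  -- suffices as a word, with `w = []` contributing the constant 1 and `v` acting as a multiplier.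
  step (suc a) v low | no 2a≰t = spanned-resp
    (λ φ → sym (trans (∑-fundamental-[] (not κ) N (λ x → φ (suc a ∷ (v ⊕ x)))) (cong (λ x → φ (suc a ∷ x)) (⊕-zeros v))))
    (reducible-leading {w = []} (cons , exceeds) low v)
    where
    exceeds : skip κ κ + 1 + t ≤ suc (suc (a + a)) + 0
    exceeds rewrite skip-equal κ | ℕ.+-identityʳ (a + a) | sym (ℕ.+-suc a a) = ℕ.≰⇒> 2a≰t
  below : ∀ a (x : Vec ℕ (suc N)) → V.head x < a → Reducible κ t (λ φ → φ x)
  below (suc a) (h ∷ v) (s≤s h≤a) with ℕ.m≤n⇒m<n∨m≡n h≤a
  ... | inj₁ h<a  = below a (h ∷ v) h<a
  ... | inj₂ refl = step h v (below h)

reducible-poly : ∀ κ t (p : List (ℚ × Vec ℕ N)) → Reducible κ t (λ φ → ⟪ p , φ ⟫)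
reducible-poly {N} κ t p = spanned-∑
  (All.universal (λ s → spanned-* (proj₁ s) (reducible-mono N κ t (proj₂ s))) p)

-- Independence

guard : ℕ → ℚ → ℚ
guard zero    q = q
guard (suc _) q = 0ℚ

∑-splits-guard : ∀ κ w (f : ℕ → SComp → ℚ) →
  ∑ (splits κ w) (λ s → guard (proj₁ s) (f (proj₁ s) (proj₂ s))) ≡ f 0 w
∑-splits-guard κ     []                    f = ℚ.+-identityʳ _
∑-splits-guard true  ((true  , zero) ∷ w)  f = ℚ.+-identityʳ _
∑-splits-guard false ((false , zero) ∷ w)  f = ℚ.+-identityʳ _
∑-splits-guard true  ((false , a) ∷ w)     f = ℚ.+-identityʳ _
∑-splits-guard false ((true  , a) ∷ w)     f = ℚ.+-identityʳ _
∑-splits-guard true  ((true  , suc a) ∷ w) f =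
  trans (cong (f 0 ((true , suc a) ∷ w) +ℚ_)
      (trans (∑-map (map₁ suc) (splits true ((true , a) ∷ w)) _) (∑-0 (splits true ((true , a) ∷ w)))))
    (ℚ.+-identityʳ _)
∑-splits-guard false ((false , suc a) ∷ w) f =
  trans (cong (f 0 ((false , suc a) ∷ w) +ℚ_)
      (trans (∑-map (map₁ suc) (splits false ((false , a) ∷ w)) _) (∑-0 (splits false ((false , a) ∷ w)))))
    (ℚ.+-identityʳ _)

-- Setting one variable to 0 leaves only the split that spends nothing on it. This flips the colour
-- of the first variable, so variables are dropped two at a time.
guarded : ∀ κ N w (ψ : ℕ → Vec ℕ N → ℚ) →
  ∑ (fundamental κ (suc N) w) (λ x → guard (V.head x) (ψ (V.head x) (V.tail x)))
  ≡ ∑ (fundamental (not κ) N w) (ψ 0)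
guarded κ N w ψ = begin
  ∑ (fundamental κ (suc N) w) (λ x → guard (V.head x) (ψ (V.head x) (V.tail x)))
    ≡⟨ ∑-fundamental κ N w _ ⟩
  ∑ (splits κ w) (λ s → ∑ (fundamental (not κ) N (proj₂ s)) (λ v → guard (proj₁ s) (ψ (proj₁ s) v)))
    ≡⟨ ∑-cong (splits κ w) (λ s → pull (proj₁ s) (fundamental (not κ) N (proj₂ s)) (ψ (proj₁ s))) ⟩
  ∑ (splits κ w) (λ s → guard (proj₁ s) (∑ (fundamental (not κ) N (proj₂ s)) (ψ (proj₁ s))))
    ≡⟨ ∑-splits-guard κ w (λ j w' → ∑ (fundamental (not κ) N w') (ψ j)) ⟩
  ∑ (fundamental (not κ) N w) (ψ 0) ∎
  where
  open ≡-Reasoning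
  pull : ∀ j xs (f : Vec ℕ N → ℚ) → ∑ xs (λ v → guard j (f v)) ≡ guard j (∑ xs f)
  pull zero    xs f = refl
  pull (suc j) xs f = ∑-0 xs

-- Setting two consecutive variables to 0 maps fundamental polynomials to fundamental polynomials.
guarded₂ : ∀ κ N w (ψ : Vec ℕ N → ℚ) (φ : Vec ℕ (suc (suc N)) → ℚ) →
  (∀ j k z → φ (j ∷ k ∷ z) ≡ guard j (guard k (ψ z))) →
  ∑ (fundamental κ (suc (suc N)) w) φ ≡ ∑ (fundamental κ N w) ψ
guarded₂ κ N w ψ φ eq = begin
  ∑ (fundamental κ (suc (suc N)) w) φ
    ≡⟨ ∑-cong (fundamental κ (suc (suc N)) w) (λ where (j ∷ k ∷ z) → eq j k z) ⟩
  ∑ (fundamental κ (suc (suc N)) w) (λ x → guard (V.head x) (ψ₁ (V.tail x)))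
    ≡⟨ guarded κ (suc N) w (λ _ → ψ₁) ⟩
  ∑ (fundamental (not κ) (suc N) w) ψ₁
    ≡⟨ guarded (not κ) N w (λ _ → ψ) ⟩
  ∑ (fundamental (not (not κ)) N w) ψ
    ≡⟨ cong (λ b → ∑ (fundamental b N w) ψ) (not-involutive κ) ⟩
  ∑ (fundamental κ N w) ψ ∎
  where
  open ≡-Reasoning
  ψ₁ : Vec ℕ (suc N) → ℚ
  ψ₁ y = guard (V.head y) (ψ (V.tail y))

-- trim i v φ is the value of φ at (f(…,u,0,0,…) − f(…,0,0,u,…)) / u, where f is the monomial v and
-- u the i-th variable: the quasisymmetric divided difference of Nadeau, Spink and Tewari.
trim : Fin N → Vec ℕ (suc (suc N)) → (Vec ℕ N → ℚ) → ℚ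
trim zero    (suc a ∷ zero  ∷ zero  ∷ v) φ = φ (a ∷ v)
trim zero    (zero  ∷ zero  ∷ suc c ∷ v) φ = -ℚ φ (c ∷ v)
trim zero    (_     ∷ _     ∷ _     ∷ v) φ = 0ℚ
trim (suc i) (a ∷ v)                     φ = trim i v (λ x → φ (a ∷ x))

trim-∑ : ∀ (i : Fin N) v (xs : List A) (f : A → Vec ℕ N → ℚ) →
  trim i v (λ y → ∑ xs (λ x → f x y)) ≡ ∑ xs (λ x → trim i v (f x))
trim-∑ zero (suc a ∷ zero  ∷ zero  ∷ v) xs f = refl
trim-∑ zero (zero  ∷ zero  ∷ suc c ∷ v) xs f = sym (∑-neg xs (λ x → f x (c ∷ v)))
trim-∑ zero (suc a ∷ zero  ∷ suc c ∷ v) xs f = sym (∑-0 xs)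
trim-∑ zero (suc a ∷ suc b ∷ c     ∷ v) xs f = sym (∑-0 xs)
trim-∑ zero (zero  ∷ zero  ∷ zero  ∷ v) xs f = sym (∑-0 xs)
trim-∑ zero (zero  ∷ suc b ∷ c     ∷ v) xs f = sym (∑-0 xs)
trim-∑ (suc i) (a ∷ v) xs f = trim-∑ i v xs (λ x y → f x (a ∷ y))

trim-cong : ∀ (i : Fin N) v {φ ψ : Vec ℕ N → ℚ} → (∀ y → φ y ≡ ψ y) → trim i v φ ≡ trim i v ψ
trim-cong zero (suc a ∷ zero  ∷ zero  ∷ v) eq = eq (a ∷ v)
trim-cong zero (zero  ∷ zero  ∷ suc c ∷ v) eq = cong -ℚ_ (eq (c ∷ v))
trim-cong zero (suc a ∷ zero  ∷ suc c ∷ v) eq = refl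
trim-cong zero (suc a ∷ suc b ∷ c     ∷ v) eq = refl
trim-cong zero (zero  ∷ zero  ∷ zero  ∷ v) eq = refl
trim-cong zero (zero  ∷ suc b ∷ c     ∷ v) eq = refl
trim-cong (suc i) (a ∷ v) eq = trim-cong i v (λ y → eq (a ∷ y))

trim-0 : ∀ (i : Fin N) v {φ} → (∀ y → φ y ≡ 0ℚ) → trim i v φ ≡ 0ℚ
trim-0 zero (suc a ∷ zero  ∷ zero  ∷ v) eq = eq (a ∷ v)
trim-0 zero (zero  ∷ zero  ∷ suc c ∷ v) eq = cong -ℚ_ (eq (c ∷ v))
trim-0 zero (suc a ∷ zero  ∷ suc c ∷ v) eq = refl
trim-0 zero (suc a ∷ suc b ∷ c     ∷ v) eq = refl
trim-0 zero (zero  ∷ zero  ∷ zero  ∷ v) eq = refl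
trim-0 zero (zero  ∷ suc b ∷ c     ∷ v) eq = refl
trim-0 (suc i) (a ∷ v) eq = trim-0 i v (λ y → eq (a ∷ y))

+-double-suc : ∀ s a → s + (suc a + suc a) ≡ suc (suc (s + (a + a)))
+-double-suc s a = begin
  s + (suc a + suc a)        ≡⟨ ℕ.+-suc s (a + suc a) ⟩
  suc (s + (a + suc a))      ≡⟨ cong (λ x → suc (s + x)) (ℕ.+-suc a a) ⟩
  suc (s + suc (a + a))      ≡⟨ cong suc (ℕ.+-suc s (a + a)) ⟩
  suc (suc (s + (a + a)))    ∎
  where open ≡-Reasoning

Dyck-tail₀ : ∀ {t} (v : Vec ℕ N) → Dyck t (0 ∷ v) → Dyck (suc t) v
Dyck-tail₀ v (s , eq , d) =
  subst (λ t → Dyck (suc t) v) (sym (trans eq (ℕ.+-identityʳ s))) d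

-- This is the dual form of the fact that `trim i` preserves 2-Dyck polynomials. Dropping two zeros
-- loses slack 2 and lowering the remaining exponent by 1 gives it back, so the untouched tail is
-- met with the same slack.
trim-cong-Dyck : ∀ (i : Fin N) {t} v {φ ψ : Vec ℕ N → ℚ} → (∀ y → Dyck t y → φ y ≡ ψ y) →
  Dyck t v → trim i v φ ≡ trim i v ψ
trim-cong-Dyck zero (suc a ∷ zero ∷ zero ∷ v) eq (s , t≡ , d) =
  eq (a ∷ v) (suc (suc s) , trans t≡ (+-double-suc s a) , Dyck-tail₀ v (Dyck-tail₀ (0 ∷ v) d))
trim-cong-Dyck zero (zero ∷ zero ∷ suc c ∷ v) eq d with Dyck-tail₀ (suc c ∷ v) (Dyck-tail₀ (0 ∷ suc c ∷ v) d)
... | s , t≡ , d' = cong -ℚ_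
  (eq (c ∷ v) (s , ℕ.suc-injective (ℕ.suc-injective (trans t≡ (+-double-suc s c))) , d'))
trim-cong-Dyck zero (suc a ∷ zero  ∷ suc c ∷ v) eq d = refl
trim-cong-Dyck zero (suc a ∷ suc b ∷ c     ∷ v) eq d = refl
trim-cong-Dyck zero (zero  ∷ zero  ∷ zero  ∷ v) eq d = refl
trim-cong-Dyck zero (zero  ∷ suc b ∷ c     ∷ v) eq d = refl
trim-cong-Dyck (suc i) (a ∷ v) eq (s , t≡ , d) =
  trim-cong-Dyck i v (λ y dy → eq (a ∷ y) (s , t≡ , dy)) d

-- The Leibniz rule: fundamental polynomials behave like constants for trim.
trim-⊕ : ∀ (i : Fin N) κ m w (φ : Vec ℕ N → ℚ) →
  ∑ (fundamental κ (suc (suc N)) w) (λ x → trim i (m ⊕ x) φ)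
  ≡ trim i m (λ y → ∑ (fundamental κ N w) (λ x → φ (y ⊕ x)))
trim-⊕ {suc N} zero κ (suc a ∷ zero ∷ zero ∷ m) w φ = begin
  ∑ (fundamental κ (3 + N) w) (λ x → trim zero ((suc a ∷ 0 ∷ 0 ∷ m) ⊕ x) φ)
    ≡⟨ ∑-fundamental κ (suc (suc N)) w _ ⟩
  ∑ (splits κ w) (λ s → ∑ (fundamental (not κ) (2 + N) (proj₂ s))
    (λ x → trim zero ((suc a ∷ 0 ∷ 0 ∷ m) ⊕ (proj₁ s ∷ x)) φ))
    ≡⟨ ∑-cong (splits κ w) (λ s → guarded₂ (not κ) N (proj₂ s)
         (λ z → φ ((a + proj₁ s) ∷ (m ⊕ z))) _ (reduced (proj₁ s))) ⟩
  ∑ (splits κ w) (λ s → ∑ (fundamental (not κ) N (proj₂ s)) (λ z → φ ((a + proj₁ s) ∷ (m ⊕ z))))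
    ≡⟨ sym (∑-fundamental κ N w _) ⟩
  ∑ (fundamental κ (suc N) w) (λ x → φ ((a ∷ m) ⊕ x)) ∎
  where
  open ≡-Reasoning
  reduced : ∀ i j k z → trim zero ((suc a ∷ 0 ∷ 0 ∷ m) ⊕ (i ∷ j ∷ k ∷ z)) φ
    ≡ guard j (guard k (φ ((a + i) ∷ (m ⊕ z))))
  reduced i zero    zero    z = refl
  reduced i zero    (suc k) z = refl
  reduced i (suc j) k       z = refl
trim-⊕ {suc N} zero κ (zero ∷ zero ∷ suc c ∷ m) w φ =
  trans (guarded₂ κ (suc N) w (λ y → -ℚ φ ((c ∷ m) ⊕ y)) _ reduced)
    (∑-neg (fundamental κ (suc N) w) _)
  where
  reduced : ∀ i j z → trim zero ((0 ∷ 0 ∷ suc c ∷ m) ⊕ (i ∷ j ∷ z)) φ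
    ≡ guard i (guard j (-ℚ φ ((c ∷ m) ⊕ z)))
  reduced zero    zero    (k ∷ z) = refl
  reduced zero    (suc j) (k ∷ z) = refl
  reduced (suc i) zero    (k ∷ z) = refl
  reduced (suc i) (suc j) (k ∷ z) = refl
-- Only here do both substitutions contribute, since the multiplier contains none of the three
-- variables. Each turns the fundamental polynomial of `w` into the one with two variables fewer, so
-- the difference vanishes.
trim-⊕ {suc N} zero κ (zero ∷ zero ∷ zero ∷ m) w φ = begin
  ∑ (fundamental κ (3 + N) w) (λ x → trim zero ((0 ∷ 0 ∷ 0 ∷ m) ⊕ x) φ)
    ≡⟨ ∑-cong (fundamental κ (3 + N) w) (λ where (i ∷ j ∷ k ∷ z) → reduced i j k z) ⟩
  ∑ (fundamental κ (3 + N) w) (λ x → left x +ℚ (-ℚ right x))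
    ≡⟨ ∑-+ (fundamental κ (3 + N) w) left (λ x → -ℚ right x) ⟩
  ∑ (fundamental κ (3 + N) w) left +ℚ ∑ (fundamental κ (3 + N) w) (λ x → -ℚ right x)
    ≡⟨ cong (∑ (fundamental κ (3 + N) w) left +ℚ_) (∑-neg (fundamental κ (3 + N) w) right) ⟩
  ∑ (fundamental κ (3 + N) w) left +ℚ (-ℚ ∑ (fundamental κ (3 + N) w) right)
    ≡⟨ cong₂ (λ x y → x +ℚ (-ℚ y)) ∑-left ∑-right ⟩
  ∑ (fundamental κ (suc N) w) lowered +ℚ (-ℚ ∑ (fundamental κ (suc N) w) lowered)
    ≡⟨ ℚ.+-inverseʳ (∑ (fundamental κ (suc N) w) lowered) ⟩
  0ℚ ∎
  where
  open ≡-Reasoning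
  -- Division by `u`. Terms free of `u` may be given the value 0, because they are the same in both
  -- substitutions.
  lowered : Vec ℕ (suc N) → ℚ
  lowered (zero  ∷ z) = 0ℚ
  lowered (suc i ∷ z) = φ (i ∷ (m ⊕ z))
  left right : Vec ℕ (3 + N) → ℚ
  left  (i ∷ j ∷ k ∷ z) = guard j (guard k (lowered (i ∷ z)))
  right (i ∷ j ∷ k ∷ z) = guard i (guard j (lowered (k ∷ z)))
  reduced : ∀ i j k z → trim zero (i ∷ j ∷ k ∷ (m ⊕ z)) φ ≡
    left (i ∷ j ∷ k ∷ z) +ℚ (-ℚ right (i ∷ j ∷ k ∷ z))
  reduced zero    zero    zero    z = refl
  reduced zero    zero    (suc k) z = sym (ℚ.+-identityˡ _)
  reduced zero    (suc j) k       z = refl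
  reduced (suc i) zero    zero    z = sym (ℚ.+-identityʳ _)
  reduced (suc i) zero    (suc k) z = refl
  reduced (suc i) (suc j) k       z = refl
  ∑-left : ∑ (fundamental κ (3 + N) w) left ≡ ∑ (fundamental κ (suc N) w) lowered
  ∑-left = begin
    ∑ (fundamental κ (3 + N) w) left
      ≡⟨ ∑-fundamental κ (2 + N) w left ⟩
    ∑ (splits κ w) (λ s → ∑ (fundamental (not κ) (2 + N) (proj₂ s)) (λ x → left (proj₁ s ∷ x)))
      ≡⟨ ∑-cong (splits κ w) (λ s → guarded₂ (not κ) N (proj₂ s)
           (λ z → lowered (proj₁ s ∷ z)) _ (λ _ _ _ → refl)) ⟩
    ∑ (splits κ w) (λ s → ∑ (fundamental (not κ) N (proj₂ s)) (λ z → lowered (proj₁ s ∷ z)))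
      ≡⟨ sym (∑-fundamental κ N w lowered) ⟩
    ∑ (fundamental κ (suc N) w) lowered ∎
  ∑-right : ∑ (fundamental κ (3 + N) w) right ≡ ∑ (fundamental κ (suc N) w) lowered
  ∑-right = guarded₂ κ (suc N) w lowered right (λ where i j (k ∷ z) → refl)
trim-⊕ {suc N} zero κ (suc a ∷ zero ∷ suc c ∷ m) w φ =
  ∑-zero (All.universal (λ where
    (i ∷ zero  ∷ k ∷ z) → refl
    (i ∷ suc j ∷ k ∷ z) → refl) (fundamental κ (3 + N) w))
trim-⊕ {suc N} zero κ (suc a ∷ suc b ∷ c ∷ m) w φ =
  ∑-zero (All.universal (λ where (i ∷ j ∷ k ∷ z) → refl) (fundamental κ (3 + N) w))
trim-⊕ {suc N} zero κ (zero ∷ suc b ∷ c ∷ m) w φ =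
  ∑-zero (All.universal (λ where
    (zero  ∷ j ∷ k ∷ z) → refl
    (suc i ∷ j ∷ k ∷ z) → refl) (fundamental κ (3 + N) w))
trim-⊕ {suc N} (suc i) κ (a ∷ m) w φ = begin
  ∑ (fundamental κ (3 + N) w) (λ x → trim (suc i) ((a ∷ m) ⊕ x) φ)
    ≡⟨ ∑-fundamental κ (2 + N) w _ ⟩
  ∑ (splits κ w) (λ s → ∑ (fundamental (not κ) (2 + N) (proj₂ s))
    (λ x → trim i (m ⊕ x) (λ y → φ ((a + proj₁ s) ∷ y))))
    ≡⟨ ∑-cong (splits κ w) (λ s → trim-⊕ i (not κ) m (proj₂ s) _) ⟩
  ∑ (splits κ w) (λ s → trim i m
    (λ y → ∑ (fundamental (not κ) N (proj₂ s)) (λ x → φ ((a + proj₁ s) ∷ (y ⊕ x)))))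
    ≡⟨ sym (trim-∑ i m (splits κ w) _) ⟩
  trim i m (λ y → ∑ (splits κ w)
    (λ s → ∑ (fundamental (not κ) N (proj₂ s)) (λ x → φ ((a + proj₁ s) ∷ (y ⊕ x)))))
    ≡⟨ trim-cong i m (λ y → sym (∑-fundamental κ N w _)) ⟩
  trim i m (λ y → ∑ (fundamental κ (suc N) w) (λ x → φ ((a ∷ y) ⊕ x))) ∎
  where open ≡-Reasoning

-- The annihilator of the ideal, tested on monomial multiples of its generators.
Vanishing : Bool → (Vec ℕ N → ℚ) → Set
Vanishing {N} κ φ = ∀ m {w} → NonEmpty w → ∑ (fundamental κ N w) (λ x → φ (m ⊕ x)) ≡ 0ℚ

-- The transpose of `trim i` carries annihilators to annihilators in two more variables: by the
-- Leibniz rule the test on `m` becomes `trim i m` of a functional that is 0 everywhere.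
vanishing-trim : ∀ {κ} (i : Fin N) {φ} → Vanishing κ φ → Vanishing κ (λ v → trim i v φ)
vanishing-trim {κ = κ} i {φ} van m {w} ne =
  trans (trim-⊕ i κ m w φ) (trim-0 i m (λ y → van y ne))

ifEq : ℕ → ℕ → ℚ → ℚ
ifEq zero    zero    q = q
ifEq (suc a) (suc b) q = ifEq a b q
ifEq zero    (suc b) q = 0ℚ
ifEq (suc a) zero    q = 0ℚ

ifEq-refl : ∀ a q → ifEq a a q ≡ q
ifEq-refl zero    q = refl
ifEq-refl (suc a) q = ifEq-refl a q

ifEq-≢ : ∀ {a b} → a ≢ b → ∀ q → ifEq a b q ≡ 0ℚ
ifEq-≢ {zero}  {zero}  a≢b q = ⊥-elim (a≢b refl)
ifEq-≢ {suc a} {suc b} a≢b q = ifEq-≢ (λ eq → a≢b (cong suc eq)) q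
ifEq-≢ {zero}  {suc b} a≢b q = refl
ifEq-≢ {suc a} {zero}  a≢b q = refl

ifEq-0 : ∀ a b → ifEq a b 0ℚ ≡ 0ℚ
ifEq-0 zero    zero    = refl
ifEq-0 (suc a) (suc b) = ifEq-0 a b
ifEq-0 zero    (suc b) = refl
ifEq-0 (suc a) zero    = refl

δᵥ : Vec ℕ N → Vec ℕ N → ℚ
δᵥ []      []      = 1ℚ
δᵥ (a ∷ e) (b ∷ v) = ifEq a b (δᵥ e v)

δᵥ-refl : ∀ (e : Vec ℕ N) → δᵥ e e ≡ 1ℚ
δᵥ-refl []      = refl
δᵥ-refl (a ∷ e) = trans (ifEq-refl a (δᵥ e e)) (δᵥ-refl e)

δᵥ-≢ : ∀ {e v : Vec ℕ N} → v ≢ e → δᵥ e v ≡ 0ℚ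
δᵥ-≢ {e = []}    {[]}    v≢e = ⊥-elim (v≢e refl)
δᵥ-≢ {e = a ∷ e} {b ∷ v} v≢e with a ℕ.≟ b
... | no a≢b   = ifEq-≢ a≢b (δᵥ e v)
... | yes refl = trans (ifEq-refl a (δᵥ e v)) (δᵥ-≢ (λ eq → v≢e (cong (a ∷_) eq)))

-- Every product `m ⊕ x` has positive degree in the colour of the first run of `w`, so it is never
-- the constant monomial.
vanishing-δᵥ-zeros : ∀ κ N → Vanishing κ (δᵥ (zeros N))
vanishing-δᵥ-zeros κ N m {(b , a) ∷ w} cons =
  ∑-zero (All.map (λ {x} eq → δᵥ-≢ (nonzero x eq)) (fundamental-deg b κ N ((b , a) ∷ w)))
  where
  pick-refl : ∀ b a → pick b b a ≡ a
  pick-refl true  a = refl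
  pick-refl false a = refl
  nonzero : ∀ x → deg b (alt κ) x ≡ sdeg b ((b , a) ∷ w) → m ⊕ x ≢ zeros N
  nonzero x eq eq0 = ℕ.1+n≢0 (begin
    suc a + sdeg b w                          ≡⟨ cong (_+ sdeg b w) (sym (pick-refl b (suc a))) ⟩
    sdeg b ((b , a) ∷ w)                      ≡⟨ sym eq ⟩
    deg b (alt κ) x                           ≡⟨ ℕ.m+n≡0⇒n≡0 (deg b (alt κ) m) (begin
      deg b (alt κ) m + deg b (alt κ) x         ≡⟨ sym (deg-⊕ b (alt κ) m x) ⟩
      deg b (alt κ) (m ⊕ x)                     ≡⟨ cong (deg b (alt κ)) eq0 ⟩
      deg b (alt κ) (zeros N)                   ≡⟨ deg-zeros b (alt κ) N ⟩
      0                                         ∎) ⟩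
    0                                         ∎)
    where open ≡-Reasoning

early late : Fin N → Vec ℕ N → Vec ℕ (suc (suc N))
early zero    (a ∷ v) = suc a ∷ 0 ∷ 0 ∷ v
early (suc i) (a ∷ v) = a ∷ early i v
late  zero    (a ∷ v) = 0 ∷ 0 ∷ suc a ∷ v
late  (suc i) (a ∷ v) = a ∷ late i v

-- Exactly two monomials have `y` in their image under `trim i`: `early i y` with coefficient 1 and
-- `late i y` with coefficient -1.
trim-δᵥ : ∀ (i : Fin N) y v → δᵥ (late i y) v ≡ δᵥ (early i y) v +ℚ (-ℚ trim i v (δᵥ y))
trim-δᵥ zero (a ∷ y) (suc b ∷ zero ∷ zero ∷ v) = sym (ℚ.+-inverseʳ (ifEq a b (δᵥ y v)))
trim-δᵥ zero (a ∷ y) (zero ∷ zero ∷ suc c ∷ v) =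
  sym (trans (ℚ.+-identityˡ _) (neg-involutive (ifEq a c (δᵥ y v))))
  where
  open +-*-Solver
  neg-involutive : ∀ q → -ℚ (-ℚ q) ≡ q
  neg-involutive = solve 1 (λ q → :- (:- q) := q) refl
trim-δᵥ zero (a ∷ y) (suc b ∷ zero  ∷ suc c ∷ v) = sym (cong (_+ℚ (-ℚ 0ℚ)) (ifEq-0 a b))
trim-δᵥ zero (a ∷ y) (suc b ∷ suc _ ∷ c     ∷ v) = sym (cong (_+ℚ (-ℚ 0ℚ)) (ifEq-0 a b))
trim-δᵥ zero (a ∷ y) (zero  ∷ zero  ∷ zero  ∷ v) = refl
trim-δᵥ zero (a ∷ y) (zero  ∷ suc b ∷ c     ∷ v) = refl
trim-δᵥ (suc i) (a ∷ y) (b ∷ v) with a ℕ.≟ b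
... | yes refl = begin
  ifEq a a (δᵥ (late i y) v)
    ≡⟨ ifEq-refl a _ ⟩
  δᵥ (late i y) v
    ≡⟨ trim-δᵥ i y v ⟩
  δᵥ (early i y) v +ℚ (-ℚ trim i v (δᵥ y))
    ≡⟨ sym (cong₂ (λ p q → p +ℚ (-ℚ q)) (ifEq-refl a _) (trim-cong i v (λ x → ifEq-refl a (δᵥ y x)))) ⟩
  ifEq a a (δᵥ (early i y) v) +ℚ (-ℚ trim i v (λ x → ifEq a a (δᵥ y x))) ∎
  where open ≡-Reasoning
... | no a≢b = trans (ifEq-≢ a≢b (δᵥ (late i y) v))
  (sym (cong₂ (λ p q → p +ℚ (-ℚ q)) (ifEq-≢ a≢b (δᵥ (early i y) v))
    (trim-0 i v (λ x → ifEq-≢ a≢b (δᵥ y x)))))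

data LeadingZeros : ℕ → Vec ℕ N → Set where
  here  : ∀ {a} {v : Vec ℕ N} → LeadingZeros 0 (suc a ∷ v)
  there : ∀ {i} {v : Vec ℕ N} → LeadingZeros i v → LeadingZeros (suc i) (0 ∷ v)

leadingZeros? : ∀ (v : Vec ℕ N) → v ≡ zeros N ⊎ ∃[ i ] LeadingZeros i v
leadingZeros? []          = inj₁ refl
leadingZeros? (suc a ∷ v) = inj₂ (0 , here)
leadingZeros? (zero  ∷ v) with leadingZeros? v
... | inj₁ refl     = inj₁ refl
... | inj₂ (i , lz) = inj₂ (suc i , there lz)

-- The two added zeros may be taken to be those directly before the first nonzero entry. Moving that
-- entry past them leaves `i` zeros in front.
as-late : ∀ {i} {v : Vec ℕ N} → LeadingZeros i v →
  ∃[ j ] ∃[ y ] (0 ∷ 0 ∷ v ≡ late j y × LeadingZeros i (early j y))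
as-late (here {a = a} {v}) = zero , a ∷ v , refl , here
as-late (there lz) with as-late lz
... | j , y , eq , lz' = suc j , 0 ∷ y , cong (0 ∷_) eq , there lz'

¬Dyck-0 : ∀ {a} {v : Vec ℕ N} → ¬ Dyck 0 (suc a ∷ v)
¬Dyck-0 {a = a} (s , eq , _) = ℕ.1+n≢0 (sym (trans eq (+-double-suc s a)))

¬Dyck-1 : ∀ {a} {v : Vec ℕ N} → ¬ Dyck 1 (suc a ∷ v)
¬Dyck-1 {a = a} (s , eq , _) = ℕ.1+n≢0 (sym (ℕ.suc-injective (trans eq (+-double-suc s a))))

-- A certificate that `e` has coefficient 0 in every 2-Dyck polynomial of the ideal. Away from the
-- 2-Dyck vectors the functional may differ from the coefficient, and this freedom is what lets it
-- vanish on the ideal.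
record Separates (n : ℕ) (e : Vec ℕ (dbl n)) : Set where
  constructor separates
  field
    functional : Vec ℕ (dbl n) → ℚ
    vanishing  : Vanishing true functional
    agrees     : ∀ v → Dyck 0 v → δᵥ e v ≡ functional v

-- With e = late j y, the value of trim j v (δᵥ y) is the coefficient of early j y minus that of e,
-- and early j y has two leading zeros fewer; moving the first nonzero entry to the left ends at a
-- vector that is not 2-Dyck.
separate-nonzero : ∀ n → (∀ y → Separates n y) → ∀ i e → LeadingZeros i e → Separates (suc n) e
-- Moves by two places end, according to parity, at the first or the second variable. A nonzero
-- exponent at either breaks the 2-Dyck condition, so the zero functional agrees with `δᵥ` on 2-Dyck
-- vectors.
separate-nonzero n sep zero (suc a ∷ e) here = separates (λ _ → 0ℚ)
  (λ m {w} _ → ∑-0 (fundamental true (dbl (suc n)) w))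
  (λ v d → δᵥ-≢ {e = suc a ∷ e} {v} (λ where refl → ¬Dyck-0 {v = e} d))
separate-nonzero n sep (suc zero) (0 ∷ suc a ∷ e) (there here) = separates (λ _ → 0ℚ)
  (λ m {w} _ → ∑-0 (fundamental true (dbl (suc n)) w))
  (λ v d → δᵥ-≢ {e = 0 ∷ suc a ∷ e} {v} (λ where refl → ¬Dyck-1 {v = e} (Dyck-tail₀ (suc a ∷ e) d)))
separate-nonzero n sep (suc (suc i)) (0 ∷ 0 ∷ e) (there (there lz)) with as-late lz
... | j , y , eq , lz' with separate-nonzero n sep i (early j y) lz' | sep y
...   | separates φ φ-van φ-agrees | separates ψ ψ-van ψ-agrees = separates
  (λ v → φ v +ℚ (-ℚ trim j v ψ))
  (λ m {w} ne → begin
    ∑ (W w) (λ x → φ (m ⊕ x) +ℚ (-ℚ trim j (m ⊕ x) ψ))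
      ≡⟨ ∑-+ (W w) (λ x → φ (m ⊕ x)) _ ⟩
    ∑ (W w) (λ x → φ (m ⊕ x)) +ℚ ∑ (W w) (λ x → -ℚ trim j (m ⊕ x) ψ)
      ≡⟨ cong₂ _+ℚ_ (φ-van m ne) (trans (∑-neg (W w) _) (cong -ℚ_ (vanishing-trim j ψ-van m ne))) ⟩
    0ℚ ∎)
  (λ v d → begin
    δᵥ (0 ∷ 0 ∷ e) v
      ≡⟨ cong (λ e → δᵥ e v) eq ⟩
    δᵥ (late j y) v
      ≡⟨ trim-δᵥ j y v ⟩
    δᵥ (early j y) v +ℚ (-ℚ trim j v (δᵥ y))
      ≡⟨ cong₂ (λ p q → p +ℚ (-ℚ q)) (φ-agrees v d) (trim-cong-Dyck j v ψ-agrees d) ⟩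
    φ v +ℚ (-ℚ trim j v ψ) ∎)
  where
  open ≡-Reasoning
  W : SComp → List (Vec ℕ (dbl (suc n)))
  W = fundamental true (dbl (suc n))

separate : ∀ n e → Separates n e
separate n e with leadingZeros? e
separate n       e | inj₁ refl =
  separates (δᵥ (zeros (dbl n))) (vanishing-δᵥ-zeros true (dbl n)) (λ _ _ → refl)
separate (suc n) e | inj₂ (i , lz) = separate-nonzero n (separate n) i e lz

-- Counting 2-Dyck vectors

sumUpTo : (ℕ → ℕ) → ℕ → ℕ
sumUpTo g zero    = g 0
sumUpTo g (suc k) = g (suc k) + sumUpTo g k

-- The degree `k` is shared between a vector and a last entry appended to it; `a` accumulates what
-- the last entry has received so far.
spread : (ℕ → List (Vec ℕ N)) → ℕ → ℕ → List (Vec ℕ (suc N))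
spread f zero    a = L.map (_∷ʳ a) (f 0)
spread f (suc k) a = L.map (_∷ʳ a) (f (suc k)) ++ spread f k (suc a)

length-spread : ∀ (f : ℕ → List (Vec ℕ N)) k a →
  L.length (spread f k a) ≡ sumUpTo (λ k → L.length (f k)) k
length-spread f zero    a = L.length-map (_∷ʳ a) (f 0)
length-spread f (suc k) a = trans (L.length-++ (L.map (_∷ʳ a) (f (suc k))))
  (cong₂ _+_ (L.length-map (_∷ʳ a) (f (suc k))) (length-spread f k (suc a)))

∈-spread⁻ : ∀ (f : ℕ → List (Vec ℕ N)) k a {x} → x ∈ spread f k a →
  ∃[ j ] ∃[ k' ] ∃[ v ] (k' + j ≡ k × v ∈ f k' × x ≡ v ∷ʳ (a + j))
∈-spread⁻ f zero a x∈ with ∈-map⁻ (_∷ʳ a) x∈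
... | v , v∈ , refl = 0 , 0 , v , refl , v∈ , cong (v ∷ʳ_) (sym (ℕ.+-identityʳ a))
∈-spread⁻ f (suc k) a x∈ with ∈-++⁻ (L.map (_∷ʳ a) (f (suc k))) x∈
... | inj₂ x∈' with ∈-spread⁻ f k (suc a) x∈'
...   | j , k' , v , eq , v∈ , refl =
  suc j , k' , v , trans (ℕ.+-suc k' j) (cong suc eq) , v∈ , cong (v ∷ʳ_) (sym (ℕ.+-suc a j))
∈-spread⁻ f (suc k) a x∈ | inj₁ x∈' with ∈-map⁻ (_∷ʳ a) x∈'
... | v , v∈ , refl =
  0 , suc k , v , ℕ.+-identityʳ (suc k) , v∈ , cong (v ∷ʳ_) (sym (ℕ.+-identityʳ a))

∈-spread⁺ : ∀ (f : ℕ → List (Vec ℕ N)) k' j a {v} → v ∈ f k' → v ∷ʳ (j + a) ∈ spread f (j + k') a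
∈-spread⁺ f zero     zero    a v∈ = ∈-map⁺ (_∷ʳ a) v∈
∈-spread⁺ f (suc k') zero    a v∈ = ∈-++⁺ˡ (∈-map⁺ (_∷ʳ a) v∈)
∈-spread⁺ f k'       (suc j) a {v} v∈ = ∈-++⁺ʳ (L.map (_∷ʳ a) (f (suc (j + k'))))
  (subst (λ b → v ∷ʳ b ∈ spread f (j + k') (suc a)) (ℕ.+-suc j a) (∈-spread⁺ f k' j (suc a) v∈))

spread-unique : ∀ (f : ℕ → List (Vec ℕ N)) → (∀ k → Unique (f k)) → ∀ k a → Unique (spread f k a)
spread-unique f uniq zero    a = Unique.map⁺ (λ {v} {w} → V.∷ʳ-injectiveˡ v w) (uniq 0)
spread-unique f uniq (suc k) a = Unique.++⁺
  (Unique.map⁺ (λ {v} {w} → V.∷ʳ-injectiveˡ v w) (uniq (suc k)))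
  (spread-unique f uniq k (suc a)) disjoint
  where
  disjoint : ∀ {x} → ¬ (x ∈ L.map (_∷ʳ a) (f (suc k)) × x ∈ spread f k (suc a))
  disjoint (x∈ , x∈') with ∈-map⁻ (_∷ʳ a) x∈ | ∈-spread⁻ f k (suc a) x∈'
  ... | v , _ , eq | j , _ , v' , _ , _ , eq' =
    ℕ.m≢1+m+n a (V.∷ʳ-injectiveʳ v v' (trans (sym eq) eq'))

-- The 2-Dyck vectors of degrees k and l in the variables i with χ i = true and χ i = false.
dyckVectors : (ℕ → Bool) → (N k l : ℕ) → List (Vec ℕ N)
dyckVectors χ zero    zero zero = [] ∷ []
dyckVectors χ zero    _    _    = []
-- The condition at the variable of index `N`: twice the sum of the entries up to it is at most `N`.
-- The conditions at earlier variables concern the shorter vector.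
dyckVectors χ (suc N) k    l with k + l + (k + l) ℕ.≤? N
... | no  _ = []
... | yes _ with χ N
...   | true  = spread (λ k' → dyckVectors χ N k' l) k 0
...   | false = spread (λ l' → dyckVectors χ N k l') l 0

dyckVectors-unique : ∀ χ N k l → Unique (dyckVectors χ N k l)
dyckVectors-unique χ zero    zero    zero    = [] ∷ []
dyckVectors-unique χ zero    zero    (suc l) = []
dyckVectors-unique χ zero    (suc k) l       = []
dyckVectors-unique χ (suc N) k       l with k + l + (k + l) ℕ.≤? N
... | no  _ = []
... | yes _ with χ N
...   | true  = spread-unique _ (λ k' → dyckVectors-unique χ N k' l) k 0
...   | false = spread-unique _ (λ l' → dyckVectors-unique χ N k l') l 0

deg-∷ʳ : ∀ b χ (v : Vec ℕ N) a → deg b χ (v ∷ʳ a) ≡ deg b χ v + pick b (χ N) a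
deg-∷ʳ b χ []      a = ℕ.+-identityʳ _
deg-∷ʳ b χ (c ∷ v) a = trans (cong (pick b (χ 0) c +_) (deg-∷ʳ b (χ ∘ suc) v a))
  (sym (ℕ.+-assoc (pick b (χ 0) c) _ _))

deg-sum : ∀ χ (v : Vec ℕ N) → deg true χ v + deg false χ v ≡ V.sum v
deg-sum χ []      = refl
deg-sum χ (a ∷ v) = begin
  (pick true (χ 0) a + deg true (χ ∘ suc) v) + (pick false (χ 0) a + deg false (χ ∘ suc) v)
    ≡⟨ interchange (pick true (χ 0) a) _ _ _ ⟩
  (pick true (χ 0) a + pick false (χ 0) a) + (deg true (χ ∘ suc) v + deg false (χ ∘ suc) v)
    ≡⟨ cong₂ _+_ (pick-sum (χ 0)) (deg-sum (χ ∘ suc) v) ⟩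
  a + V.sum v ∎
  where
  open ≡-Reasoning
  pick-sum : ∀ b → pick true b a + pick false b a ≡ a
  pick-sum true  = ℕ.+-identityʳ a
  pick-sum false = refl

Dyck-∷ʳ⁺ : ∀ {t} (v : Vec ℕ N) a → Dyck t v → V.sum v + a + (V.sum v + a) ≤ t + N → Dyck t (v ∷ʳ a)
Dyck-∷ʳ⁺ {t = t} [] a d le with ℕ.m≤n⇒∃[o]m+o≡n le
... | s , eq = s , trans (sym (ℕ.+-identityʳ t)) (trans (sym eq) (ℕ.+-comm (a + a) s)) , tt
Dyck-∷ʳ⁺ {suc N} (b ∷ v) a (s , refl , d) le = s , refl , Dyck-∷ʳ⁺ v a d
  (ℕ.+-cancelˡ-≤ (b + b) _ _ (subst₂ _≤_ (left b (V.sum v) a) (right b s N) le))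
  where
  open ℕ-Solver
  left : ∀ b S a → b + S + a + (b + S + a) ≡ b + b + (S + a + (S + a))
  left = solve 3 (λ b S a → b :+ S :+ a :+ (b :+ S :+ a) := b :+ b :+ (S :+ a :+ (S :+ a))) refl
  right : ∀ b s N → s + (b + b) + suc N ≡ b + b + (suc s + N)
  right = solve 3 (λ b s N → s :+ (b :+ b) :+ (con 1 :+ N) := b :+ b :+ (con 1 :+ s :+ N)) refl

Dyck-∷ʳ⁻ : ∀ {t} (v : Vec ℕ N) a → Dyck t (v ∷ʳ a) → Dyck t v × V.sum v + a + (V.sum v + a) ≤ t + N
Dyck-∷ʳ⁻ {t = t} [] a (s , refl , _) =
  tt , ℕ.≤-trans (ℕ.m≤n+m (a + a) s) (ℕ.≤-reflexive (sym (ℕ.+-identityʳ t)))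
Dyck-∷ʳ⁻ {suc N} (b ∷ v) a (s , refl , d) with Dyck-∷ʳ⁻ v a d
... | d' , le = (s , refl , d') , subst₂ _≤_ (left b (V.sum v) a) (right b s N) (ℕ.+-monoʳ-≤ (b + b) le)
  where
  open ℕ-Solver
  left : ∀ b S a → b + b + (S + a + (S + a)) ≡ b + S + a + (b + S + a)
  left = solve 3 (λ b S a → b :+ b :+ (S :+ a :+ (S :+ a)) := b :+ S :+ a :+ (b :+ S :+ a)) refl
  right : ∀ b s N → b + b + (suc s + N) ≡ s + (b + b) + suc N
  right = solve 3 (λ b s N → b :+ b :+ (con 1 :+ s :+ N) := s :+ (b :+ b) :+ (con 1 :+ N)) refl

Dyck-sum : ∀ {t} (v : Vec ℕ N) → Dyck t v → V.sum v + V.sum v ≤ t + N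
Dyck-sum []      _ = z≤n
Dyck-sum {suc N} (b ∷ v) (s , refl , d) =
  subst₂ _≤_ (left b (V.sum v)) (right b s N) (ℕ.+-monoʳ-≤ (b + b) (Dyck-sum v d))
  where
  open ℕ-Solver
  left : ∀ b S → b + b + (S + S) ≡ b + S + (b + S)
  left = solve 2 (λ b S → b :+ b :+ (S :+ S) := b :+ S :+ (b :+ S)) refl
  right : ∀ b s N → b + b + (suc s + N) ≡ s + (b + b) + suc N
  right = solve 3 (λ b s N → b :+ b :+ (con 1 :+ s :+ N) := s :+ (b :+ b) :+ (con 1 :+ N)) refl

HasDegrees : (ℕ → Bool) → ℕ → ℕ → Vec ℕ N → Set
HasDegrees χ k l v = deg true χ v ≡ k × deg false χ v ≡ l

hasDegrees-sum : ∀ {χ k l} (v : Vec ℕ N) → HasDegrees χ k l v → V.sum v ≡ k + l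
hasDegrees-sum {χ = χ} v (refl , refl) = sym (deg-sum χ v)

hasDegrees-∷ʳ : ∀ {χ k l} {v : Vec ℕ N} a → HasDegrees χ k l v →
  HasDegrees χ (k + pick true (χ N) a) (l + pick false (χ N) a) (v ∷ʳ a)
hasDegrees-∷ʳ {χ = χ} {v = v} a (refl , refl) = deg-∷ʳ true χ v a , deg-∷ʳ false χ v a

dyckVectors-sound : ∀ χ N k l {x} → x ∈ dyckVectors χ N k l → Dyck 0 x × HasDegrees χ k l x
dyckVectors-sound χ zero    zero    zero    (here refl) = tt , refl , refl
dyckVectors-sound χ (suc N) k l x∈ with k + l + (k + l) ℕ.≤? N
dyckVectors-sound χ (suc N) k l () | no _
dyckVectors-sound χ (suc N) k l x∈ | yes le with χ N in χN
dyckVectors-sound χ (suc N) k l x∈ | yes le | true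
  with ∈-spread⁻ (λ k' → dyckVectors χ N k' l) k 0 x∈
... | j , k' , v , refl , v∈ , refl with dyckVectors-sound χ N k' l v∈
...   | d , h = Dyck-∷ʳ⁺ v j d (subst (λ s → s + j + (s + j) ≤ N) (sym (hasDegrees-sum v h))
                  (subst (λ s → s + s ≤ N) (swap k' j l) le)) ,
                degrees (hasDegrees-∷ʳ {v = v} j h)
  where
  swap : ∀ a b c → a + b + c ≡ a + c + b
  swap = solve 3 (λ a b c → a :+ b :+ c := a :+ c :+ b) refl where open ℕ-Solver
  degrees : HasDegrees χ (k' + pick true (χ N) j) (l + pick false (χ N) j) (v ∷ʳ j) →
    HasDegrees χ (k' + j) l (v ∷ʳ j)
  degrees rewrite χN | ℕ.+-identityʳ l = id
dyckVectors-sound χ (suc N) k l x∈ | yes le | false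
  with ∈-spread⁻ (λ l' → dyckVectors χ N k l') l 0 x∈
... | j , l' , v , refl , v∈ , refl with dyckVectors-sound χ N k l' v∈
...   | d , h = Dyck-∷ʳ⁺ v j d (subst (λ s → s + j + (s + j) ≤ N) (sym (hasDegrees-sum v h))
                  (subst (λ s → s + s ≤ N) (sym (ℕ.+-assoc k l' j)) le)) ,
                degrees (hasDegrees-∷ʳ {v = v} j h)
  where
  degrees : HasDegrees χ (k + pick true (χ N) j) (l' + pick false (χ N) j) (v ∷ʳ j) →
    HasDegrees χ k (l' + j) (v ∷ʳ j)
  degrees rewrite χN | ℕ.+-identityʳ k = id

dyckVectors-complete : ∀ χ N (x : Vec ℕ N) → Dyck 0 x → ∀ {k l} → HasDegrees χ k l x →
  x ∈ dyckVectors χ N k l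
dyckVectors-complete χ zero    [] _ (refl , refl) = here refl
dyckVectors-complete χ (suc N) x d {k} {l} h with V.initLast x
... | v , a , refl with Dyck-∷ʳ⁻ v a d
...   | d' , le with k + l + (k + l) ℕ.≤? N
...     | no ≰N = ⊥-elim (≰N (subst (λ s → s + s ≤ N) (trans (sym (sum-∷ʳ v a)) (hasDegrees-sum (v ∷ʳ a) h)) le))
  where
  sum-∷ʳ : ∀ {N} (v : Vec ℕ N) a → V.sum (v ∷ʳ a) ≡ V.sum v + a
  sum-∷ʳ []      a = ℕ.+-identityʳ a
  sum-∷ʳ (b ∷ v) a = trans (cong (b +_) (sum-∷ʳ v a)) (sym (ℕ.+-assoc b (V.sum v) a))
dyckVectors-complete χ (suc N) x d {k} {l} (refl , refl) | v , a , refl | d' , le | yes _ with χ N in χN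
... | true = subst₂ (λ k'' l' → v ∷ʳ a ∈ spread (λ k' → dyckVectors χ N k' l') k'' 0)
    (trans (ℕ.+-comm a _) (sym (trans (deg-∷ʳ true χ v a) (cong (λ b → deg true χ v + pick true b a) χN))))
    (sym (trans (deg-∷ʳ false χ v a) (trans (cong (λ b → deg false χ v + pick false b a) χN) (ℕ.+-identityʳ _))))
    (subst (λ b → v ∷ʳ b ∈ spread (λ k' → dyckVectors χ N k' (deg false χ v)) (a + deg true χ v) 0) (ℕ.+-identityʳ a)
      (∈-spread⁺ (λ k' → dyckVectors χ N k' (deg false χ v)) (deg true χ v) a 0
        (dyckVectors-complete χ N v d' (refl , refl))))
... | false = subst₂ (λ k' l'' → v ∷ʳ a ∈ spread (λ l' → dyckVectors χ N k' l') l'' 0)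
    (sym (trans (deg-∷ʳ true χ v a) (trans (cong (λ b → deg true χ v + pick true b a) χN) (ℕ.+-identityʳ _))))
    (trans (ℕ.+-comm a _) (sym (trans (deg-∷ʳ false χ v a) (cong (λ b → deg false χ v + pick false b a) χN))))
    (subst (λ b → v ∷ʳ b ∈ spread (λ l' → dyckVectors χ N (deg true χ v) l') (a + deg false χ v) 0) (ℕ.+-identityʳ a)
      (∈-spread⁺ (λ l' → dyckVectors χ N (deg true χ v) l') (deg false χ v) a 0
        (dyckVectors-complete χ N v d' (refl , refl))))

-- Multiset coefficients

multichoose : ℕ → ℕ → ℕ
multichoose n       zero    = 1
multichoose zero    (suc k) = 0
multichoose (suc n) (suc k) = multichoose (suc n) k + multichoose n (suc k)

-- The value for `k - 1`, but 0 rather than 1 at `k = 0`, so that the absorption and summation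
-- formulas hold there too.
multichoose⁻ : ℕ → ℕ → ℕ
multichoose⁻ n zero    = 0
multichoose⁻ n (suc k) = multichoose n k

multichoose-C : ∀ n k → multichoose (suc n) k ≡ (n + k) C k
multichoose-C n zero = refl
multichoose-C zero (suc k) = trans (ℕ.+-identityʳ _) (begin
  multichoose 1 k              ≡⟨ multichoose-C zero k ⟩
  k C k                        ≡⟨ sym (ℕ.+-identityʳ _) ⟩
  k C k + 0                    ≡⟨ cong (k C k +_) (sym (k>n⇒nCk≡0 (ℕ.n<1+n k))) ⟩
  k C k + k C suc k            ≡⟨ nCk+nC[k+1]≡[n+1]C[k+1] k k ⟩
  suc k C suc k                ∎)
  where open ≡-Reasoning
multichoose-C (suc n) (suc k) = begin
  multichoose (suc (suc n)) k + multichoose (suc n) (suc k)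
    ≡⟨ cong₂ _+_ (multichoose-C (suc n) k) (multichoose-C n (suc k)) ⟩
  (suc n + k) C k + (n + suc k) C suc k
    ≡⟨ cong (λ m → (suc n + k) C k + m C suc k) (ℕ.+-suc n k) ⟩
  (suc n + k) C k + (suc n + k) C suc k
    ≡⟨ nCk+nC[k+1]≡[n+1]C[k+1] (suc n + k) k ⟩
  suc (suc n + k) C suc k
    ≡⟨ cong (_C suc k) (sym (ℕ.+-suc (suc n) k)) ⟩
  (suc n + suc k) C suc k ∎
  where open ≡-Reasoning

multichoose-absorb : ∀ n k → n * multichoose (suc n) k ≡ suc k * multichoose n (suc k)
multichoose-absorb zero    k       = sym (ℕ.*-zeroʳ (suc k))
multichoose-absorb (suc n) zero    = begin
  suc n * 1                                 ≡⟨ cong suc (multichoose-absorb n zero) ⟩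
  suc (1 * multichoose n 1)                 ≡⟨⟩
  1 + (multichoose n 1 + 0)                 ≡⟨ sym (ℕ.+-identityʳ _) ⟩
  1 + (multichoose n 1 + 0) + 0             ≡⟨ cong (λ x → 1 + x + 0) (ℕ.+-identityʳ _) ⟩
  1 * multichoose (suc n) 1                 ∎
  where open ≡-Reasoning
multichoose-absorb (suc n) (suc k) = begin
  suc n * (multichoose (2 + n) k + c)
    ≡⟨ ℕ.*-distribˡ-+ (suc n) (multichoose (2 + n) k) c ⟩
  suc n * multichoose (2 + n) k + suc n * c
    ≡⟨ cong (_+ suc n * c) (multichoose-absorb (suc n) k) ⟩
  suc k * c + suc n * c
    ≡⟨ rearrange k n c ⟩
  suc (suc k) * c + n * c
    ≡⟨ cong (suc (suc k) * c +_) (multichoose-absorb n (suc k)) ⟩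
  suc (suc k) * c + suc (suc k) * multichoose n (suc (suc k))
    ≡⟨ sym (ℕ.*-distribˡ-+ (suc (suc k)) c _) ⟩
  suc (suc k) * (c + multichoose n (suc (suc k))) ∎
  where
  open ≡-Reasoning
  c : ℕ
  c = multichoose (suc n) (suc k)
  rearrange : ∀ k n c → suc k * c + suc n * c ≡ suc (suc k) * c + n * c
  rearrange = solve 3 (λ k n c → (con 1 :+ k) :* c :+ (con 1 :+ n) :* c := (con 2 :+ k) :* c :+ n :* c) refl
    where open ℕ-Solver

multichoose⁻-absorb : ∀ n k → n * multichoose⁻ (suc n) k ≡ k * multichoose n k
multichoose⁻-absorb n zero    = ℕ.*-zeroʳ n
multichoose⁻-absorb n (suc k) = multichoose-absorb n k

-- The hockey-stick identity: summing over the degree, as appending a last entry does, raises the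
-- number of variables by one.
sum-multichoose : ∀ n k → sumUpTo (multichoose n) k ≡ multichoose (suc n) k
sum-multichoose n zero    = refl
sum-multichoose n (suc k) = trans (ℕ.+-comm (multichoose n (suc k)) _)
  (cong (_+ multichoose n (suc k)) (sum-multichoose n k))

sum-multichoose⁻ : ∀ n k → sumUpTo (multichoose⁻ n) k ≡ multichoose⁻ (suc n) k
sum-multichoose⁻ n zero          = refl
sum-multichoose⁻ n (suc zero)    = refl
sum-multichoose⁻ n (suc (suc k)) = trans (cong (multichoose n (suc k) +_) (sum-multichoose⁻ n (suc k)))
  (ℕ.+-comm (multichoose n (suc k)) _)

sumUpTo-cong : ∀ {f g : ℕ → ℕ} k → (∀ i → i ≤ k → f i ≡ g i) → sumUpTo f k ≡ sumUpTo g k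
sumUpTo-cong zero    eq = eq 0 z≤n
sumUpTo-cong (suc k) eq =
  cong₂ _+_ (eq (suc k) ℕ.≤-refl) (sumUpTo-cong k (λ i i≤k → eq i (ℕ.m≤n⇒m≤1+n i≤k)))

sumUpTo-+ : ∀ f g k → sumUpTo (λ i → f i + g i) k ≡ sumUpTo f k + sumUpTo g k
sumUpTo-+ f g zero    = refl
sumUpTo-+ f g (suc k) = trans (cong (f (suc k) + g (suc k) +_) (sumUpTo-+ f g k))
  (interchange (f (suc k)) (g (suc k)) _ _)

sumUpTo-*ʳ : ∀ f c k → sumUpTo (λ i → f i * c) k ≡ sumUpTo f k * c
sumUpTo-*ʳ f c zero    = refl
sumUpTo-*ʳ f c (suc k) = trans (cong (f (suc k) * c +_) (sumUpTo-*ʳ f c k))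
  (sym (ℕ.*-distribʳ-+ c (f (suc k)) _))

-- As k * multichoose n k = n * multichoose (suc n) (k ∸ 1), the number of 2-Dyck vectors
-- multichoose n k * multichoose n l * (n ∸ (k + l)) / n takes the form below, with neither division
-- nor subtraction, in which it can be summed.
sum-ballot : ∀ (E : ℕ → ℕ) n p q k →
  (∀ i → i ≤ k → E i + (multichoose⁻ (suc n) i * p + multichoose n i * q) ≡ multichoose n i * p) →
  sumUpTo E k + (multichoose⁻ (suc (suc n)) k * p + multichoose (suc n) k * q) ≡ multichoose (suc n) k * p
sum-ballot E n p q k eq = begin
  sumUpTo E k + (multichoose⁻ (suc (suc n)) k * p + multichoose (suc n) k * q)
    ≡⟨ cong (sumUpTo E k +_) (sym (cong₂ _+_
         (trans (sumUpTo-*ʳ (multichoose⁻ (suc n)) p k) (cong (_* p) (sum-multichoose⁻ (suc n) k)))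
         (trans (sumUpTo-*ʳ (multichoose n) q k) (cong (_* q) (sum-multichoose n k))))) ⟩
  sumUpTo E k + (sumUpTo (λ i → multichoose⁻ (suc n) i * p) k + sumUpTo (λ i → multichoose n i * q) k)
    ≡⟨ sym (trans (sumUpTo-+ E _ k) (cong (sumUpTo E k +_) (sumUpTo-+ (λ i → multichoose⁻ (suc n) i * p) _ k))) ⟩
  sumUpTo (λ i → E i + (multichoose⁻ (suc n) i * p + multichoose n i * q)) k
    ≡⟨ sumUpTo-cong k eq ⟩
  sumUpTo (λ i → multichoose n i * p) k
    ≡⟨ trans (sumUpTo-*ʳ (multichoose n) p k) (cong (_* p) (sum-multichoose n k)) ⟩
  multichoose (suc n) k * p ∎
  where open ≡-Reasoning

-- The number of 2-Dyck vectors of a given bidegree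

dbl≡ : ∀ n → dbl n ≡ n + n
dbl≡ zero    = refl
dbl≡ (suc n) = cong suc (trans (cong suc (dbl≡ n)) (sym (ℕ.+-suc n n)))

alt-dbl : ∀ κ n → alt κ (dbl n) ≡ κ
alt-dbl κ zero    = refl
alt-dbl κ (suc n) = trans (cong (λ b → alt b (dbl n)) (not-involutive κ)) (alt-dbl κ n)

alt-suc-dbl : ∀ κ n → alt κ (suc (dbl n)) ≡ not κ
alt-suc-dbl κ n = alt-dbl (not κ) n

#dyck : (ℕ → Bool) → ℕ → ℕ → ℕ → ℕ
#dyck χ N k l = L.length (dyckVectors χ N k l)

#dyck-true : ∀ χ N k l → χ N ≡ true → k + l + (k + l) ≤ N →
  #dyck χ (suc N) k l ≡ sumUpTo (λ k' → #dyck χ N k' l) k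
#dyck-true χ N k l χN le with k + l + (k + l) ℕ.≤? N
... | no ≰N = ⊥-elim (≰N le)
... | yes _ with χ N
#dyck-true χ N k l refl le | yes _ | true = length-spread (λ k' → dyckVectors χ N k' l) k 0

#dyck-false : ∀ χ N k l → χ N ≡ false → k + l + (k + l) ≤ N →
  #dyck χ (suc N) k l ≡ sumUpTo (λ l' → #dyck χ N k l') l
#dyck-false χ N k l χN le with k + l + (k + l) ℕ.≤? N
... | no ≰N = ⊥-elim (≰N le)
... | yes _ with χ N
#dyck-false χ N k l refl le | yes _ | false = length-spread (λ l' → dyckVectors χ N k l') l 0

#dyck-outside : ∀ χ N k l → ¬ (k + l + (k + l) ≤ N) → #dyck χ (suc N) k l ≡ 0
#dyck-outside χ N k l ≰N with k + l + (k + l) ℕ.≤? N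
... | no  _  = refl
... | yes le = ⊥-elim (≰N le)

≤⇒+≤dbl : ∀ {s n} → s ≤ n → s + s ≤ dbl n
≤⇒+≤dbl {s} {n} s≤n = subst (s + s ≤_) (sym (dbl≡ n)) (ℕ.+-mono-≤ s≤n s≤n)

mutual
  -- For positive `n`, absorption turns this into the count `multichoose n k * multichoose n l`
  -- times `1 - (k + l)/n`; after one more x it is `multichoose (suc n) k * multichoose n l` times
  -- `1 - k/(n + 1) - l/n`. The range includes the line `k + l = n`, where the count is 0 for
  -- positive `n`, because the sums in `#dyck-odd` reach it.
  #dyck-even : ∀ n k l → k + l ≤ n → #dyck (alt true) (dbl n) k l +
    (multichoose⁻ (suc n) k * multichoose n l + multichoose n k * multichoose⁻ (suc n) l)
    ≡ multichoose n k * multichoose n l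
  #dyck-even zero zero zero z≤n = refl
  #dyck-even (suc n) k l k+l≤ with ℕ.m≤n⇒m<n∨m≡n k+l≤
  ... | inj₁ (s≤s k+l≤n) = begin
    #dyck (alt true) (dbl (suc n)) k l
      + (multichoose⁻ (2 + n) k * multichoose (suc n) l + multichoose (suc n) k * multichoose⁻ (2 + n) l)
      ≡⟨ cong₂ _+_
           (#dyck-false (alt true) (suc (dbl n)) k l (alt-suc-dbl true n) (ℕ.m≤n⇒m≤1+n (≤⇒+≤dbl k+l≤n)))
           (exchange (multichoose⁻ (2 + n) k) (multichoose (suc n) l) (multichoose (suc n) k) (multichoose⁻ (2 + n) l)) ⟩
    sumUpTo (λ l' → #dyck (alt true) (suc (dbl n)) k l') l
      + (multichoose⁻ (2 + n) l * multichoose (suc n) k + multichoose (suc n) l * multichoose⁻ (2 + n) k)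
      ≡⟨ sum-ballot (λ l' → #dyck (alt true) (suc (dbl n)) k l') n (multichoose (suc n) k) (multichoose⁻ (2 + n) k) l
           (λ l' l'≤l → #dyck-odd n k l' (ℕ.≤-trans (ℕ.+-monoʳ-≤ k l'≤l) k+l≤n)) ⟩
    multichoose (suc n) l * multichoose (suc n) k
      ≡⟨ ℕ.*-comm (multichoose (suc n) l) _ ⟩
    multichoose (suc n) k * multichoose (suc n) l ∎
    where
    open ≡-Reasoning
    exchange : ∀ a b c d → a * b + c * d ≡ d * c + b * a
    exchange = solve 4 (λ a b c d → a :* b :+ c :* d := d :* c :+ b :* a) refl where open ℕ-Solver
  -- Here the condition at the last variable excludes every vector, and the formula agrees:
  -- multiplied by `suc n`, the two correction terms add up to `(k + l) * (c * d)`, that is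
  -- `suc n * (c * d)`.
  ... | inj₂ k+l≡ = trans (cong (_+ (multichoose⁻ (2 + n) k * d + c * multichoose⁻ (2 + n) l))
      (#dyck-outside (alt true) (suc (dbl n)) k l outside)) boundary
    where
    outside : ¬ (k + l + (k + l) ≤ suc (dbl n))
    outside le rewrite k+l≡ | dbl≡ n | ℕ.+-suc n n = ℕ.1+n≰n le
    open ≡-Reasoning
    c d : ℕ
    c = multichoose (suc n) k
    d = multichoose (suc n) l
    boundary : multichoose⁻ (2 + n) k * d + c * multichoose⁻ (2 + n) l ≡ c * d
    boundary = ℕ.*-cancelˡ-≡ _ _ (suc n) (begin
      suc n * (multichoose⁻ (2 + n) k * d + c * multichoose⁻ (2 + n) l)
        ≡⟨ distribute (suc n) (multichoose⁻ (2 + n) k) d c (multichoose⁻ (2 + n) l) ⟩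
      suc n * multichoose⁻ (2 + n) k * d + c * (suc n * multichoose⁻ (2 + n) l)
        ≡⟨ cong₂ (λ x y → x * d + c * y) (multichoose⁻-absorb (suc n) k) (multichoose⁻-absorb (suc n) l) ⟩
      k * c * d + c * (l * d)
        ≡⟨ collect k c d l ⟩
      (k + l) * (c * d)
        ≡⟨ cong (_* (c * d)) k+l≡ ⟩
      suc n * (c * d) ∎)
      where
      open ℕ-Solver
      distribute : ∀ n a b c d → n * (a * b + c * d) ≡ n * a * b + c * (n * d)
      distribute = solve 5 (λ n a b c d → n :* (a :* b :+ c :* d) := n :* a :* b :+ c :* (n :* d)) refl
      collect : ∀ k c d l → k * c * d + c * (l * d) ≡ (k + l) * (c * d)
      collect = solve 4 (λ k c d l → k :* c :* d :+ c :* (l :* d) := (k :+ l) :* (c :* d)) refl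

  #dyck-odd : ∀ n k l → k + l ≤ n → #dyck (alt true) (suc (dbl n)) k l +
    (multichoose⁻ (suc n) l * multichoose (suc n) k + multichoose n l * multichoose⁻ (2 + n) k)
    ≡ multichoose n l * multichoose (suc n) k
  #dyck-odd n k l k+l≤n = begin
    #dyck (alt true) (suc (dbl n)) k l
      + (multichoose⁻ (suc n) l * multichoose (suc n) k + multichoose n l * multichoose⁻ (2 + n) k)
      ≡⟨ cong₂ _+_
           (#dyck-true (alt true) (dbl n) k l (alt-dbl true n) (≤⇒+≤dbl k+l≤n))
           (exchange (multichoose⁻ (suc n) l) (multichoose (suc n) k) (multichoose n l) (multichoose⁻ (2 + n) k)) ⟩
    sumUpTo (λ k' → #dyck (alt true) (dbl n) k' l) k
      + (multichoose⁻ (2 + n) k * multichoose n l + multichoose (suc n) k * multichoose⁻ (suc n) l)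
      ≡⟨ sum-ballot (λ k' → #dyck (alt true) (dbl n) k' l) n (multichoose n l) (multichoose⁻ (suc n) l) k
           (λ k' k'≤k → #dyck-even n k' l (ℕ.≤-trans (ℕ.+-monoˡ-≤ l k'≤k) k+l≤n)) ⟩
    multichoose (suc n) k * multichoose n l
      ≡⟨ ℕ.*-comm (multichoose (suc n) k) _ ⟩
    multichoose n l * multichoose (suc n) k ∎
    where
    open ≡-Reasoning
    exchange : ∀ a b c d → a * b + c * d ≡ d * c + b * a
    exchange = solve 4 (λ a b c d → a :* b :+ c :* d := d :* c :+ b :* a) refl where open ℕ-Solver

#dyck-bigraded : ∀ n → 1 ≤ n → ∀ k l → k + l ≤ n → n * #dyck (alt true) (dbl n) k l
  ≡ ((n + k ∸ 1) C k) * ((n + l ∸ 1) C l) * (n ∸ (k + l))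
#dyck-bigraded (suc n) _ k l k+l≤ = begin
  suc n * E
    ≡⟨ sym (ℕ.m+n∸n≡m (suc n * E) ((k + l) * (c * d))) ⟩
  suc n * E + (k + l) * (c * d) ∸ (k + l) * (c * d)
    ≡⟨ cong (_∸ (k + l) * (c * d)) multiplied ⟩
  suc n * (c * d) ∸ (k + l) * (c * d)
    ≡⟨ sym (ℕ.*-distribʳ-∸ (c * d) (suc n) (k + l)) ⟩
  (suc n ∸ (k + l)) * (c * d)
    ≡⟨ ℕ.*-comm (suc n ∸ (k + l)) (c * d) ⟩
  c * d * (suc n ∸ (k + l))
    ≡⟨ cong₂ (λ x y → x * y * (suc n ∸ (k + l))) (multichoose-C n k) (multichoose-C n l) ⟩
  ((n + k) C k) * ((n + l) C l) * (suc n ∸ (k + l)) ∎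
  where
  open ≡-Reasoning
  E c d : ℕ
  E = #dyck (alt true) (dbl (suc n)) k l
  c = multichoose (suc n) k
  d = multichoose (suc n) l
  multiplied : suc n * E + (k + l) * (c * d) ≡ suc n * (c * d)
  multiplied = begin
    suc n * E + (k + l) * (c * d)
      ≡⟨ spread-out (suc n * E) k l c d ⟩
    suc n * E + (k * c * d + c * (l * d))
      ≡⟨ cong (suc n * E +_) (sym (cong₂ (λ x y → x * d + c * y)
           (multichoose⁻-absorb (suc n) k) (multichoose⁻-absorb (suc n) l))) ⟩
    suc n * E + (suc n * multichoose⁻ (2 + n) k * d + c * (suc n * multichoose⁻ (2 + n) l))
      ≡⟨ factor (suc n) E (multichoose⁻ (2 + n) k) d c (multichoose⁻ (2 + n) l) ⟩
    suc n * (E + (multichoose⁻ (2 + n) k * d + c * multichoose⁻ (2 + n) l))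
      ≡⟨ cong (suc n *_) (#dyck-even (suc n) k l k+l≤) ⟩
    suc n * (c * d) ∎
    where
    open ℕ-Solver
    spread-out : ∀ m k l c d → m + (k + l) * (c * d) ≡ m + (k * c * d + c * (l * d))
    spread-out = solve 5 (λ m k l c d → m :+ (k :+ l) :* (c :* d) := m :+ (k :* c :* d :+ c :* (l :* d))) refl
    factor : ∀ n E a b c d → n * E + (n * a * b + c * (n * d)) ≡ n * (E + (a * b + c * d))
    factor = solve 6 (λ n E a b c d → n :* E :+ (n :* a :* b :+ c :* (n :* d)) := n :* (E :+ (a :* b :+ c :* d))) refl

-- The total number of 2-Dyck vectors

mono : ℕ → Bool
mono _ = true

-- With one colour the second degree is 0 and the first is the sum of all entries. For positive `N`
-- the count is the ballot number `multichoose N k` times `1 - 2k/N`, which vanishes on the boundary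
-- `k + k = N`.
#dyck-mono : ∀ N k → k + k ≤ N →
  #dyck mono N k 0 + (multichoose⁻ (suc N) k + multichoose⁻ (suc N) k) ≡ multichoose N k
#dyck-mono zero zero z≤n = refl
#dyck-mono (suc N) k k+k≤ with ℕ.m≤n⇒m<n∨m≡n k+k≤
... | inj₁ (s≤s k+k≤N) = begin
  #dyck mono (suc N) k 0 + (multichoose⁻ (2 + N) k + multichoose⁻ (2 + N) k)
    ≡⟨ cong (_+ (multichoose⁻ (2 + N) k + multichoose⁻ (2 + N) k))
         (#dyck-true mono N k 0 refl (subst (λ s → s + s ≤ N) (sym (ℕ.+-identityʳ k)) k+k≤N)) ⟩
  sumUpTo (λ k' → #dyck mono N k' 0) k + (multichoose⁻ (2 + N) k + multichoose⁻ (2 + N) k)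
    ≡⟨ cong (sumUpTo (λ k' → #dyck mono N k' 0) k +_) (sym (cong₂ _+_ (sum-multichoose⁻ (suc N) k) (sum-multichoose⁻ (suc N) k))) ⟩
  sumUpTo (λ k' → #dyck mono N k' 0) k
    + (sumUpTo (multichoose⁻ (suc N)) k + sumUpTo (multichoose⁻ (suc N)) k)
    ≡⟨ sym (trans (sumUpTo-+ (λ k' → #dyck mono N k' 0) _ k)
         (cong (sumUpTo (λ k' → #dyck mono N k' 0) k +_) (sumUpTo-+ (multichoose⁻ (suc N)) _ k))) ⟩
  sumUpTo (λ i → #dyck mono N i 0 + (multichoose⁻ (suc N) i + multichoose⁻ (suc N) i)) k
    ≡⟨ sumUpTo-cong k (λ i i≤k → #dyck-mono N i (ℕ.≤-trans (ℕ.+-mono-≤ i≤k i≤k) k+k≤N)) ⟩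
  sumUpTo (multichoose N) k
    ≡⟨ sum-multichoose N k ⟩
  multichoose (suc N) k ∎
  where open ≡-Reasoning
... | inj₂ k+k≡ = trans (cong (_+ (c⁻ + c⁻)) (#dyck-outside mono N k 0 outside)) boundary
  where
  open ≡-Reasoning
  c⁻ : ℕ
  c⁻ = multichoose⁻ (2 + N) k
  outside : ¬ (k + 0 + (k + 0) ≤ N)
  outside le rewrite ℕ.+-identityʳ k | k+k≡ = ℕ.1+n≰n le
  boundary : c⁻ + c⁻ ≡ multichoose (suc N) k
  boundary = ℕ.*-cancelˡ-≡ _ _ (suc N) (begin
    suc N * (c⁻ + c⁻)                          ≡⟨ ℕ.*-distribˡ-+ (suc N) c⁻ c⁻ ⟩
    suc N * c⁻ + suc N * c⁻                    ≡⟨ cong₂ _+_ (multichoose⁻-absorb (suc N) k) (multichoose⁻-absorb (suc N) k) ⟩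
    k * multichoose (suc N) k + k * multichoose (suc N) k ≡⟨ sym (ℕ.*-distribʳ-+ (multichoose (suc N) k) k k) ⟩
    (k + k) * multichoose (suc N) k            ≡⟨ cong (_* multichoose (suc N) k) k+k≡ ⟩
    suc N * multichoose (suc N) k              ∎)

collect : (ℕ → List A) → ℕ → List A
collect f zero    = f 0
collect f (suc k) = f (suc k) ++ collect f k

length-collect : ∀ (f : ℕ → List A) k → L.length (collect f k) ≡ sumUpTo (λ i → L.length (f i)) k
length-collect f zero    = refl
length-collect f (suc k) = trans (L.length-++ (f (suc k))) (cong (L.length (f (suc k)) +_) (length-collect f k))

∈-collect⁻ : ∀ (f : ℕ → List A) k {x} → x ∈ collect f k → ∃[ i ] (i ≤ k × x ∈ f i)
∈-collect⁻ f zero    x∈ = 0 , z≤n , x∈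
∈-collect⁻ f (suc k) x∈ with ∈-++⁻ (f (suc k)) x∈
... | inj₁ x∈f = suc k , ℕ.≤-refl , x∈f
... | inj₂ x∈' with ∈-collect⁻ f k x∈'
...   | i , i≤k , x∈f = i , ℕ.m≤n⇒m≤1+n i≤k , x∈f

∈-collect⁺ : ∀ (f : ℕ → List A) {i} k {x} → i ≤ k → x ∈ f i → x ∈ collect f k
∈-collect⁺ f zero    z≤n x∈ = x∈
∈-collect⁺ f (suc k) i≤k x∈ with ℕ.m≤n⇒m<n∨m≡n i≤k
... | inj₁ (s≤s i≤k') = ∈-++⁺ʳ (f (suc k)) (∈-collect⁺ f k i≤k' x∈)
... | inj₂ refl       = ∈-++⁺ˡ x∈

collect-unique : ∀ (f : ℕ → List A) → (∀ i → Unique (f i)) →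
  (∀ {i j x} → x ∈ f i → x ∈ f j → i ≡ j) → ∀ k → Unique (collect f k)
collect-unique f uniq inj zero    = uniq 0
collect-unique f uniq inj (suc k) = Unique.++⁺ (uniq (suc k)) (collect-unique f uniq inj k)
  λ (x∈ , x∈') → let (i , i≤k , x∈f) = ∈-collect⁻ f k x∈' in
    ℕ.1+n≰n (subst (_≤ k) (inj x∈f x∈) i≤k)

allDyckVectors : ∀ n → List (Vec ℕ (dbl n))
allDyckVectors n = collect (λ k → dyckVectors mono (dbl n) k 0) n

allDyckVectors-unique : ∀ n → Unique (allDyckVectors n)
allDyckVectors-unique n = collect-unique _ (λ k → dyckVectors-unique mono (dbl n) k 0) inj n
  where
  inj : ∀ {i j x} → x ∈ dyckVectors mono (dbl n) i 0 → x ∈ dyckVectors mono (dbl n) j 0 → i ≡ j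
  inj {i} {j} x∈i x∈j with dyckVectors-sound mono (dbl n) i 0 x∈i | dyckVectors-sound mono (dbl n) j 0 x∈j
  ... | _ , eq , _ | _ , eq' , _ = trans (sym eq) eq'

allDyckVectors-sound : ∀ n {x} → x ∈ allDyckVectors n → Dyck 0 x
allDyckVectors-sound n x∈ with ∈-collect⁻ (λ k → dyckVectors mono (dbl n) k 0) n x∈
... | i , _ , x∈i = proj₁ (dyckVectors-sound mono (dbl n) i 0 x∈i)

allDyckVectors-complete : ∀ n x → Dyck 0 x → x ∈ allDyckVectors n
allDyckVectors-complete n x d = ∈-collect⁺ (λ k → dyckVectors mono (dbl n) k 0) n bound
  (dyckVectors-complete mono (dbl n) x d (refl , deg-false x))
  where
  deg-false : ∀ {N} (x : Vec ℕ N) → deg false mono x ≡ 0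
  deg-false []      = refl
  deg-false (_ ∷ x) = deg-false x
  deg-true : deg true mono x ≡ V.sum x
  deg-true = trans (sym (ℕ.+-identityʳ _)) (trans (cong (deg true mono x +_) (sym (deg-false x))) (deg-sum mono x))
  half : ∀ s n → s + s ≤ dbl n → s ≤ n
  half zero    n       _  = z≤n
  half (suc s) zero    ()
  half (suc s) (suc n) (s≤s le) rewrite ℕ.+-suc s s = s≤s (half s n (s≤s⁻¹ le))
  bound : deg true mono x ≤ n
  bound = subst (_≤ n) (sym deg-true) (half (V.sum x) n (Dyck-sum x d))

-- A 2-Dyck vector of length `2n` extends by exactly one entry to a 2-Dyck vector of length `2n + 1`
-- and sum `n`. So the total is a single ballot number, whose factor `1 - 2n/(2n + 1)` is
-- `1/(2n + 1)`.
#allDyck : ∀ n → (2 * n + 1) * L.length (allDyckVectors n) ≡ (3 * n) C n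
#allDyck n = begin
  (2 * n + 1) * T
    ≡⟨ cong (_* T) (trans (ℕ.+-comm (2 * n) 1) (cong suc (trans (cong (n +_) (ℕ.+-identityʳ n)) (sym (dbl≡ n))))) ⟩
  K * T
    ≡⟨ ℕ.+-cancelʳ-≡ (n * c + n * c) (K * T) c total ⟩
  c
    ≡⟨ multichoose-C (dbl n) n ⟩
  (dbl n + n) C n
    ≡⟨ cong (_C n) (trans (cong (_+ n) (dbl≡ n)) (three n)) ⟩
  (3 * n) C n ∎
  where
  open ≡-Reasoning
  T K c c⁻ : ℕ
  T  = L.length (allDyckVectors n)
  K  = suc (dbl n)
  c  = multichoose K n
  c⁻ = multichoose⁻ (suc K) n
  three : ∀ n → n + n + n ≡ 3 * n
  three = solve 1 (λ n → n :+ n :+ n := con 3 :* n) refl where open ℕ-Solver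
  T≡ : T ≡ #dyck mono K n 0
  T≡ = trans (length-collect _ n)
    (sym (#dyck-true mono (dbl n) n 0 refl (≤⇒+≤dbl (ℕ.≤-reflexive (ℕ.+-identityʳ n)))))
  total : K * T + (n * c + n * c) ≡ c + (n * c + n * c)
  total = begin
    K * T + (n * c + n * c)
      ≡⟨ cong₂ (λ x y → K * T + (x + y)) (sym (multichoose⁻-absorb K n)) (sym (multichoose⁻-absorb K n)) ⟩
    K * T + (K * c⁻ + K * c⁻)
      ≡⟨ sym (trans (ℕ.*-distribˡ-+ K T (c⁻ + c⁻)) (cong (K * T +_) (ℕ.*-distribˡ-+ K c⁻ c⁻))) ⟩
    K * (T + (c⁻ + c⁻))
      ≡⟨ cong (λ x → K * (x + (c⁻ + c⁻))) T≡ ⟩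
    K * (#dyck mono K n 0 + (c⁻ + c⁻))
      ≡⟨ cong (K *_) (#dyck-mono K n (ℕ.m≤n⇒m≤1+n (≤⇒+≤dbl ℕ.≤-refl))) ⟩
    K * c
      ≡⟨ cong (c +_) (trans (cong (_* c) (dbl≡ n)) (ℕ.*-distribʳ-+ c n n)) ⟩
    c + (n * c + n * c) ∎

-- The ideal, the bigrading and the bases

-- Here `s` is the slack left by the pairs already read, counted in factors, hence `s + s` in the
-- units of `Dyck`. The condition at the x of a pair follows from the one at its y.
toDyck : ∀ s (v : Mono n) → (∀ l → 1 ≤ l → l ≤ n → pairSum (L.take l (V.toList v)) ≤ l ∸ 1 + s) →
  Dyck (s + s) (flat v)
toDyck s [] _ = tt
toDyck s ((a , b) ∷ v) h with ℕ.m≤n⇒∃[o]m+o≡n (subst (_≤ s) (ℕ.+-identityʳ (a + b)) (h 1 (s≤s z≤n) (s≤s z≤n)))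
... | r , refl = r + r + (b + b) , first a b r , suc (r + r) , refl ,
  subst (λ t → Dyck (suc t) (flat v)) (ℕ.+-suc r r) (toDyck (suc r) v tail)
  where
  open ℕ-Solver
  first : ∀ a b r → a + b + r + (a + b + r) ≡ r + r + (b + b) + (a + a)
  first = solve 3 (λ a b r → a :+ b :+ r :+ (a :+ b :+ r) := r :+ r :+ (b :+ b) :+ (a :+ a)) refl
  tail : ∀ l → 1 ≤ l → l ≤ _ → pairSum (L.take l (V.toList v)) ≤ l ∸ 1 + suc r
  tail (suc l) _ l≤ = ℕ.+-cancelˡ-≤ (a + b) _ _
    (subst (a + b + pairSum (L.take (suc l) (V.toList v)) ≤_) (shuffle l (a + b) r) (h (suc (suc l)) (s≤s z≤n) (s≤s l≤)))
    where
    shuffle : ∀ l c r → suc l + (c + r) ≡ c + (l + suc r)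
    shuffle = solve 3 (λ l c r → con 1 :+ l :+ (c :+ r) := c :+ (l :+ (con 1 :+ r))) refl

fromDyck : ∀ s (v : Mono n) → Dyck (s + s) (flat v) →
  ∀ l → 1 ≤ l → l ≤ n → pairSum (L.take l (V.toList v)) ≤ l ∸ 1 + s
fromDyck s ((a , b) ∷ v) (s₁ , eq₁ , s₂ , eq₂ , d) (suc l) _ (s≤s l≤n)
  with ℕ.m≤n⇒∃[o]m+o≡n a+b≤s
  where
  twice : suc (s + s) ≡ s₂ + ((a + b) + (a + b))
  twice = trans (cong suc eq₁) (trans (cong (_+ (a + a)) eq₂) (solve 3
    (λ s a b → s :+ (b :+ b) :+ (a :+ a) := s :+ ((a :+ b) :+ (a :+ b))) refl s₂ a b))
    where open ℕ-Solver
  -- The second variable of a pair adds one unit of slack, but twice a sum is even and cannot use it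
  -- up.
  half : ∀ c s → c + c ≤ suc (s + s) → c ≤ s
  half zero    s       _ = z≤n
  half (suc c) zero    (s≤s le) rewrite ℕ.+-suc c c with le
  ... | ()
  half (suc c) (suc s) (s≤s le) rewrite ℕ.+-suc c c | ℕ.+-suc s s = s≤s (half c s (s≤s⁻¹ le))
  a+b≤s : a + b ≤ s
  a+b≤s = half (a + b) s (subst (a + b + (a + b) ≤_) (sym twice) (ℕ.m≤n+m _ s₂))
... | r , refl = step l l≤n
  where
  open ℕ-Solver
  s₂≡ : s₂ ≡ suc (r + r)
  s₂≡ = ℕ.+-cancelʳ-≡ ((b + b) + (a + a)) _ _ (begin
    s₂ + ((b + b) + (a + a))          ≡⟨ sym (ℕ.+-assoc s₂ (b + b) (a + a)) ⟩
    s₂ + (b + b) + (a + a)            ≡⟨ cong (_+ (a + a)) (sym eq₂) ⟩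
    suc (s₁ + (a + a))                ≡⟨ cong suc (sym eq₁) ⟩
    suc (a + b + r + (a + b + r))     ≡⟨ solve 3 (λ a b r → con 1 :+ (a :+ b :+ r :+ (a :+ b :+ r))
                                            := con 1 :+ (r :+ r) :+ ((b :+ b) :+ (a :+ a))) refl a b r ⟩
    suc (r + r) + ((b + b) + (a + a)) ∎)
    where open ≡-Reasoning
  step : ∀ l → l ≤ _ → a + b + pairSum (L.take l (V.toList v)) ≤ l + (a + b + r)
  step zero    _  = ℕ.+-monoʳ-≤ (a + b) z≤n
  step (suc l) l≤ = subst (a + b + pairSum (L.take (suc l) (V.toList v)) ≤_) (shuffle l (a + b) r)
    (ℕ.+-monoʳ-≤ (a + b) (fromDyck (suc r) v
      (subst (λ t → Dyck t (flat v)) (trans (cong suc s₂≡) (sym (cong suc (ℕ.+-suc r r)))) d) (suc l) (s≤s z≤n) l≤))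
    where
    shuffle : ∀ l c r → c + (l + suc r) ≡ suc l + (c + r)
    shuffle = solve 3 (λ l c r → c :+ (l :+ (con 1 :+ r)) := con 1 :+ l :+ (c :+ r)) refl

twoDyck⇒Dyck : ∀ (v : Mono n) → TwoDyck v → Dyck 0 (flat v)
twoDyck⇒Dyck v h = toDyck 0 v (λ l 1≤l l≤n → ℕ.≤-trans (h l 1≤l l≤n) (ℕ.m≤m+n (l ∸ 1) 0))

Dyck⇒twoDyck : ∀ (v : Mono n) → Dyck 0 (flat v) → TwoDyck v
Dyck⇒twoDyck v d l 1≤l l≤n = subst (pairSum (L.take l (V.toList v)) ≤_) (ℕ.+-identityʳ (l ∸ 1)) (fromDyck 0 v d l 1≤l l≤n)

flat-injective : ∀ {v w : Mono n} → flat v ≡ flat w → v ≡ w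
flat-injective {v = v} {w} eq = trans (sym (unflat-flat v)) (trans (cong unflat eq) (unflat-flat w))

δ-flat : ∀ (e m : Mono n) → δ e m ≡ δᵥ (flat e) (flat m)
δ-flat e m with m ≟M e
... | yes refl = sym (δᵥ-refl (flat m))
... | no m≢e   = sym (δᵥ-≢ (λ eq → m≢e (flat-injective eq)))

flat-mulMono : ∀ (m e : Mono n) → flat (mulMono m e) ≡ flat m ⊕ flat e
flat-mulMono []      []      = refl
flat-mulMono (_ ∷ m) (_ ∷ e) = cong (λ v → _ ∷ _ ∷ v) (flat-mulMono m e)

flat-zeroMono : ∀ n → flat (zeroMono n) ≡ zeros (dbl n)
flat-zeroMono zero    = refl
flat-zeroMono (suc n) = cong (λ v → 0 ∷ 0 ∷ v) (flat-zeroMono n)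

-- The empty predicate forces an empty remainder, so the polynomial is exactly a combination of
-- monomial multiples of nonconstant fundamental polynomials.
Ideal : ∀ n → ((Vec ℕ (dbl n) → ℚ) → ℚ) → Set
Ideal n = Spanned true (λ _ → ⊥) NonEmpty

ideal-vanishing : ∀ {ℓ} → Ideal n ℓ → ∀ {φ} → Vanishing true φ → ℓ φ ≡ 0ℚ
ideal-vanishing ([] , gs , [] , ne , eq) {φ} van = trans (eq φ) (trans (ℚ.+-identityˡ _)
  (∑-zero (All.map (λ {g} ne → trans (cong (proj₁ g *ℚ_) (van (proj₁ (proj₂ g)) ne)) (ℚ.*-zeroʳ (proj₁ g))) ne)))

⟪F-scomp⟫ : ∀ c → IsBicomposition c → ∀ (φ : Vec ℕ (dbl n) → ℚ) →
  ⟪ F n c , φ ∘ flat ⟫ ≡ ∑ (fundamental true (dbl n) (scomp c)) φ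
⟪F-scomp⟫ {n} c bic φ = trans (⟪F⟫ n c bic (φ ∘ flat))
  (∑-cong (fundamental true (dbl n) (scomp c)) (λ x → cong φ (flat-unflat {n} x)))

ideal-F : ∀ {c} → IsBicomposition c → NonEmpty c → ∀ m →
  Ideal n (λ φ → ⟪ F n c , (λ e → φ (m ⊕ flat e)) ⟫)
ideal-F {c = c} bic ne m =
  spanned-resp (λ φ → ⟪F-scomp⟫ c bic (λ x → φ (m ⊕ x))) (spanned-generator (scomp-nonEmpty bic ne) m)

coeff-0 : ∀ (p : Poly n) → coeff p (zeroMono n) ≡ ⟪ p , δᵥ (zeros (dbl n)) ∘ flat ⟫
coeff-0 {n} p = trans (coeff-⟪⟫ p (zeroMono n)) (⟪⟫-cong p λ m →
  trans (δ-flat (zeroMono n) m) (cong (λ z → δᵥ z (flat m)) (flat-zeroMono n)))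

zeros-⊕ : ∀ (v : Vec ℕ N) → zeros N ⊕ v ≡ v
zeros-⊕ []      = refl
zeros-⊕ (a ∷ v) = cong (a ∷_) (zeros-⊕ v)

coeff-F-0 : ∀ {c} → IsBicomposition c → NonEmpty c → coeff (F n c) (zeroMono n) ≡ 0ℚ
coeff-F-0 {n} {c} bic ne = trans (coeff-0 (F n c))
  (trans (⟪⟫-cong (F n c) (λ m → cong (δᵥ (zeros (dbl n))) (sym (zeros-⊕ (flat m)))))
    (ideal-vanishing {n} (ideal-F bic ne (zeros (dbl n))) {δᵥ (zeros (dbl n))} (vanishing-δᵥ-zeros true (dbl n))))

-- The empty bicomposition may occur several times in the expansion of `g`, so its coefficients need
-- not vanish one by one. The constant-term functional kills all other terms and therefore shows
-- that their sum is 0.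
ideal-BQSym : ∀ (g : Poly n) → BQSym n g → coeff g (zeroMono n) ≡ 0ℚ → ∀ m →
  Ideal n (λ φ → ⟪ g , (λ e → φ (m ⊕ flat e)) ⟫)
ideal-BQSym {n} g (cs , bics , g≈) g0 m = spanned-resp (λ φ → begin
    ⟪ g , (λ e → φ (m ⊕ flat e)) ⟫
      ≡⟨ expansion (λ e → φ (m ⊕ flat e)) ⟩
    ∑ cs constant *ℚ φ (m ⊕ flat (zeroMono n)) +ℚ ∑ cs (λ t → positive t (λ e → φ (m ⊕ flat e)))
      ≡⟨ cong (λ q → q *ℚ φ (m ⊕ flat (zeroMono n)) +ℚ ∑ cs (λ t → positive t (λ e → φ (m ⊕ flat e)))) constant-0 ⟩
    0ℚ *ℚ φ (m ⊕ flat (zeroMono n)) +ℚ ∑ cs (λ t → positive t (λ e → φ (m ⊕ flat e)))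
      ≡⟨ trans (cong (_+ℚ ∑ cs (λ t → positive t (λ e → φ (m ⊕ flat e)))) (ℚ.*-zeroˡ (φ (m ⊕ flat (zeroMono n))))) (ℚ.+-identityˡ _) ⟩
    ∑ cs (λ t → positive t (λ e → φ (m ⊕ flat e))) ∎)
  (ideal-positive m)
  where
  open ≡-Reasoning
  constant : ℚ × Bivector → ℚ
  constant (q , [])    = q
  constant (q , _ ∷ _) = 0ℚ
  positive : ℚ × Bivector → (Mono n → ℚ) → ℚ
  positive (q , [])    ψ = 0ℚ
  positive (q , b ∷ c) ψ = q *ℚ ⟪ F n (b ∷ c) , ψ ⟫
  decompose : ∀ t ψ → proj₁ t *ℚ ⟪ F n (proj₂ t) , ψ ⟫ ≡ constant t *ℚ ψ (zeroMono n) +ℚ positive t ψ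
  decompose (q , [])    ψ = trans (cong (q *ℚ_) (⟪1P⟫ ψ)) (sym (ℚ.+-identityʳ _))
  decompose (q , b ∷ c) ψ = sym (trans (cong (_+ℚ q *ℚ ⟪ F n (b ∷ c) , ψ ⟫) (ℚ.*-zeroˡ (ψ (zeroMono n)))) (ℚ.+-identityˡ _))
  expansion : ∀ ψ → ⟪ g , ψ ⟫ ≡ ∑ cs constant *ℚ ψ (zeroMono n) +ℚ ∑ cs (λ t → positive t ψ)
  expansion ψ = begin
    ⟪ g , ψ ⟫
      ≡⟨ ≈P⇒⟪⟫ g (sumP (L.map (λ t → scaleP (proj₁ t) (F n (proj₂ t))) cs)) g≈ ψ ⟩
    ⟪ sumP (L.map (λ t → scaleP (proj₁ t) (F n (proj₂ t))) cs) , ψ ⟫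
      ≡⟨ trans (⟪⟫-sumP (L.map (λ t → scaleP (proj₁ t) (F n (proj₂ t))) cs) ψ) (∑-map _ cs _) ⟩
    ∑ cs (λ t → ⟪ scaleP (proj₁ t) (F n (proj₂ t)) , ψ ⟫)
      ≡⟨ ∑-cong cs (λ t → trans (⟪⟫-scale (proj₁ t) (F n (proj₂ t)) ψ) (decompose t ψ)) ⟩
    ∑ cs (λ t → constant t *ℚ ψ (zeroMono n) +ℚ positive t ψ)
      ≡⟨ trans (∑-+ cs _ _) (cong (_+ℚ ∑ cs (λ t → positive t ψ)) (∑-*ʳ (ψ (zeroMono n)) cs constant)) ⟩
    ∑ cs constant *ℚ ψ (zeroMono n) +ℚ ∑ cs (λ t → positive t ψ) ∎
  ideal-positive : ∀ m → Ideal n (λ φ → ∑ cs (λ t → positive t (λ e → φ (m ⊕ flat e))))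
  ideal-positive m = spanned-∑ (All.map (λ {t} → term t) bics)
    where
    term : ∀ t → IsBicomposition (proj₂ t) → Ideal n (λ φ → positive t (λ e → φ (m ⊕ flat e)))
    term (q , [])    _   = spanned-0
    term (q , b ∷ c) bic = spanned-* q (ideal-F bic cons m)
  δ₀ : Mono n → ℚ
  δ₀ e = δᵥ (zeros (dbl n)) (zeros (dbl n) ⊕ flat e)
  δ₀-zero : δ₀ (zeroMono n) ≡ 1ℚ
  δ₀-zero = trans (cong (δᵥ (zeros (dbl n))) (trans (zeros-⊕ (flat (zeroMono n))) (flat-zeroMono n))) (δᵥ-refl (zeros (dbl n)))
  constant-0 : ∑ cs constant ≡ 0ℚ
  constant-0 = begin
    ∑ cs constant
      ≡⟨ sym (trans (cong₂ (λ x y → ∑ cs constant *ℚ x +ℚ y) δ₀-zero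
           (ideal-vanishing {n} (ideal-positive (zeros (dbl n))) {δᵥ (zeros (dbl n))} (vanishing-δᵥ-zeros true (dbl n))))
           (trans (ℚ.+-identityʳ _) (ℚ.*-identityʳ _))) ⟩
    ∑ cs constant *ℚ δ₀ (zeroMono n) +ℚ ∑ cs (λ t → positive t δ₀)
      ≡⟨ sym (expansion δ₀) ⟩
    ⟪ g , δ₀ ⟫
      ≡⟨ ⟪⟫-cong g (λ e → cong (δᵥ (zeros (dbl n))) (zeros-⊕ (flat e))) ⟩
    ⟪ g , δᵥ (zeros (dbl n)) ∘ flat ⟫
      ≡⟨ trans (sym (coeff-0 g)) g0 ⟩
    0ℚ ∎

InI⇒ideal : ∀ (p : Poly n) → InI n p → Ideal n (λ φ → ⟪ p , φ ∘ flat ⟫)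
InI⇒ideal {n} p (gs , bqs , p≈) = spanned-resp
  (λ φ → begin
    ⟪ p , φ ∘ flat ⟫
      ≡⟨ ≈P⇒⟪⟫ p (sumP (L.map (λ t → proj₁ t *P proj₂ t) gs)) p≈ (φ ∘ flat) ⟩
    ⟪ sumP (L.map (λ t → proj₁ t *P proj₂ t) gs) , φ ∘ flat ⟫
      ≡⟨ trans (⟪⟫-sumP (L.map (λ t → proj₁ t *P proj₂ t) gs) (φ ∘ flat)) (∑-map _ gs _) ⟩
    ∑ gs (λ t → ⟪ proj₁ t *P proj₂ t , φ ∘ flat ⟫)
      ≡⟨ ∑-cong gs (λ t → trans (⟪⟫-*P (proj₁ t) (proj₂ t) (φ ∘ flat))
           (⟪⟫-cong (proj₁ t) (λ m → ⟪⟫-cong (proj₂ t) (λ e → cong φ (flat-mulMono m e))))) ⟩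
    ∑ gs (λ t → ⟪ proj₁ t , (λ m → ⟪ proj₂ t , (λ e → φ (flat m ⊕ flat e)) ⟫) ⟫) ∎)
  (spanned-∑ (All.map (λ {t} bq → spanned-∑ (All.universal
    (λ s → spanned-* (proj₁ s) (ideal-BQSym (proj₂ t) (proj₁ bq) (proj₂ bq) (flat (proj₂ s)))) (proj₁ t))) bqs))
  where open ≡-Reasoning

ideal⇒InI : ∀ (p : Poly n) → Ideal n (λ φ → ⟪ p , φ ∘ flat ⟫) → InI n p
ideal⇒InI {n} p ([] , gs , [] , ne , eq) = L.map generator gs ,
  All.map⁺ (All.map (λ {g} ne → quasisymmetric (proj₂ (proj₂ g)) ,
    coeff-F-0 (isBicomposition (proj₂ (proj₂ g))) (bicomposition-nonEmpty ne)) ne) ,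
  ⟪⟫⇒≈P p (sumP (L.map (λ t → proj₁ t *P proj₂ t) (L.map generator gs))) (λ φ → begin
    ⟪ p , φ ⟫
      ≡⟨ ⟪⟫-cong p (λ m → cong φ (sym (unflat-flat m))) ⟩
    ⟪ p , φ ∘ unflat ∘ flat ⟫
      ≡⟨ trans (eq (φ ∘ unflat)) (ℚ.+-identityˡ _) ⟩
    combine true gs (φ ∘ unflat)
      ≡⟨ ∑-cong gs (λ g → sym (evaluate g φ)) ⟩
    ∑ gs (λ g → ⟪ proj₁ (generator g) *P proj₂ (generator g) , φ ⟫)
      ≡⟨ sym (trans (⟪⟫-sumP (L.map (λ t → proj₁ t *P proj₂ t) (L.map generator gs)) φ)
           (trans (∑-map _ (L.map generator gs) _) (∑-map generator gs _))) ⟩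
    ⟪ sumP (L.map (λ t → proj₁ t *P proj₂ t) (L.map generator gs)) , φ ⟫ ∎)
  where
  open ≡-Reasoning
  generator : Term (dbl n) → Poly n × Poly n
  generator (q , m , w) = (q , unflat m) ∷ [] , F n (bicomposition w)
  quasisymmetric : ∀ w → BQSym n (F n (bicomposition w))
  quasisymmetric w = (1ℚ , bicomposition w) ∷ [] , isBicomposition w ∷ [] ,
    ⟪⟫⇒≈P (F n (bicomposition w)) (scaleP 1ℚ (F n (bicomposition w)) +P []) (λ φ →
      sym (trans (∑-++ (scaleP 1ℚ (F n (bicomposition w))) [] _)
      (trans (ℚ.+-identityʳ _) (trans (⟪⟫-scale 1ℚ (F n (bicomposition w)) φ) (ℚ.*-identityˡ _)))))
  evaluate : ∀ g φ → ⟪ proj₁ (generator g) *P proj₂ (generator g) , φ ⟫ ≡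
    proj₁ g *ℚ ∑ (fundamental true (dbl n) (proj₂ (proj₂ g))) (λ v → φ (unflat (proj₁ (proj₂ g) ⊕ v)))
  evaluate (q , m , w) φ = begin
    ⟪ ((q , unflat m) ∷ []) *P F n (bicomposition w) , φ ⟫
      ≡⟨ trans (⟪⟫-*P ((q , unflat m) ∷ []) (F n (bicomposition w)) φ) (ℚ.+-identityʳ _) ⟩
    q *ℚ ⟪ F n (bicomposition w) , φ ∘ mulMono (unflat m) ⟫
      ≡⟨ cong (q *ℚ_) (⟪F⟫ n (bicomposition w) (isBicomposition w) _) ⟩
    q *ℚ ∑ (fundamental true (dbl n) (scomp (bicomposition w))) (λ v → φ (mulMono (unflat m) (unflat v)))
      ≡⟨ cong (λ w' → q *ℚ ∑ (fundamental true (dbl n) w') (λ v → φ (mulMono (unflat m) (unflat v)))) (scomp-bicomposition w) ⟩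
    q *ℚ ∑ (fundamental true (dbl n) w) (λ v → φ (mulMono (unflat m) (unflat v)))
      ≡⟨ cong (q *ℚ_) (∑-cong (fundamental true (dbl n) w) (λ v → cong φ (sym (unflat-⊕ {n} m v)))) ⟩
    q *ℚ ∑ (fundamental true (dbl n) w) (λ v → φ (unflat (m ⊕ v))) ∎

-- The bigrading of the ideal

bidegree? : ∀ k l (e : Mono n) → Dec (xdeg e ≡ k × ydeg e ≡ l)
bidegree? k l e = (xdeg e ℕ.≟ k) ×-dec (ydeg e ℕ.≟ l)

restrict : ℕ → ℕ → (Mono n → ℚ) → Mono n → ℚ
restrict k l φ e = if does (bidegree? k l e) then φ e else 0ℚ

restrict-yes : ∀ {k l} φ (e : Mono n) → xdeg e ≡ k × ydeg e ≡ l → restrict k l φ e ≡ φ e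
restrict-yes {k = k} {l} φ e d = cong (λ b → if b then φ e else 0ℚ) (dec-true (bidegree? k l e) d)

restrict-no : ∀ {k l} φ (e : Mono n) → ¬ (xdeg e ≡ k × ydeg e ≡ l) → restrict k l φ e ≡ 0ℚ
restrict-no {k = k} {l} φ e ¬d = cong (λ b → if b then φ e else 0ℚ) (dec-false (bidegree? k l e) ¬d)

⟪bicomp⟫ : ∀ k l (p : Poly n) φ → ⟪ bicomp k l p , φ ⟫ ≡ ⟪ p , restrict k l φ ⟫
⟪bicomp⟫ k l [] φ = refl
⟪bicomp⟫ k l ((q , e) ∷ p) φ with xdeg e ℕ.≟ k | ydeg e ℕ.≟ l
... | yes x | yes y = cong₂ (λ a b → q *ℚ a +ℚ b) (sym (restrict-yes φ e (x , y))) (⟪bicomp⟫ k l p φ)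
... | yes x | no ¬y = trans (⟪bicomp⟫ k l p φ) (sym (trans
  (cong (λ a → q *ℚ a +ℚ ⟪ p , restrict k l φ ⟫) (restrict-no φ e (λ (_ , y) → ¬y y)))
  (trans (cong (_+ℚ ⟪ p , restrict k l φ ⟫) (ℚ.*-zeroʳ q)) (ℚ.+-identityˡ _))))
... | no ¬x | _     = trans (⟪bicomp⟫ k l p φ) (sym (trans
  (cong (λ a → q *ℚ a +ℚ ⟪ p , restrict k l φ ⟫) (restrict-no φ e (λ (x , _) → ¬x x)))
  (trans (cong (_+ℚ ⟪ p , restrict k l φ ⟫) (ℚ.*-zeroʳ q)) (ℚ.+-identityˡ _))))

bicomp-All : ∀ k l {P : Mono n → Set} (p : Poly n) → All (λ t → P (proj₂ t)) p →
  All (λ t → P (proj₂ t) × xdeg (proj₂ t) ≡ k × ydeg (proj₂ t) ≡ l) (bicomp k l p)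
bicomp-All k l []            []         = []
bicomp-All k l ((q , e) ∷ p) (pe ∷ pes) with xdeg e ℕ.≟ k | ydeg e ℕ.≟ l
... | yes x | yes y = (pe , x , y) ∷ bicomp-All k l p pes
... | yes x | no  _ = bicomp-All k l p pes
... | no  _ | _     = bicomp-All k l p pes

-- `BiHom` speaks of coefficients, while the list may contain cancelling terms of other bidegrees.
-- So `bicomp k l p` and `p` are compared by coefficients, not term by term.
⟪bihom⟫ : ∀ {k l} (p : Poly n) → BiHom k l p → ∀ φ → ⟪ p , restrict k l φ ⟫ ≡ ⟪ p , φ ⟫
⟪bihom⟫ {n} {k} {l} p hom φ = trans (sym (⟪bicomp⟫ k l p φ)) (≈P⇒⟪⟫ (bicomp k l p) p same-coeff φ)
  where
  same-coeff : bicomp k l p ≈P p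
  same-coeff e = trans (coeff-⟪⟫ (bicomp k l p) e) (trans (⟪bicomp⟫ k l p (δ e)) restricted)
    where
    restricted : ⟪ p , restrict k l (δ e) ⟫ ≡ coeff p e
    restricted with bidegree? k l e
    ... | yes d = trans (⟪⟫-cong p (λ m → inside m (m ≟M e))) (sym (coeff-⟪⟫ p e))
      where
      elsewhere : ∀ m → m ≢ e → Dec (xdeg m ≡ k × ydeg m ≡ l) → restrict k l (δ e) m ≡ δ e m
      elsewhere m m≢e (yes d') = restrict-yes (δ e) m d'
      elsewhere m m≢e (no ¬d') = trans (restrict-no (δ e) m ¬d') (sym (δ-≢ e m m≢e))
      inside : ∀ m → Dec (m ≡ e) → restrict k l (δ e) m ≡ δ e m
      inside m (yes refl) = restrict-yes (δ e) e d
      inside m (no  m≢e)  = elsewhere m m≢e (bidegree? k l m)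
    ... | no ¬d = trans (∑-zero (All.universal vanish p)) (sym zero-coeff)
      where
      outside : ∀ m → Dec (xdeg m ≡ k × ydeg m ≡ l) → restrict k l (δ e) m ≡ 0ℚ
      outside m (yes d') = trans (restrict-yes (δ e) m d') (δ-≢ e m (λ where refl → ¬d d'))
      outside m (no ¬d') = restrict-no (δ e) m ¬d'
      vanish : ∀ t → proj₁ t *ℚ restrict k l (δ e) (proj₂ t) ≡ 0ℚ
      vanish (q , m) = trans (cong (q *ℚ_) (outside m (bidegree? k l m))) (ℚ.*-zeroʳ q)
      zero-coeff : coeff p e ≡ 0ℚ
      zero-coeff with coeff p e ℚ.≟ 0ℚ
      ... | yes eq = eq
      ... | no neq = ⊥-elim (¬d (hom e neq))

-- A monomial multiple of a fundamental polynomial is bihomogeneous, so restriction to one bidegree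
-- either keeps it whole or kills it.
ideal-bicomp : ∀ (p : Poly n) k l →
  Ideal n (λ φ → ⟪ p , φ ∘ flat ⟫) → Ideal n (λ φ → ⟪ bicomp k l p , φ ∘ flat ⟫)
ideal-bicomp {n} p k l ([] , gs , [] , ne , eq) = spanned-resp (λ φ → begin
    ⟪ bicomp k l p , φ ∘ flat ⟫
      ≡⟨ ⟪bicomp⟫ k l p (φ ∘ flat) ⟩
    ⟪ p , restrict k l (φ ∘ flat) ⟫
      ≡⟨ ⟪⟫-cong p (λ m → cong (restrict k l (φ ∘ flat)) (sym (unflat-flat m))) ⟩
    ⟪ p , restrict k l (φ ∘ flat) ∘ unflat ∘ flat ⟫
      ≡⟨ trans (eq (restrict k l (φ ∘ flat) ∘ unflat)) (ℚ.+-identityˡ _) ⟩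
    combine true gs (restrict k l (φ ∘ flat) ∘ unflat) ∎)
  (spanned-∑ (All.map (λ {g} ne → spanned-* (proj₁ g) (term (proj₁ (proj₂ g)) (proj₂ (proj₂ g)) ne)) ne))
  where
  open ≡-Reasoning
  term : ∀ m w → NonEmpty w → Ideal n (λ φ →
    ∑ (fundamental true (dbl n) w) (λ v → restrict k l (φ ∘ flat) (unflat (m ⊕ v))))
  term m w ne with (deg true (alt true) m + sdeg true w ℕ.≟ k) ×-dec (deg false (alt true) m + sdeg false w ℕ.≟ l)
  ... | yes (x , y) = spanned-resp
    (λ φ → ∑-congAll (All.map (λ {v} (dx , dy) → trans
        (restrict-yes (φ ∘ flat) (unflat (m ⊕ v))
          (trans (xdeg-unflat {n} (m ⊕ v)) (trans (deg-⊕ true (alt true) m v) (trans (cong (deg true (alt true) m +_) dx) x)) ,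
           trans (ydeg-unflat {n} (m ⊕ v)) (trans (deg-⊕ false (alt true) m v) (trans (cong (deg false (alt true) m +_) dy) y))))
        (cong φ (flat-unflat {n} (m ⊕ v))))
      (All.zip (fundamental-deg true true (dbl n) w , fundamental-deg false true (dbl n) w))))
    (spanned-generator ne m)
  ... | no ¬xy = spanned-resp
    (λ φ → ∑-zero (All.map (λ {v} (dx , dy) → restrict-no (φ ∘ flat) (unflat (m ⊕ v)) λ (x , y) → ¬xy
        (trans (cong (deg true (alt true) m +_) (sym dx))
           (trans (sym (deg-⊕ true (alt true) m v)) (trans (sym (xdeg-unflat {n} (m ⊕ v))) x)) ,
         trans (cong (deg false (alt true) m +_) (sym dy))
           (trans (sym (deg-⊕ false (alt true) m v)) (trans (sym (ydeg-unflat {n} (m ⊕ v))) y))))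
      (All.zip (fundamental-deg true true (dbl n) w , fundamental-deg false true (dbl n) w))))
    spanned-0

inI-bicomp : ∀ (p : Poly n) → InI n p → ∀ k l → InI n (bicomp k l p)
inI-bicomp p p∈I k l = ideal⇒InI (bicomp k l p) (ideal-bicomp p k l (InI⇒ideal p p∈I))

inI-resp : ∀ (p p' : Poly n) → (∀ φ → ⟪ p' , φ ⟫ ≡ ⟪ p , φ ⟫) → InI n p → InI n p'
inI-resp p p' eq (gs , bq , p≈) = gs , bq , λ e → trans (⟪⟫⇒≈P p' p eq e) (p≈ e)

twoDyck-spanning : ∀ (p : Poly n) → ∃[ r ] (All (λ t → TwoDyck (proj₂ t)) r × InI n (p -P r))
twoDyck-spanning {n} p with reducible-poly true 0 (L.map (λ t → proj₁ t , flat (proj₂ t)) p)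
... | r , gs , dr , eg , eq = r' ,
  All.map⁺ (All.map (λ {t} d → Dyck⇒twoDyck (unflat {n} (proj₂ t)) (subst (Dyck 0) (sym (flat-unflat {n} (proj₂ t))) d)) dr) ,
  ideal⇒InI (p -P r') ([] , gs , [] , All.map proj₁ eg , λ φ → begin
    ⟪ p -P r' , φ ∘ flat ⟫
      ≡⟨ ⟪⟫-minus p r' (φ ∘ flat) ⟩
    ⟪ p , φ ∘ flat ⟫ +ℚ (-ℚ ⟪ r' , φ ∘ flat ⟫)
      ≡⟨ cong₂ (λ a b → a +ℚ (-ℚ b)) (sym (∑-map _ p _))
           (trans (∑-map _ r _) (⟪⟫-cong r (λ v → cong φ (flat-unflat {n} v)))) ⟩
    ⟪ L.map (λ t → proj₁ t , flat (proj₂ t)) p , φ ⟫ +ℚ (-ℚ ⟪ r , φ ⟫)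
      ≡⟨ cong (_+ℚ (-ℚ ⟪ r , φ ⟫)) (eq φ) ⟩
    (⟪ r , φ ⟫ +ℚ combine true gs φ) +ℚ (-ℚ ⟪ r , φ ⟫)
      ≡⟨ cancel ⟪ r , φ ⟫ (combine true gs φ) ⟩
    0ℚ +ℚ combine true gs φ ∎)
  where
  open ≡-Reasoning
  r' : Poly n
  r' = L.map (λ t → proj₁ t , unflat (proj₂ t)) r
  cancel : ∀ a b → (a +ℚ b) +ℚ (-ℚ a) ≡ 0ℚ +ℚ b
  cancel = solve 2 (λ a b → (a :+ b) :+ (:- a) := con 0ℚ :+ b) refl where open +-*-Solver

twoDyck-independent : ∀ (r : Poly n) → All (λ t → TwoDyck (proj₂ t)) r → InI n r → r ≈P 0P
twoDyck-independent {n} r dr r∈I e with separate n (flat e)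
... | separates φ van agrees = begin
  coeff r e
    ≡⟨ coeff-⟪⟫ r e ⟩
  ⟪ r , δ e ⟫
    ≡⟨ ∑-congAll (All.map (λ {t} d → cong (proj₁ t *ℚ_)
         (trans (δ-flat e (proj₂ t)) (agrees (flat (proj₂ t)) (twoDyck⇒Dyck (proj₂ t) d)))) dr) ⟩
  ⟪ r , φ ∘ flat ⟫
    ≡⟨ ideal-vanishing {n} (InI⇒ideal r r∈I) {φ} van ⟩
  0ℚ ∎
  where open ≡-Reasoning

-- Bases given by lists of monomials

basisVectors : (ms : List (Mono n)) → Vec (Poly n) (L.length ms)
basisVectors ms = V.map monoP (V.fromList ms)

combination : (ms : List (Mono n)) → Vec ℚ (L.length ms) → (Mono n → ℚ) → ℚ
combination []       []       φ = 0ℚ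
combination (m ∷ ms) (q ∷ qs) φ = q *ℚ φ m +ℚ combination ms qs φ

⟪lincomb⟫ : ∀ (ms : List (Mono n)) qs φ → ⟪ lincomb qs (basisVectors ms) , φ ⟫ ≡ combination ms qs φ
⟪lincomb⟫ []       []       φ = refl
⟪lincomb⟫ (m ∷ ms) (q ∷ qs) φ =
  cong₂ _+ℚ_ (cong (_*ℚ φ m) (ℚ.*-identityʳ q)) (⟪lincomb⟫ ms qs φ)

lincomb-All : ∀ {P : Mono n → Set} (ms : List (Mono n)) qs → All P ms →
  All (λ t → P (proj₂ t)) (lincomb qs (basisVectors ms))
lincomb-All []       []       []         = []
lincomb-All (m ∷ ms) (q ∷ qs) (pm ∷ pms) = pm ∷ lincomb-All ms qs pms

combination-∉ : ∀ (ms : List (Mono n)) qs m → All (m ≢_) ms → combination ms qs (δ m) ≡ 0ℚ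
combination-∉ []        []       m []        = refl
combination-∉ (m' ∷ ms) (q ∷ qs) m (ne ∷ nes) = cong₂ _+ℚ_
  (trans (cong (q *ℚ_) (δ-≢ m m' (λ eq → ne (sym eq)))) (ℚ.*-zeroʳ q)) (combination-∉ ms qs m nes)

combination-lookup : ∀ (ms : List (Mono n)) → Unique ms → ∀ qs i →
  combination ms qs (δ (V.lookup (V.fromList ms) i)) ≡ V.lookup qs i
combination-lookup (m ∷ ms) (ne ∷ u) (q ∷ qs) zero = trans
  (cong₂ _+ℚ_ (trans (cong (q *ℚ_) (δ-refl m)) (ℚ.*-identityʳ q)) (combination-∉ ms qs m ne))
  (ℚ.+-identityʳ q)
combination-lookup (m ∷ ms) (ne ∷ u) (q ∷ qs) (suc i) = trans
  (cong₂ _+ℚ_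
    (trans (cong (q *ℚ_) (δ-≢ (V.lookup (V.fromList ms) i) m (All-lookup ms ne i))) (ℚ.*-zeroʳ q))
    (combination-lookup ms u qs i))
  (ℚ.+-identityˡ _)
  where
  All-lookup : ∀ {P : Mono _ → Set} ms → All P ms → ∀ i → P (V.lookup (V.fromList ms) i)
  All-lookup (_ ∷ ms) (p ∷ ps) zero    = p
  All-lookup (_ ∷ ms) (p ∷ ps) (suc i) = All-lookup ms ps i

combination-map : ∀ (ms : List (Mono n)) (f : Mono n → ℚ) φ →
  combination ms (V.map f (V.fromList ms)) φ ≡ ∑ ms (λ m → f m *ℚ φ m)
combination-map []       f φ = refl
combination-map (m ∷ ms) f φ = cong (f m *ℚ φ m +ℚ_) (combination-map ms f φ)

∑-δ : ∀ (ms : List (Mono n)) → Unique ms → ∀ {e} → e ∈ ms → ∀ (φ : Mono n → ℚ) →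
  ∑ ms (λ m → δ m e *ℚ φ m) ≡ φ e
∑-δ (m ∷ ms) (ne ∷ u) (here refl) φ = trans
  (cong₂ _+ℚ_ (trans (cong (_*ℚ φ m) (δ-refl m)) (ℚ.*-identityˡ (φ m)))
    (∑-zero (All.map (λ {m'} ne → trans (cong (_*ℚ φ m') (δ-≢ m' m ne)) (ℚ.*-zeroˡ (φ m'))) ne)))
  (ℚ.+-identityʳ (φ m))
∑-δ (m ∷ ms) (ne ∷ u) {e} (there e∈) φ = trans
  (cong₂ _+ℚ_ (trans (cong (_*ℚ φ m) (δ-≢ m e (λ eq → All.lookup ne e∈ (sym eq)))) (ℚ.*-zeroˡ (φ m))) (∑-δ ms u e∈ φ))
  (ℚ.+-identityˡ (φ e))

expand : ∀ (ms : List (Mono n)) → Unique ms → ∀ (r : Poly n) → All (λ t → proj₂ t ∈ ms) r → ∀ φ →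
  ⟪ r , φ ⟫ ≡ ⟪ lincomb (V.map (coeff r) (V.fromList ms)) (basisVectors ms) , φ ⟫
expand ms u r r∈ φ = sym (begin
  ⟪ lincomb (V.map (coeff r) (V.fromList ms)) (basisVectors ms) , φ ⟫
    ≡⟨ trans (⟪lincomb⟫ ms _ φ) (combination-map ms (coeff r) φ) ⟩
  ∑ ms (λ m → coeff r m *ℚ φ m)
    ≡⟨ ∑-cong ms (λ m → trans (cong (_*ℚ φ m) (coeff-⟪⟫ r m)) (sym (∑-*ʳ (φ m) r _))) ⟩
  ∑ ms (λ m → ∑ r (λ t → proj₁ t *ℚ δ m (proj₂ t) *ℚ φ m))
    ≡⟨ ∑-swap ms r _ ⟩
  ∑ r (λ t → ∑ ms (λ m → proj₁ t *ℚ δ m (proj₂ t) *ℚ φ m))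
    ≡⟨ ∑-congAll (All.map (λ {t} t∈ → trans
         (trans (∑-cong ms (λ m → ℚ.*-assoc (proj₁ t) (δ m (proj₂ t)) (φ m))) (∑-*ˡ (proj₁ t) ms _))
         (cong (proj₁ t *ℚ_) (∑-δ ms u t∈ φ))) r∈) ⟩
  ⟪ r , φ ⟫ ∎)
  where open ≡-Reasoning

-- Independence holds for any list of distinct 2-Dyck monomials, so only spanning depends on `S`.
-- This serves the whole ring and each bidegree alike.
isBasis : ∀ (S : Poly n → Set) (ms : List (Mono n)) → Unique ms → All TwoDyck ms →
  (∀ p → S p → ∃[ r ] (All (λ t → proj₂ t ∈ ms) r × InI n (p -P r))) →
  IsBasisMod (InI n) S (basisVectors ms)
isBasis {n} S ms u dms span = spanning , independent
  where
  open ≡-Reasoning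
  spanning : ∀ p → S p → ∃[ qs ] InI n (p -P lincomb qs (basisVectors ms))
  spanning p sp with span p sp
  ... | r , r∈ , p-r∈I = qs , inI-resp (p -P r) (p -P lincomb qs (basisVectors ms)) (λ φ → begin
      ⟪ p -P lincomb qs (basisVectors ms) , φ ⟫
        ≡⟨ ⟪⟫-minus p (lincomb qs (basisVectors ms)) φ ⟩
      ⟪ p , φ ⟫ +ℚ (-ℚ ⟪ lincomb qs (basisVectors ms) , φ ⟫)
        ≡⟨ cong (λ x → ⟪ p , φ ⟫ +ℚ (-ℚ x)) (sym (expand ms u r r∈ φ)) ⟩
      ⟪ p , φ ⟫ +ℚ (-ℚ ⟪ r , φ ⟫)
        ≡⟨ sym (⟪⟫-minus p r φ) ⟩
      ⟪ p -P r , φ ⟫ ∎) p-r∈I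
    where
    qs : Vec ℚ (L.length ms)
    qs = V.map (coeff r) (V.fromList ms)
  independent : ∀ qs → InI n (lincomb qs (basisVectors ms)) → ∀ i → V.lookup qs i ≡ 0ℚ
  independent qs inI i = begin
    V.lookup qs i
      ≡⟨ sym (combination-lookup ms u qs i) ⟩
    combination ms qs (δ (V.lookup (V.fromList ms) i))
      ≡⟨ sym (⟪lincomb⟫ ms qs _) ⟩
    ⟪ lincomb qs (basisVectors ms) , δ (V.lookup (V.fromList ms) i) ⟫
      ≡⟨ sym (coeff-⟪⟫ (lincomb qs (basisVectors ms)) _) ⟩
    coeff (lincomb qs (basisVectors ms)) (V.lookup (V.fromList ms) i)
      ≡⟨ twoDyck-independent (lincomb qs (basisVectors ms)) (lincomb-All ms qs dms) inI _ ⟩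
    0ℚ ∎

unflat-injective : ∀ {v w : Vec ℕ (dbl n)} → unflat {n} v ≡ unflat w → v ≡ w
unflat-injective {n} {v} {w} eq = trans (sym (flat-unflat {n} v)) (trans (cong flat eq) (flat-unflat {n} w))

∈-unflat : ∀ {vs : List (Vec ℕ (dbl n))} {e} → flat e ∈ vs → e ∈ L.map unflat vs
∈-unflat {vs = vs} {e} e∈ = subst (_∈ L.map unflat vs) (unflat-flat e) (∈-map⁺ unflat e∈)

unflat-twoDyck : ∀ (vs : List (Vec ℕ (dbl n))) → (∀ {v} → v ∈ vs → Dyck 0 v) → All TwoDyck (L.map (unflat {n}) vs)
unflat-twoDyck {n} vs sound = All.map⁺ (All.tabulate λ {v} v∈ →
  Dyck⇒twoDyck (unflat {n} v) (subst (Dyck 0) (sym (flat-unflat {n} v)) (sound v∈)))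

basis : ∀ n → ∃[ N ] (((2 * n + 1) * N ≡ (3 * n) C n) × ∃[ bs ] IsBasisMod {n} {N} (InI n) (λ _ → ⊤) bs)
basis n = L.length ms , trans (cong ((2 * n + 1) *_) (L.length-map unflat (allDyckVectors n))) (#allDyck n) ,
  basisVectors ms , isBasis (λ _ → ⊤) ms
    (Unique.map⁺ (unflat-injective {n}) (allDyckVectors-unique n))
    (unflat-twoDyck (allDyckVectors n) (allDyckVectors-sound n))
    λ p _ → let (r , dr , p-r∈I) = twoDyck-spanning p in
      r , All.map (λ {t} d → ∈-unflat (allDyckVectors-complete n (flat (proj₂ t)) (twoDyck⇒Dyck (proj₂ t) d))) dr , p-r∈I
  where
  ms : List (Mono n)
  ms = L.map unflat (allDyckVectors n)

bihom-monoP : ∀ {k l} (m : Mono n) → xdeg m ≡ k × ydeg m ≡ l → BiHom k l (monoP m)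
bihom-monoP m d e c≢0 with m ≟M e
... | yes refl = d
... | no  _    = ⊥-elim (c≢0 refl)

-- The component `bicomp k l r` of a 2-Dyck remainder `r` is again 2-Dyck. As `p` is its own
-- component, `p` minus that component is the component of `p -P r`, which stays in the ideal.
twoDyck-spanning-bihom : ∀ {k l} (p : Poly n) → BiHom k l p →
  ∃[ r ] (All (λ t → TwoDyck (proj₂ t) × xdeg (proj₂ t) ≡ k × ydeg (proj₂ t) ≡ l) r × InI n (p -P r))
twoDyck-spanning-bihom {n} {k} {l} p hom = let (r , dr , p-r∈I) = twoDyck-spanning p in
  bicomp k l r , bicomp-All k l r dr ,
  inI-resp (bicomp k l (p -P r)) (p -P bicomp k l r) (difference r) (inI-bicomp (p -P r) p-r∈I k l)
  where
  open ≡-Reasoning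
  difference : ∀ r φ → ⟪ p -P bicomp k l r , φ ⟫ ≡ ⟪ bicomp k l (p -P r) , φ ⟫
  difference r φ = begin
    ⟪ p -P bicomp k l r , φ ⟫
      ≡⟨ ⟪⟫-minus p (bicomp k l r) φ ⟩
    ⟪ p , φ ⟫ +ℚ (-ℚ ⟪ bicomp k l r , φ ⟫)
      ≡⟨ cong₂ (λ a b → a +ℚ (-ℚ b)) (sym (⟪bihom⟫ p hom φ)) (⟪bicomp⟫ k l r φ) ⟩
    ⟪ p , restrict k l φ ⟫ +ℚ (-ℚ ⟪ r , restrict k l φ ⟫)
      ≡⟨ sym (⟪⟫-minus p r (restrict k l φ)) ⟩
    ⟪ p -P r , restrict k l φ ⟫
      ≡⟨ sym (⟪bicomp⟫ k l (p -P r) φ) ⟩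
    ⟪ bicomp k l (p -P r) , φ ⟫ ∎

bidegree-basis : ∀ n → 1 ≤ n → ∀ k l → k + l ≤ n →
  ∃[ N ] ((n * N ≡ ((n + k ∸ 1) C k) * ((n + l ∸ 1) C l) * (n ∸ (k + l)))
    × ∃[ bs ] ((∀ i → BiHom k l (V.lookup bs i)) × IsBasisMod {n} {N} (InI n) (BiHom k l) bs))
bidegree-basis n 1≤n k l k+l≤ = L.length ms ,
  trans (cong (n *_) (L.length-map unflat vs)) (#dyck-bigraded n 1≤n k l k+l≤) ,
  basisVectors ms , homogeneous ,
  isBasis (BiHom k l) ms (Unique.map⁺ (unflat-injective {n}) (dyckVectors-unique (alt true) (dbl n) k l))
    (unflat-twoDyck vs (λ v∈ → proj₁ (dyckVectors-sound (alt true) (dbl n) k l v∈))) spanning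
  where
  vs : List (Vec ℕ (dbl n))
  vs = dyckVectors (alt true) (dbl n) k l
  ms : List (Mono n)
  ms = L.map unflat vs
  degrees : All (λ m → xdeg m ≡ k × ydeg m ≡ l) ms
  degrees = All.map⁺ (All.tabulate λ {v} v∈ →
    let (_ , x , y) = dyckVectors-sound (alt true) (dbl n) k l v∈
    in trans (xdeg-unflat {n} v) x , trans (ydeg-unflat {n} v) y)
  homogeneous : ∀ i → BiHom k l (V.lookup (basisVectors ms) i)
  homogeneous = go ms degrees
    where
    go : ∀ ms → All (λ m → xdeg m ≡ k × ydeg m ≡ l) ms → ∀ i → BiHom k l (V.lookup (basisVectors ms) i)
    go (m ∷ ms) (d ∷ ds) zero    = bihom-monoP m d
    go (m ∷ ms) (d ∷ ds) (suc i) = go ms ds i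
  member : ∀ e → TwoDyck e × xdeg e ≡ k × ydeg e ≡ l → e ∈ ms
  member e (d , x , y) = ∈-unflat (dyckVectors-complete (alt true) (dbl n) (flat e) (twoDyck⇒Dyck e d)
    (trans (sym (xdeg-unflat {n} (flat e))) (trans (cong xdeg (unflat-flat e)) x) ,
     trans (sym (ydeg-unflat {n} (flat e))) (trans (cong ydeg (unflat-flat e)) y)))
  spanning : ∀ p → BiHom k l p → ∃[ r ] (All (λ t → proj₂ t ∈ ms) r × InI n (p -P r))
  spanning p hom = let (r , dr , p-r∈I) = twoDyck-spanning-bihom p hom in
    r , All.map (λ {t} → member (proj₂ t)) dr , p-r∈I

theorem2 : (n : ℕ) → 1 ≤ n →
    ((∀ (p : Poly n) → ∃[ r ] (All (λ t → TwoDyck (proj₂ t)) r × InI n (p -P r)))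
    × (∀ (r : Poly n) → All (λ t → TwoDyck (proj₂ t)) r → InI n r → r ≈P 0P))
    × (∃[ N ] (((2 * n + 1) * N ≡ (3 * n) C n)
    × ∃[ bs ] IsBasisMod {n} {N} (InI n) (λ _ → ⊤) bs))
    × (∀ (p : Poly n) → InI n p → ∀ k l → InI n (bicomp k l p))
    × (∀ k l → k + l ≤ n →
    ∃[ N ] ((n * N ≡ ((n + k ∸ 1) C k) * ((n + l ∸ 1) C l) * (n ∸ (k + l)))
    × ∃[ bs ] ((∀ i → BiHom k l (lookup bs i))
    × IsBasisMod {n} {N} (InI n) (BiHom k l) bs)))
theorem2 n 1≤n = (twoDyck-spanning , twoDyck-independent) , basis n , inI-bicomp , bidegree-basis n 1≤n
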